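{- There is a randomized CONGEST algorithm that, given an undirected unweighted $n$-vertex graph $G$ of diameter $D$ and girth $g$ (length of a shortest cycle), computes with high probability a value $\tilde{g}$ with $g\le \tilde{g}\le \left(2-\frac{1}{g}\right)g$ (the length of a cycle of $G$), in $\tilde{O}(\sqrt{n}+D)$ rounds.
   Context: CONGEST model: the communication network is the undirected graph $G=(V,E)$, $n=|V|$; each node has a unique identifier in $\{0,\dots,n-1\}$, knows its own and its neighbours' identifiers; computation proceeds in synchronous rounds in which each node may send a message of $O(\log n)$ bits to each neighbour; local computation is free. $D$ is the hop diameter of $G$. $\tilde{O}$ hides polylogarithmic factors in $n$. -}

module Defs where

open import Data.Bool.Base using (Bool; true; false; T; if_then_else_)
open import Data.Fin.Base using (Fin; toℕ)
open import Data.Integer.Base using (+_)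
open import Data.List.Base as List using (List; []; _∷_; length; filterᵇ)
open import Data.List.Relation.Unary.Unique.Propositional using (Unique)
open import Data.Nat.Base
open import Data.Nat.Logarithm using (⌈log₂_⌉)
open import Data.Nat.Properties using
  (m^n≢0; ≤ᵇ-reflects-≤; ≤-<-trans; *-mono-<; n<1+n; m≤n⇒m≤1+n; ≰⇒>)
open import Data.Product.Base using (Σ-syntax; ∃-syntax; _×_; _,_)
open import Data.Rational.Base as ℚ using (ℚ; 0ℚ; 1ℚ; ½)
open import Data.Vec.Base as Vec using (Vec; []; _∷_)
open import Relation.Nullary.Reflects using (ofʸ; ofⁿ)
open import Relation.Binary.PropositionalEquality using (_≡_)

-- The vertices are the identifiers
-- 0, …, n-1 themselves, so quantifying over all graphs also quantifies over
-- all assignments of identifiers to nodes.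

record Graph (n : ℕ) : Set where
  field
    adj    : Fin n → Fin n → Bool
    sym    : ∀ u v → adj u v ≡ adj v u
    irrefl : ∀ u → adj u u ≡ false

  Adj : Fin n → Fin n → Set
  Adj u v = T (adj u v)

  neighbours : Fin n → List (Fin n)
  neighbours u = filterᵇ (adj u) (List.allFin n)

open Graph public using (Adj; neighbours)

module _ {n : ℕ} (G : Graph n) where

  data Walk : Fin n → Fin n → ℕ → Set where
    []  : ∀ {u} → Walk u u 0
    _∷_ : ∀ {u v w ℓ} → Adj G u v → Walk v w ℓ → Walk u w (suc ℓ)

  vertices : ∀ {u v ℓ} → Walk u v ℓ → List (Fin n)
  vertices {u} []      = u ∷ []
  vertices {u} (_ ∷ p) = u ∷ vertices p

  -- A cycle is a simple path with at least two edges, together with an edge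
  -- joining its end to its start.
  data Cycle : ℕ → Set where
    close : ∀ {u v ℓ} (p : Walk u v ℓ) → Unique (vertices p) → 2 ≤ ℓ →
            Adj G v u → Cycle (suc ℓ)

  IsGirth : ℕ → Set
  IsGirth g = Cycle g × (∀ ℓ → Cycle ℓ → g ≤ ℓ)

  IsDistance : Fin n → Fin n → ℕ → Set
  IsDistance u v d = Walk u v d × (∀ ℓ → Walk u v ℓ → d ≤ ℓ)

  -- The largest distance; in particular the graph is connected.
  IsDiameter : ℕ → Set
  IsDiameter D = (∀ u v → ∃[ d ] IsDistance u v d × d ≤ D)
               × (∃[ u ] ∃[ v ] IsDistance u v D)

-- Computations that toss finitely many independent fair coins.

data Rand (A : Set) : Set where
  ret  : A → Rand A
  flip : Rand A → Rand A → Rand A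

infixl 1 _>>=_

_>>=_ : ∀ {A B} → Rand A → (A → Rand B) → Rand B
ret a    >>= f = f a
flip l r >>= f = flip (l >>= f) (r >>= f)

sequence : ∀ {A n} → Vec (Rand A) n → Rand (Vec A n)
sequence []       = ret []
sequence (x ∷ xs) = x >>= λ a → sequence xs >>= λ as → ret (a ∷ as)

Always : ∀ {A} → (A → Set) → Rand A → Set
Always P (ret a)    = P a
Always P (flip l r) = Always P l × Always P r

Pr : ∀ {A} → (A → Bool) → Rand A → ℚ
Pr E (ret a)    = if E a then 1ℚ else 0ℚ
Pr E (flip l r) = ½ ℚ.* (Pr E l ℚ.+ Pr E r)

-- P has probability at least q.  P need not come with a decision procedure,
-- so the probability is that of a decidable event contained in P.
ProbAtLeast : ∀ {A} → ℚ → (A → Set) → Rand A → Set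
ProbAtLeast {A} q P x =
  Σ[ E ∈ (A → Bool) ] (∀ a → T (E a) → P a) × q ℚ.≤ Pr E x

-- 1 - 1 / nᶜ
whp : (n : ℕ) .{{_ : NonZero n}} → ℕ → ℚ
whp n c = 1ℚ ℚ.- ℚ._/_ (+ 1) (n ^ c) {{m^n≢0 n c}}

-- The empty bit string stands for not sending anything.
Message : Set
Message = List Bool

data Status (State : Set) : Set where
  running : State → Status State
  halted  : (output : ℕ) → Status State

-- The program run by every node.  It is uniform: initially a node knows only
-- its own identifier and those of its neighbours (not n, D or g).
record Algorithm : Set₁ where
  field
    State : Set
    init  : (self : ℕ) (nbrs : List ℕ) → Rand State
    -- message for the neighbour with the given identifier
    send  : State → ℕ → Message
    -- the messages arriving in a round, each with its sender's identifier
    step  : State → List (ℕ × Message) → Rand (Status State)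

module _ (A : Algorithm) {n : ℕ} (G : Graph n) where
  open Algorithm A

  Config : Set
  Config = Vec (Status State) n

  start : Rand Config
  start = sequence (Vec.tabulate λ u →
    init (toℕ u) (List.map toℕ (neighbours G u)) >>= λ s → ret (running s))

  message : Config → Fin n → Fin n → Message
  message σ u v with Vec.lookup σ u
  ... | running s = send s (toℕ v)
  ... | halted _  = []

  inbox : Config → Fin n → List (ℕ × Message)
  inbox σ u = List.map (λ v → toℕ v , message σ v u) (neighbours G u)

  stepNode : Config → Fin n → Rand (Status State)
  stepNode σ u with Vec.lookup σ u
  ... | running s = step s (inbox σ u)
  ... | halted o  = ret (halted o)

  round : Config → Rand Config
  round σ = sequence (Vec.tabulate (stepNode σ))

  run : ℕ → Rand Config
  run zero    = start
  run (suc t) = run t >>= round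

  -- With b constant this is the O(log n)-bit limit; it is imposed on every
  -- execution, not only with high probability.
  Bandwidth : ℕ → Set
  Bandwidth b = ∀ t → Always
    (λ σ → ∀ u v → Adj G u v → length (message σ u v) ≤ b * ⌈log₂ n ⌉)
    (run t)

  AllHalted : Config → Set
  AllHalted σ = ∀ u → ∃[ o ] Vec.lookup σ u ≡ halted o

  AllOutput : ℕ → Config → Set
  AllOutput o σ = ∀ u → Vec.lookup σ u ≡ halted o

⌊√_⌋ : ℕ → ℕ
⌊√ zero  ⌋ = 0
⌊√ suc n ⌋ = next ⌊√ n ⌋
  where
  next : ℕ → ℕ
  next s = if suc s * suc s ≤ᵇ suc n then suc s else s

⌊√⌋-correct : ∀ n → ⌊√ n ⌋ * ⌊√ n ⌋ ≤ n × n < suc ⌊√ n ⌋ * suc ⌊√ n ⌋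
⌊√⌋-correct zero = z≤n , s≤s z≤n
⌊√⌋-correct (suc n) with ⌊√ n ⌋ | ⌊√⌋-correct n
... | s | s²≤n , n<[1+s]²
  with suc s * suc s ≤ᵇ suc n | ≤ᵇ-reflects-≤ (suc s * suc s) (suc n)
... | true  | ofʸ le  = le , ≤-<-trans n<[1+s]² (*-mono-< (n<1+n (suc s)) (n<1+n (suc s)))
... | false | ofⁿ nle = m≤n⇒m≤1+n s²≤n , ≰⇒> nle

{-# OPTIONS --safe #-}

-- Identifiers are 0, …, n - 1, so node 0 acts as the leader.  A wave from node
-- 0 lets every node learn the eccentricity h of node 0 and n at the same round
-- 3 (h + 1); from then on all nodes follow a common schedule.  Node 0 draws
-- Õ(√n) random identifiers, and "source detection" (each round a node announces
-- the least (distance, source) pair not yet announced) spreads them.  A second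
-- source detection runs from all vertices, the non-sampled ones starting with a
-- handicap 2 h + 1, so that a node learns its distance to all sampled vertices
-- and to the ≈ √n nearest vertices.  A node x that hears of a source from two
-- neighbours, at distances not above its own, closes a walk through x on which
-- the neighbours are joined avoiding x.  On a shortest cycle such an x exists
-- with walk length at most 2 g - 1: with k = ⌊ (g - 1) / 2 ⌋, either all k-balls
-- around the cycle are small and a cycle vertex serves as the source, or one is
-- large and probably contains a sampled vertex; x is the vertex of the cycle
-- farthest from the source.  The x with the shortest walk is agreed upon by
-- gossip, and a third source detection, from the neighbours of x in G - x, finds
-- the length of a shortest cycle through x exactly.

module Submission where

open import Defs
open import Data.Bool.Base using (Bool; true; false; T; if_then_else_; not; _∧_)
open import Data.Bool.Properties using (T?; T-∧; ∧-comm)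
open import Data.Empty using (⊥; ⊥-elim)
open import Data.Fin.Base as Fin using (Fin; toℕ)
open import Data.Fin.Properties as Fin using (toℕ<n; toℕ-injective)
open import Data.Integer.Base using (+_)
open import Data.List.Base as List using (List; []; _∷_; _++_; map; filter; foldr; length; cartesianProduct; allFin)
open import Data.List.Properties using (length-++; map-cong; map-∘; length-map; ++-identityʳ)
open import Data.List.Membership.Propositional using (_∈_; _∉_; find)
open import Data.List.Membership.Propositional.Properties
open import Data.List.Relation.Unary.All as All using (All; []; _∷_)
open import Data.List.Relation.Unary.Any as Any using (Any; here; there; any?)
open import Data.List.Relation.Unary.Unique.Propositional using (Unique)
open import Data.List.Relation.Unary.AllPairs using ([]; _∷_)
open import Data.Nat.Base hiding (_/_)
open import Data.Nat.Base as ℕ using () renaming (_/_ to _div_)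
open import Data.Nat.Binary.Base as ℕᵇ using (ℕᵇ; 2[1+_]; 1+[2_])
open import Data.Nat.Binary.Properties as ℕᵇ using ()
open import Data.Nat.DivMod hiding (_/_; _div_; _mod_; result)
open import Data.Nat.Induction using (<-wellFounded)
open import Data.Nat.Logarithm using (⌈log₂_⌉; ⌈log₂⌉-mono-≤; ⌈log₂⌈n/2⌉⌉≡⌈log₂n⌉∸1)
open import Data.Nat.Properties hiding (_≟_)
open import Data.Nat.Properties as ℕ using ()
open import Data.Nat.Tactic.RingSolver using (solve-∀)
open import Data.Product.Base using (Σ-syntax; ∃-syntax; _×_; _,_; proj₁; proj₂)
open import Data.Rational.Base as ℚ using (ℚ; mkℚ; 0ℚ; 1ℚ; ½; _/_)
import Data.Rational.Properties as ℚ
import Data.Rational.Solver as ℚ-Solver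
import Data.Integer.Base as ℤ
import Data.Integer.Properties as ℤ
open import Data.Nat.Coprimality as Coprime using (1-coprimeTo)
open import Data.Sum.Base using (_⊎_; inj₁; inj₂)
open import Data.Unit.Base using (tt)
open import Data.Vec.Base as Vec using (Vec; []; _∷_)
open import Data.Vec.Properties as Vec using (lookup∘tabulate)
open import Function.Base using (_∘_; id; case_of_)
open import Function.Bundles using (Equivalence)
open import Induction.WellFounded using (Acc; acc)
open import Relation.Binary.PropositionalEquality using (_≡_; _≢_; refl; sym; trans; cong; cong₂; subst; subst₂; module ≡-Reasoning)
open import Relation.Nullary using (¬_; Dec; yes; no; contradiction; does; ¬?; _×-dec_; _→-dec_)
open import Relation.Nullary.Decidable using (map′)
import Data.List.Membership.DecPropositional as DecMembership
import Data.List.Relation.Unary.Unique.DecPropositional as UniqueDec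
open DecMembership ℕ._≟_ using (_∈?_)

-- Why a third detection: the loop found at `x` need not be a cycle, as the two walks to the source
-- may share vertices. It only certifies that two distinct neighbours of `x` are joined in `G - x`.
-- A shortest walk joining two neighbours there is a simple path, which `x` closes to a cycle. Why
-- `2 g - 1`: a source within `k` of a cycle vertex is within `k + ⌈ (g - 1) / 2 ⌉ = g - 1` of the
-- whole cycle. For one neighbour of the farthest vertex the bound is one less, so the loop has
-- length at most `(g - 1) + (g - 2) + 2`. Why `√n`: the handicap exceeds every distance, so sampled
-- sources wait only for each other, and any other source waits for them and for the vertices of a
-- ball. This costs `m + K` rounds, and hitting every set of `K` vertices takes about
-- `(n / K) c log n` draws; `K ≈ √n` balances the two. Why one node draws: the sample size is then
-- fixed, and given one vector of draws the execution is deterministic. Time and bandwidth hold for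
-- each such vector, and probability enters only through the chance that the draws miss a fixed set.

by-≡ : ∀ {m n} k → m + k ≡ n → m ≤ n
by-≡ {m} k refl = m≤m+n m k

-- Minima and maxima of lists.

foldr-⊓-≤ : ∀ d xs {x} → x ∈ xs → foldr _⊓_ d xs ≤ x
foldr-⊓-≤ d (y ∷ xs) (here refl) = m⊓n≤m y _
foldr-⊓-≤ d (y ∷ xs) (there x∈) = ≤-trans (m⊓n≤n y _) (foldr-⊓-≤ d xs x∈)

foldr-⊓-≤ᵈ : ∀ d xs → foldr _⊓_ d xs ≤ d
foldr-⊓-≤ᵈ d []       = ≤-refl
foldr-⊓-≤ᵈ d (y ∷ xs) = ≤-trans (m⊓n≤n y _) (foldr-⊓-≤ᵈ d xs)

foldr-⊓-sel : ∀ d xs → foldr _⊓_ d xs ≡ d ⊎ foldr _⊓_ d xs ∈ xs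
foldr-⊓-sel d []       = inj₁ refl
foldr-⊓-sel d (y ∷ xs) with ⊓-sel y (foldr _⊓_ d xs)
... | inj₁ eq = inj₂ (here eq)
... | inj₂ eq with foldr-⊓-sel d xs
...   | inj₁ eq′ = inj₁ (trans eq eq′)
...   | inj₂ i   = inj₂ (there (subst (_∈ xs) (sym eq) i))

foldr-⊔-≥ : ∀ d xs {x} → x ∈ xs → x ≤ foldr _⊔_ d xs
foldr-⊔-≥ d (y ∷ xs) (here refl) = m≤m⊔n y _
foldr-⊔-≥ d (y ∷ xs) (there x∈) = ≤-trans (foldr-⊔-≥ d xs x∈) (m≤n⊔m y _)

foldr-⊔-≤ : ∀ d xs {b} → d ≤ b → (∀ {x} → x ∈ xs → x ≤ b) → foldr _⊔_ d xs ≤ b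
foldr-⊔-≤ d []       d≤ f = d≤
foldr-⊔-≤ d (y ∷ xs) d≤ f = ⊔-lub (f (here refl)) (foldr-⊔-≤ d xs d≤ (f ∘ there))

remove : ∀ {x : ℕ} {xs} → x ∈ xs →
  ∃[ ys ] suc (length ys) ≡ length xs × (∀ {y} → y ≢ x → y ∈ xs → y ∈ ys)
remove {xs = _ ∷ xs} (here refl) = xs , refl , λ where
  y≢x (here refl) → contradiction refl y≢x
  y≢x (there y∈)  → y∈
remove {xs = z ∷ _} (there x∈) with remove x∈
... | ys , eq , f = z ∷ ys , cong suc eq , λ where
  y≢x (here refl) → here refl
  y≢x (there y∈)  → there (f y≢x y∈)

module _ {n : ℕ} (G : Graph n) where

  ∈-neighbours⁺ : ∀ {u v} → Adj G u v → v ∈ neighbours G u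
  ∈-neighbours⁺ {u} {v} a = ∈-filter⁺ (T? ∘ Graph.adj G u) (∈-allFin v) a

  ∈-neighbours⁻ : ∀ {u v} → v ∈ neighbours G u → Adj G u v
  ∈-neighbours⁻ {u} v∈ = proj₂ (∈-filter⁻ (T? ∘ Graph.adj G u) {xs = allFin n} v∈)

  Adj-sym : ∀ {u v} → Adj G u v → Adj G v u
  Adj-sym {u} {v} = subst T (Graph.sym G u v)

  Adj-irrefl : ∀ {u} → ¬ Adj G u u
  Adj-irrefl {u} = subst T (Graph.irrefl G u)

-- Source detection

-- Keys are natural numbers D * suc N + s: the residue s names a source and
-- the quotient D is a distance estimate.  One hop adds suc N.

module Keys (N : ℕ) where

  keys : List ℕ → List (ℕ × ℕ) → List ℕ
  keys ini log = ini ++ map (λ e → proj₂ e + suc N) log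

  -- A class that was announced becomes eligible again when a smaller key of it arrives later.
  Eligible : List ℕ → List ℕ → ℕ → Set
  Eligible ks sent κ = κ ∉ sent × All (λ κ′ → κ′ % suc N ≡ κ % suc N → κ ≤ κ′) ks

  eligible? : ∀ ks sent κ → Dec (Eligible ks sent κ)
  eligible? ks sent κ =
    ¬? (κ ∈? sent) ×-dec All.all? (λ κ′ → (κ′ % suc N ℕ.≟ κ % suc N) →-dec (κ ≤? κ′)) ks

  -- 0 stands for no key, suc κ for the key κ.
  least : List ℕ → ℕ
  least []       = 0
  least (x ∷ xs) = suc (foldr _⊓_ x xs)

  least-∈ : ∀ xs {κ} → least xs ≡ suc κ → κ ∈ xs
  least-∈ (x ∷ xs) refl with foldr-⊓-sel x xs
  ... | inj₁ eq = here eq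
  ... | inj₂ i  = there i

  least-≤ : ∀ xs {x} → x ∈ xs → ∃[ κ ] least xs ≡ suc κ × κ ≤ x
  least-≤ (x ∷ xs) (here refl) = _ , refl , foldr-⊓-≤ᵈ x xs
  least-≤ (x ∷ xs) (there i)   = _ , refl , foldr-⊓-≤ x xs i

  pick : List ℕ → List ℕ → ℕ
  pick ks sent = least (filter (eligible? ks sent) ks)

  heard : List (ℕ × ℕ) → List (ℕ × ℕ)
  heard []                = []
  heard ((y , zero) ∷ ms)  = heard ms
  heard ((y , suc κ) ∷ ms) = (y , κ) ∷ heard ms

  ∈-heard⁺ : ∀ {ms y κ} → (y , suc κ) ∈ ms → (y , κ) ∈ heard ms
  ∈-heard⁺ {_ ∷ _}            (here refl) = here refl
  ∈-heard⁺ {(_ , zero) ∷ _}  (there i)   = ∈-heard⁺ i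
  ∈-heard⁺ {(_ , suc _) ∷ _} (there i)   = there (∈-heard⁺ i)

  ∈-heard⁻ : ∀ ms {y κ} → (y , κ) ∈ heard ms → (y , suc κ) ∈ ms
  ∈-heard⁻ ((_ , zero) ∷ ms)  i           = there (∈-heard⁻ ms i)
  ∈-heard⁻ ((_ , suc _) ∷ ms) (here refl) = here refl
  ∈-heard⁻ ((_ , suc _) ∷ ms) (there i)   = there (∈-heard⁻ ms i)

  record-sent : ℕ → List ℕ → List ℕ
  record-sent zero    sent = sent
  record-sent (suc κ) sent = κ ∷ sent

  extend : Bool → List (ℕ × ℕ) → List (ℕ × ℕ) → List (ℕ × ℕ)
  extend live ms log = if live then heard ms ++ log else log

module Flood (N : ℕ) (G : Graph (suc N)) (live : Fin (suc N) → Bool)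
             (ini : Fin (suc N) → List ℕ) where
  open Keys N

  mutual
    log : ℕ → Fin (suc N) → List (ℕ × ℕ)
    log zero    v = []
    log (suc t) v =
      extend (live v) (map (λ u → toℕ u , out t u) (neighbours G v)) (log t v)

    sent : ℕ → Fin (suc N) → List ℕ
    sent zero    v = []
    sent (suc t) v = record-sent (out t v) (sent t v)

    out : ℕ → Fin (suc N) → ℕ
    out t v = pick (keys (ini v) (log t v)) (sent t v)

  known : ℕ → Fin (suc N) → List ℕ
  known t v = keys (ini v) (log t v)

  -- The time-free ideal: the keys that would arrive if every node passed on everything. What is
  -- known at any time is compared with it.
  data Reach : Fin (suc N) → ℕ → Set where
    origin : ∀ {x κ} → T (live x) → κ ∈ ini x → Reach x κ
    hop    : ∀ {x y κ} → T (live x) → Adj G x y → Reach y κ → Reach x (κ + suc N)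

  log-mono : ∀ {t v e} → e ∈ log t v → e ∈ log (suc t) v
  log-mono {t} {v} i with live v
  ... | true  = ∈-++⁺ʳ _ i
  ... | false = i

  sent-mono : ∀ {t v κ} → κ ∈ sent t v → κ ∈ sent (suc t) v
  sent-mono {t} {v} i with out t v
  ... | zero  = i
  ... | suc _ = there i

  known-mono : ∀ {t v κ} → κ ∈ known t v → κ ∈ known (suc t) v
  known-mono {t} {v} i with ∈-++⁻ (ini v) i
  ... | inj₁ j = ∈-++⁺ˡ j
  ... | inj₂ j with ∈-map⁻ _ j
  ...   | e , e∈ , refl = ∈-++⁺ʳ (ini v) (∈-map⁺ _ (log-mono {t} e∈))

  ∈-sent-new : ∀ {t v κ} → out t v ≡ suc κ → κ ∈ sent (suc t) v
  ∈-sent-new {t} {v} eq rewrite eq = here refl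

  ∈-sent⁻ : ∀ {t v κ} → κ ∈ sent (suc t) v → out t v ≡ suc κ ⊎ κ ∈ sent t v
  ∈-sent⁻ {t} {v} i with out t v | i
  ... | zero  | j         = inj₂ j
  ... | suc _ | here refl = inj₁ refl
  ... | suc _ | there j   = inj₂ j

  sent⇒known : ∀ t {v κ} → κ ∈ sent t v → κ ∈ known t v
  sent⇒known (suc t) {v} {κ} i with ∈-sent⁻ {t} i
  ... | inj₂ j  = known-mono {t} (sent⇒known t j)
  ... | inj₁ eq = known-mono {t} (proj₁ (∈-filter⁻ (eligible? (known t v) (sent t v)) {xs = known t v}
                    (least-∈ (filter (eligible? (known t v) (sent t v)) (known t v)) eq)))

  sent⇒log : ∀ t {v u κ} → T (live v) → Adj G v u → κ ∈ sent t u → (toℕ u , κ) ∈ log t v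
  sent⇒log (suc t) {v} {u} {κ} lv a i with ∈-sent⁻ {t} i
  ... | inj₂ j  = log-mono {t} (sent⇒log t lv a j)
  ... | inj₁ eq with live v
  ...   | true = ∈-++⁺ˡ (∈-heard⁺ (subst (λ z → (toℕ u , z) ∈ map (λ w → toℕ w , out t w) (neighbours G v))
                          eq (∈-map⁺ _ (∈-neighbours⁺ G a))))

  log⇒sent : ∀ t {v y κ} → (y , κ) ∈ log t v →
    ∃[ u ] y ≡ toℕ u × T (live v) × Adj G v u × κ ∈ sent t u
  log⇒sent (suc t) {v} {y} {κ} i = aux (live v) refl i
    where
    old : (y , κ) ∈ log t v → ∃[ u ] y ≡ toℕ u × T (live v) × Adj G v u × κ ∈ sent (suc t) u
    old j with log⇒sent t j
    ... | u , eq , lv , a , k = u , eq , lv , a , sent-mono {t} k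
    aux : ∀ b → b ≡ live v → (y , κ) ∈ extend b (map (λ u → toℕ u , out t u) (neighbours G v)) (log t v) →
      ∃[ u ] y ≡ toℕ u × T (live v) × Adj G v u × κ ∈ sent (suc t) u
    aux false _  j = old j
    aux true  lv j with ∈-++⁻ (heard (map (λ u → toℕ u , out t u) (neighbours G v))) j
    ... | inj₂ k = old k
    ... | inj₁ k with ∈-map⁻ _ (∈-heard⁻ (map (λ u → toℕ u , out t u) (neighbours G v)) k)
    ...   | u , u∈ , eq = u , cong proj₁ eq , subst T lv tt , ∈-neighbours⁻ G u∈ , ∈-sent-new {t} (sym (cong proj₂ eq))

  known-cases : ∀ t {v κ} → κ ∈ known t v →
    κ ∈ ini v ⊎ ∃[ u ] ∃[ κ₀ ] κ ≡ κ₀ + suc N × T (live v) × Adj G v u × κ₀ ∈ sent t u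
  known-cases t {v} i with ∈-++⁻ (ini v) i
  ... | inj₁ j = inj₁ j
  ... | inj₂ j with ∈-map⁻ _ j
  ...   | (y , κ₀) , e∈ , eq with log⇒sent t e∈
  ...     | u , _ , lv , a , k = inj₂ (u , κ₀ , eq , lv , a , k)

  sent⇒known-hop : ∀ t {v u κ} → T (live v) → Adj G v u → κ ∈ sent t u → κ + suc N ∈ known t v
  sent⇒known-hop t lv a i = ∈-++⁺ʳ _ (∈-map⁺ _ (sent⇒log t lv a i))

  module _ {B : ℕ} (ini-≤ : ∀ {v κ} → κ ∈ ini v → κ ≤ B) where

    known-≤ : ∀ t {v κ} → κ ∈ known t v → κ ≤ B + t * suc N
    sent-≤  : ∀ t {v κ} → κ ∈ sent (suc t) v → κ ≤ B + t * suc N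

    known-≤ zero    i with known-cases zero i
    ... | inj₁ j = ≤-trans (ini-≤ j) (m≤m+n B 0)
    known-≤ (suc t) i with known-cases (suc t) i
    ... | inj₁ j = ≤-trans (ini-≤ j) (m≤m+n B _)
    ... | inj₂ (u , κ₀ , refl , _ , _ , j) = ≤-trans (+-monoˡ-≤ (suc N) (sent-≤ t j))
      (≤-reflexive (trans (+-assoc B (t * suc N) (suc N)) (cong (λ z → B + z) (+-comm (t * suc N) (suc N)))))
    sent-≤ t {v} i with ∈-sent⁻ {t} i
    ... | inj₁ eq = known-≤ t (proj₁ (∈-filter⁻ (eligible? (known t v) (sent t v)) {xs = known t v}
                    (least-∈ (filter (eligible? (known t v) (sent t v)) (known t v)) eq)))
    sent-≤ (suc t) i | inj₂ j = ≤-trans (sent-≤ t j) (+-monoʳ-≤ B (m≤n+m (t * suc N) (suc N)))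

    out-≤ : ∀ t v → out t v ≤ suc (B + t * suc N)
    out-≤ t v = go (out t v) refl
      where
      go : ∀ z → out t v ≡ z → z ≤ suc (B + t * suc N)
      go zero    eq = z≤n
      go (suc κ) eq = s≤s (sent-≤ t (∈-sent-new {t} eq))

  module _ (ini-live : ∀ {v κ} → κ ∈ ini v → T (live v)) where

    -- Induction on the key rather than on the round: a received key exceeds the announced one by
    -- `suc N`.
    known⇒Reach : ∀ t {v κ} → κ ∈ known t v → Reach v κ
    known⇒Reach t {v} {κ} i = go (<-wellFounded κ) i
      where
      go : ∀ {κ v} → Acc _<_ κ → κ ∈ known t v → Reach v κ
      go (acc rs) i with known-cases t i
      ... | inj₁ j = origin (ini-live j) j
      ... | inj₂ (u , κ₀ , refl , lv , a , j) =
        hop lv a (go (rs (m<m+n κ₀ z<s)) (sent⇒known t j))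

    Announced : ℕ → Fin (suc N) → ℕ → Set
    Announced t x κ = Any (λ κ′ → κ′ ≤ κ × κ′ % suc N ≡ κ % suc N) (sent t x)

    announced? : ∀ t x κ → Dec (Announced t x κ)
    announced? t x κ = any? (λ κ′ → (κ′ ≤? κ) ×-dec (κ′ % suc N ℕ.≟ κ % suc N)) (sent t x)

    -- `us` names all competitors that can delay `κ` at `x`. Its length, added to the distance, is
    -- the waiting time.
    Covers : Fin (suc N) → ℕ → List ℕ → Set
    Covers x κ us = ∀ {κ′} → κ′ < κ → Reach x κ′ → κ′ % suc N ≢ κ % suc N → κ′ % suc N ∈ us

    Announced-mono : ∀ {t x κ} → Announced t x κ → Announced (suc t) x κ
    Announced-mono {t} {x} i with out t x
    ... | zero  = i
    ... | suc _ = there i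

  module Progress (ini-live : ∀ {v κ} → κ ∈ ini v → T (live v)) where
    private
      n = suc N

    least-of-class : ∀ (ks : List ℕ) {κ} → κ ∈ ks →
      ∃[ μ ] μ ∈ ks × μ ≤ κ × μ % n ≡ κ % n × All (λ κ′ → κ′ % n ≡ μ % n → μ ≤ κ′) ks
    least-of-class ks {κ} κ∈ = μ , proj₁ μ∈′ , foldr-⊓-≤ᵈ κ cl , proj₂ μ∈′ ,
      All.tabulate (λ {κ′} κ′∈ eq → foldr-⊓-≤ κ cl (∈-filter⁺ P? κ′∈ (trans eq (proj₂ μ∈′))))
      where
      P? = λ κ′ → κ′ % n ℕ.≟ κ % n
      cl = filter P? ks
      μ = foldr _⊓_ κ cl
      μ∈′ : μ ∈ ks × μ % n ≡ κ % n
      μ∈′ with foldr-⊓-sel κ cl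
      ... | inj₁ eq = subst (λ z → z ∈ ks × z % n ≡ κ % n) (sym eq) (κ∈ , refl)
      ... | inj₂ i  = ∈-filter⁻ P? {xs = ks} i

    -- us lists the classes that can be served at x before κ.  If x announces a
    -- smaller key q instead of κ, the class of q is in us and can be struck off
    -- for q, so that by induction on keys q was announced before.
    announce : ∀ {κ x} (us : List ℕ) t → Reach x κ → Covers ini-live x κ us →
      κ div n + length us < t → Announced ini-live t x κ
    announce {κ} us t = go (<-wellFounded κ) us t
      where
      go : ∀ {κ x} → Acc _<_ κ → (us : List ℕ) → ∀ t → Reach x κ → Covers ini-live x κ us →
        κ div n + length us < t → Announced ini-live t x κ
      go {κ} {x} (acc rs) us (suc t) r cov (s≤s le) with announced? ini-live (suc t) x κ
      ... | yes p = p
      ... | no ¬p = ⊥-elim (¬p result)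
        where
        ¬p₀ : ¬ Announced ini-live t x κ
        ¬p₀ q = ¬p (Announced-mono ini-live {t} q)
        κ-known : ∀ {κ x} → Reach x κ → Covers ini-live x κ us → κ div n + length us ≤ t →
          (∀ {κ₀} → κ₀ < κ → Acc _<_ κ₀) →
          ∃[ κ₁ ] κ₁ ∈ known t x × κ₁ ≤ κ × κ₁ % n ≡ κ % n
        κ-known {κ} (origin _ i) _ _ _ = κ , ∈-++⁺ˡ i , ≤-refl , refl
        κ-known {x = x} (hop {y = y} {κ = κ₀} lx a ry) cov le rs with go (rs (m<m+n κ₀ z<s)) us t ry cov-y lt
          where
          -- A competitor `κ′` of `κ₀` at `y` turns into the competitor `κ′ + n` of `κ` at `x`, so
          -- the same list serves at `y`.
          cov-y : Covers ini-live y κ₀ us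
          cov-y {κ′} κ′<κ₀ ry′ ne = subst (_∈ us) ([m+n]%n≡m%n κ′ n)
            (cov (+-monoˡ-< n κ′<κ₀) (hop lx a ry′)
              (λ eq → ne (trans (sym ([m+n]%n≡m%n κ′ n)) (trans eq ([m+n]%n≡m%n κ₀ n)))))
          lt : κ₀ div n + length us < t
          lt = subst (λ z → z + length us ≤ t)
                 (trans (m/n≡1+[m∸n]/n (m≤n+m n κ₀)) (cong (λ z → suc (z div n)) (m+n∸n≡m κ₀ n))) le
        ... | p with find p
        ...   | κ″ , κ″∈ , κ″≤ , cl =
          κ″ + n , sent⇒known-hop t lx a κ″∈ , +-monoˡ-≤ n κ″≤ ,
          trans ([m+n]%n≡m%n κ″ n) (trans cl (sym ([m+n]%n≡m%n κ₀ n)))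
        result : Announced ini-live (suc t) x κ
        result with κ-known r cov le (λ lt → rs lt)
        ... | κ₁ , κ₁∈ , κ₁≤κ , cl₁ with least-of-class (known t x) κ₁∈
        ...   | μ , μ∈ , μ≤κ₁ , clμ , μ-least
          with least-≤ (filter (eligible? (known t x) (sent t x)) (known t x))
                 (∈-filter⁺ (eligible? (known t x) (sent t x)) μ∈
                   ((λ i → ¬p₀ (Any.map (λ { refl → ≤-trans μ≤κ₁ κ₁≤κ , trans clμ cl₁ }) i)) , μ-least))
        ...     | q , q-out , q≤μ
          with ∈-filter⁻ (eligible? (known t x) (sent t x)) {xs = known t x}
                 (least-∈ (filter (eligible? (known t x) (sent t x)) (known t x)) q-out)
             | q % n ℕ.≟ κ % n
        ...       | q∈ , q∉sent , q-least | yes cl =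
          Any.map (λ { refl → ≤-trans q≤μ (≤-trans μ≤κ₁ κ₁≤κ) , cl }) (∈-sent-new {t} q-out)
        ...       | q∈ , q∉sent , q-least | no ncl = ⊥-elim (contra (remove (cov q<κ rq ncl)))
          where
          q<κ : q < κ
          q<κ = ≤∧≢⇒< (≤-trans q≤μ (≤-trans μ≤κ₁ κ₁≤κ)) (λ eq → ncl (cong (_% n) eq))
          rq = known⇒Reach ini-live t q∈
          contra : ∃[ ys ] suc (length ys) ≡ length us × (∀ {y} → y ≢ q % n → y ∈ us → y ∈ ys) → ⊥
          contra (ys , len , keep) with go (rs q<κ) ys t rq cov-q lt
            where
            cov-q : Covers ini-live x q ys
            cov-q {κ′} κ′<q r′ ne with κ′ % n ℕ.≟ κ % n
            ... | no ne′ = keep ne (cov (<-trans κ′<q q<κ) r′ ne′)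
            -- A smaller reachable key in the class of `κ` itself would, by induction, have been
            -- announced by `suc t`, against `¬p`.
            ... | yes cl′ = ⊥-elim (¬p (Any.map (λ (le′ , cl″) → ≤-trans le′ (<⇒≤ (<-trans κ′<q q<κ)) , trans cl″ cl′)
                (go (rs (<-trans κ′<q q<κ)) us (suc t) r′
                  (λ κ″<κ′ r″ ne″ → cov (<-trans κ″<κ′ (<-trans κ′<q q<κ)) r″ (λ e → ne″ (trans e (sym cl′))))
                  (s≤s (≤-trans (+-monoˡ-≤ (length us) (/-monoˡ-≤ n (<⇒≤ (<-trans κ′<q q<κ)))) le)))))
            lt : q div n + length ys < t
            lt = ≤-trans (≤-reflexive (sym (+-suc (q div n) (length ys))))
                   (≤-trans (+-mono-≤ (/-monoˡ-≤ n (<⇒≤ q<κ)) (≤-reflexive len)) le)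
          ... | p with find p
          ...   | q′ , q′∈ , q′≤q , cl′ =
            q∉sent (subst (_∈ sent t x) (≤-antisym q′≤q (All.lookup q-least (sent⇒known t q′∈) cl′)) q′∈)

-- Keys that do not pass through a given vertex.

others : ∀ {n} → Fin n → Fin n → Bool
others x y = not (does (toℕ y ℕ.≟ toℕ x))

T-others : ∀ {n} {x y : Fin n} → y ≢ x → T (others x y)
T-others {x = x} {y} ne with toℕ y ≡ᵇ toℕ x | ≡ᵇ⇒≡ (toℕ y) (toℕ x)
... | true  | eq = contradiction (toℕ-injective (eq tt)) ne
... | false | _  = tt

others-T : ∀ {n} {x y : Fin n} → T (others x y) → y ≢ x
others-T {x = x} t refl with toℕ x ≡ᵇ toℕ x | ≡⇒≡ᵇ (toℕ x) (toℕ x) refl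
... | true | _ = t

module _ (N : ℕ) (G : Graph (suc N)) (live : Fin (suc N) → Bool) (ini : Fin (suc N) → List ℕ)
         (x : Fin (suc N)) where
  open Flood N G live ini

  -- If every derivation of κ passed through x, then x would have announced a
  -- smaller key of the same source.
  known⇒Reach-avoiding : ∀ t {y κ} → y ≢ x → κ ∈ known t y →
    Flood.Reach N G (others x) ini y κ ⊎ ∃[ κ′ ] κ′ ∈ known t x × κ′ < κ × κ′ % suc N ≡ κ % suc N
  known⇒Reach-avoiding t {κ = κ} ne i = go (<-wellFounded κ) ne i
    where
    go : ∀ {κ y} → Acc _<_ κ → y ≢ x → κ ∈ known t y →
      Flood.Reach N G (others x) ini y κ ⊎ ∃[ κ′ ] κ′ ∈ known t x × κ′ < κ × κ′ % suc N ≡ κ % suc N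
    go (acc rs) ne i with known-cases t i
    ... | inj₁ j = inj₁ (Flood.origin (T-others ne) j)
    ... | inj₂ (u , κ₀ , refl , lv , a , j) with u Fin.≟ x
    ...   | yes refl = inj₂ (κ₀ , sent⇒known t j , m<m+n κ₀ z<s , sym ([m+n]%n≡m%n κ₀ (suc N)))
    ...   | no ne′ with go (rs (m<m+n κ₀ z<s)) ne′ (sent⇒known t j)
    ...     | inj₁ r = inj₁ (Flood.hop (T-others ne) a r)
    ...     | inj₂ (κ′ , k , lt , cl) =
      inj₂ (κ′ , k , <-trans lt (m<m+n κ₀ z<s) , trans cl (sym ([m+n]%n≡m%n κ₀ (suc N))))

-- Concatenation and reversal of walks.

module _ {n : ℕ} (G : Graph n) where

  infixr 5 _▷_
  _▷_ : ∀ {u v w ℓ m} → Walk G u v ℓ → Walk G v w m → Walk G u w (ℓ + m)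
  []      ▷ q = q
  (a ∷ p) ▷ q = a ∷ (p ▷ q)

  walk-snoc : ∀ {u v w ℓ} → Walk G u v ℓ → Adj G v w → Walk G u w (suc ℓ)
  walk-snoc {ℓ = ℓ} p a = subst (Walk G _ _) (+-comm ℓ 1) (p ▷ (a ∷ []))

  walk-reverse : ∀ {u v ℓ} → Walk G u v ℓ → Walk G v u ℓ
  walk-reverse []      = []
  walk-reverse (a ∷ p) = walk-snoc (walk-reverse p) (Adj-sym G a)

-- Gossip and message encoding

gossip-step : ℕ → List (ℕ × ℕ) → ℕ
gossip-step b ms = foldr _⊓_ b (map proj₂ ms)

module Gossip {n : ℕ} (G : Graph n) (val : Fin n → ℕ) where

  best : ℕ → Fin n → ℕ
  best zero    v = val v
  best (suc t) v = gossip-step (best t v) (map (λ u → toℕ u , best t u) (neighbours G v))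

  best-attained : ∀ t v → ∃[ u ] best t v ≡ val u
  best-attained zero    v = v , refl
  best-attained (suc t) v
    with foldr-⊓-sel (best t v) (map proj₂ (map (λ u → toℕ u , best t u) (neighbours G v)))
  ... | inj₁ eq with best-attained t v
  ...   | u , eq′ = u , trans eq eq′
  best-attained (suc t) v | inj₂ i with ∈-map⁻ _ i
  ...   | e , j , eq with ∈-map⁻ _ j
  ...     | w , _ , refl with best-attained t w
  ...       | u , eq′ = u , trans eq eq′

  best-decr : ∀ t v → best (suc t) v ≤ best t v
  best-decr t v = foldr-⊓-≤ᵈ _ (map proj₂ (map (λ u → toℕ u , best t u) (neighbours G v)))

  best-nbr : ∀ t {v u} → Adj G v u → best (suc t) v ≤ best t u
  best-nbr t {v} a = foldr-⊓-≤ _ (map proj₂ (map (λ u → toℕ u , best t u) (neighbours G v)))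
    (∈-map⁺ proj₂ (∈-map⁺ _ (∈-neighbours⁺ G a)))

  best-≤ : ∀ t {v u ℓ} → Walk G v u ℓ → ℓ ≤ t → best t v ≤ val u
  best-≤ zero    []      _        = ≤-refl
  best-≤ (suc t) []      _        = ≤-trans (best-decr t _) (best-≤ t [] z≤n)
  best-≤ (suc t) (a ∷ p) (s≤s le) = ≤-trans (best-nbr t a) (best-≤ t p le)

  -- The value held at `v` started at some `w`, and `w` is within `t` hops of `u` as well.
  best-agree : ∀ t → (∀ u v → ∃[ ℓ ] Walk G u v ℓ × ℓ ≤ t) → ∀ u v → best t u ≡ best t v
  best-agree t reach u v = ≤-antisym (half u v) (half v u)
    where
    half : ∀ u v → best t u ≤ best t v
    half u v with best-attained t v
    ... | w , eq with reach u w
    ...   | _ , p , le = subst (best t u ≤_) (sym eq) (best-≤ t p le)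

-- Each bijective binary digit is preceded by a continuation bit, which makes
-- the code prefix-free.

encodeᵇ : ℕᵇ → Message
encodeᵇ ℕᵇ.zero  = false ∷ []
encodeᵇ 2[1+ b ] = true ∷ false ∷ encodeᵇ b
encodeᵇ 1+[2 b ] = true ∷ true ∷ encodeᵇ b

decodeᵇ : Message → ℕᵇ × Message
decodeᵇ (true ∷ false ∷ bs) with decodeᵇ bs
... | b , r = 2[1+ b ] , r
decodeᵇ (true ∷ true ∷ bs) with decodeᵇ bs
... | b , r = 1+[2 b ] , r
decodeᵇ (false ∷ bs) = ℕᵇ.zero , bs
-- The default covers the empty message: silence reads as 0, in agreement with `value (output o)`.
decodeᵇ bs = ℕᵇ.zero , bs

decodeᵇ-encodeᵇ : ∀ b r → decodeᵇ (encodeᵇ b ++ r) ≡ (b , r)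
decodeᵇ-encodeᵇ ℕᵇ.zero  r = refl
decodeᵇ-encodeᵇ 2[1+ b ] r rewrite decodeᵇ-encodeᵇ b r = refl
decodeᵇ-encodeᵇ 1+[2 b ] r rewrite decodeᵇ-encodeᵇ b r = refl

encode : ℕ → Message
encode x = encodeᵇ (ℕᵇ.fromℕ x)

decode : Message → ℕ × Message
decode bs = ℕᵇ.toℕ (proj₁ (decodeᵇ bs)) , proj₂ (decodeᵇ bs)

decode-encode : ∀ x r → decode (encode x ++ r) ≡ (x , r)
decode-encode x r rewrite decodeᵇ-encodeᵇ (ℕᵇ.fromℕ x) r | ℕᵇ.toℕ-fromℕ x = refl

decode-encode′ : ∀ x → proj₁ (decode (encode x)) ≡ x
decode-encode′ x = cong proj₁ (trans (cong decode (sym (++-identityʳ (encode x)))) (decode-encode x []))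

-- `s` is the number of digits. Bijective digits are at least 1, so the value is at least
-- `2 ^ s - 1`.
length-encodeᵇ : ∀ b → ∃[ s ] length (encodeᵇ b) ≡ suc (2 * s) × 2 ^ s ≤ suc (ℕᵇ.toℕ b)
length-encodeᵇ ℕᵇ.zero = 0 , refl , ≤-refl
length-encodeᵇ 2[1+ b ] with length-encodeᵇ b
... | s , eq , le = suc s , trans (cong (suc ∘ suc) eq) (cong suc (sym (*-suc 2 s))) ,
  m≤n⇒m≤1+n (*-monoʳ-≤ 2 le)
length-encodeᵇ 1+[2 b ] with length-encodeᵇ b
... | s , eq , le = suc s , trans (cong (suc ∘ suc) eq) (cong suc (sym (*-suc 2 s))) ,
  subst (2 * 2 ^ s ≤_) (*-suc 2 (ℕᵇ.toℕ b)) (*-monoʳ-≤ 2 le)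

length-encode : ∀ x e → suc x ≤ 2 ^ e → length (encode x) ≤ suc (2 * e)
length-encode x e le with length-encodeᵇ (ℕᵇ.fromℕ x)
... | s , eq , le′ rewrite eq | ℕᵇ.toℕ-fromℕ x = s≤s (*-monoʳ-≤ 2 s≤e)
  where
  s≤e : s ≤ e
  s≤e with s ≤? e
  ... | yes p = p
  ... | no ¬p = contradiction (≤-trans le′ le) (<⇒≱ (^-monoʳ-< 2 (s≤s (s≤s z≤n)) (≰⇒> ¬p)))

-- Probabilities

ι : ℕ → ℚ
ι a = + a / 1

ι-mkℚ : ∀ a → ι a ≡ mkℚ (+ a) 0 (Coprime.sym (1-coprimeTo a))
ι-mkℚ a = ℚ.normalize-coprime (Coprime.sym (1-coprimeTo a))

ι-+ : ∀ a b → ι (a + b) ≡ ι a ℚ.+ ι b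
ι-+ a b rewrite ι-mkℚ a | ι-mkℚ b = cong (_/ 1) (begin
  + (a + b)                    ≡⟨ ℤ.pos-+ a b ⟩
  + a ℤ.+ + b                  ≡⟨ cong₂ ℤ._+_ (ℤ.*-identityʳ (+ a)) (ℤ.*-identityʳ (+ b)) ⟨
  + a ℤ.* + 1 ℤ.+ + b ℤ.* + 1  ∎)
  where open ≡-Reasoning

ι-* : ∀ a b → ι (a * b) ≡ ι a ℚ.* ι b
ι-* a b rewrite ι-mkℚ a | ι-mkℚ b = cong (_/ 1) (ℤ.pos-* a b)

ι-mono : ∀ {a b} → a ≤ b → ι a ℚ.≤ ι b
ι-mono {a} {b} le rewrite ι-mkℚ a | ι-mkℚ b =
  ℚ.*≤* (ℤ.*-monoʳ-≤-nonNeg (+ 1) (ℤ.+≤+ le))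

ι-pos : ∀ a .{{_ : NonZero a}} → ℚ.Positive (ι a)
ι-pos a = ℚ.normalize-pos a 1

1/k*k≡1 : ∀ k .{{_ : NonZero k}} → (+ 1 / k) ℚ.* ι k ≡ 1ℚ
1/k*k≡1 (suc k) rewrite ι-mkℚ (suc k) | ℚ.normalize-coprime {1} {k} (1-coprimeTo (suc k)) =
  ℚ.*-inverseˡ (mkℚ (+ suc k) 0 (Coprime.sym (1-coprimeTo (suc k))))

-- `(2 - 1/g) g = 2 g - 1`, so the rational bound is a strict inequality of natural numbers.
≤-2g-1 : ∀ x g .{{_ : NonZero g}} → suc x ≤ 2 * g →
  (+ x / 1) ℚ.≤ ((+ 2 / 1) ℚ.- (+ 1 / g)) ℚ.* (+ g / 1)
≤-2g-1 x g le = begin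
  ι x                                                    ≡⟨ solve 1 (λ p → p := (con 1ℚ :+ p) :- con 1ℚ) refl (ι x) ⟩
  (1ℚ ℚ.+ ι x) ℚ.- 1ℚ                                    ≡⟨ cong (ℚ._- 1ℚ) (ι-+ 1 x) ⟨
  ι (suc x) ℚ.- 1ℚ                                       ≤⟨ ℚ.+-monoˡ-≤ (ℚ.- 1ℚ) (ι-mono le) ⟩
  ι (2 * g) ℚ.- 1ℚ                                       ≡⟨ cong₂ ℚ._-_ (ι-* 2 g) (sym (1/k*k≡1 g)) ⟩
  ι 2 ℚ.* ι g ℚ.- (+ 1 / g) ℚ.* ι g                      ≡⟨ solve 3 (λ p q r → p :* r :- q :* r := (p :- q) :* r) refl (ι 2) (+ 1 / g) (ι g) ⟩
  (ι 2 ℚ.- (+ 1 / g)) ℚ.* ι g                            ∎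
  where
  open ℚ.≤-Reasoning
  open ℚ-Solver.+-*-Solver

>>=-assoc : ∀ {A B C : Set} (x : Rand A) (f : A → Rand B) (g : B → Rand C) →
  ((x >>= f) >>= g) ≡ (x >>= λ a → f a >>= g)
>>=-assoc (ret a)    f g = refl
>>=-assoc (flip l r) f g = cong₂ flip (>>=-assoc l f g) (>>=-assoc r f g)

>>=-cong : ∀ {A B : Set} (x : Rand A) {f g : A → Rand B} → (∀ a → f a ≡ g a) → (x >>= f) ≡ (x >>= g)
>>=-cong (ret a)    eq = eq a
>>=-cong (flip l r) eq = cong₂ flip (>>=-cong l eq) (>>=-cong r eq)

Always->>= : ∀ {A B : Set} {P : B → Set} (x : Rand A) {f : A → Rand B} →
  (∀ a → Always P (f a)) → Always P (x >>= f)
Always->>= (ret a)    all = all a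
Always->>= (flip l r) all = Always->>= l all , Always->>= r all

sequence-ret : ∀ {A : Set} {n} {f : Fin n → Rand A} {h : Fin n → A} →
  (∀ u → f u ≡ ret (h u)) → sequence (Vec.tabulate f) ≡ ret (Vec.tabulate h)
sequence-ret {n = zero}  eq = refl
sequence-ret {n = suc n} eq rewrite eq Fin.zero | sequence-ret (eq ∘ Fin.suc) = refl

-- For the round in which node 0 alone tosses coins: the joint step is one draw followed by a pure
-- function of it.
sequence-head : ∀ {A B : Set} {n} {f : Fin (suc n) → Rand A} (x : Rand B) {h : B → Fin (suc n) → A} →
  f Fin.zero ≡ (x >>= λ b → ret (h b Fin.zero)) →
  (∀ b u → f (Fin.suc u) ≡ ret (h b (Fin.suc u))) →
  sequence (Vec.tabulate f) ≡ (x >>= λ b → ret (Vec.tabulate (h b)))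
sequence-head x {h} eq₀ eqs rewrite eq₀ =
  trans (>>=-assoc x _ _) (>>=-cong x λ b → cong (_>>= λ as → ret (h b Fin.zero ∷ as)) (sequence-ret (eqs b)))

Pr-map : ∀ {A B : Set} (E : B → Bool) (x : Rand A) (f : A → B) → Pr E (x >>= λ a → ret (f a)) ≡ Pr (E ∘ f) x
Pr-map E (ret a)    f = refl
Pr-map E (flip l r) f = cong₂ (λ p q → ½ ℚ.* (p ℚ.+ q)) (Pr-map E l f) (Pr-map E r f)

Pr-mono : ∀ {A : Set} {E F : A → Bool} (x : Rand A) → (∀ a → T (E a) → T (F a)) → Pr E x ℚ.≤ Pr F x
Pr-mono {E = E} {F} (ret a) imp with E a | F a | imp a
... | false | false | _ = ℚ.≤-refl
... | false | true  | _ = ℚ.*≤* (ℤ.+≤+ z≤n)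
... | true  | true  | _ = ℚ.≤-refl
... | true  | false | f = ⊥-elim (f tt)
Pr-mono (flip l r) imp = ℚ.*-monoˡ-≤-nonNeg ½ (ℚ.+-mono-≤ (Pr-mono l imp) (Pr-mono r imp))

Pr-not : ∀ {A : Set} (E : A → Bool) (x : Rand A) → Pr (not ∘ E) x ≡ 1ℚ ℚ.- Pr E x
Pr-not E (ret a) with E a
... | true  = refl
... | false = refl
Pr-not E (flip l r) rewrite Pr-not E l | Pr-not E r =
  solve 2 (λ p q → con ½ :* ((con 1ℚ :- p) :+ (con 1ℚ :- q)) := con 1ℚ :- con ½ :* (p :+ q)) refl (Pr E l) (Pr E r)
  where open ℚ-Solver.+-*-Solver

-- Independence enters here: `x` is one draw, and `f` makes the remaining ones, whose success
-- probability `p` does not depend on it.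
Pr->>= : ∀ {A B : Set} {E : B → Bool} {F : A → Bool} {p} (x : Rand A) (f : A → Rand B) →
  (∀ a → Pr E (f a) ≡ (if F a then p else 0ℚ)) → Pr E (x >>= f) ≡ Pr F x ℚ.* p
Pr->>= {F = F} {p} (ret a) f eq with F a | eq a
... | true  | e = trans e (sym (ℚ.*-identityˡ p))
... | false | e = trans e (sym (ℚ.*-zeroˡ p))
Pr->>= {E = E} {F} {p} (flip l r) f eq rewrite Pr->>= {E = E} {F} {p} l f eq | Pr->>= {E = E} {F} {p} r f eq =
  solve 3 (λ a b p → con ½ :* (a :* p :+ b :* p) := con ½ :* (a :+ b) :* p) refl (Pr F l) (Pr F r) p
  where open ℚ-Solver.+-*-Solver

-- Uniform draws and the probability of missing a set.

draw : (L a : ℕ) → Rand ℕ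
draw zero    a = ret a
draw (suc L) a = flip (draw L a) (draw L (2 ^ L + a))

draws : (L m : ℕ) → Rand (Vec ℕ m)
draws L zero    = ret []
draws L (suc m) = draw L 0 >>= λ i → draws L m >>= λ is → ret (i ∷ is)

count : (ℕ → Bool) → ℕ → ℕ → ℕ
count E a zero    = 0
count E a (suc m) = (if E a then 1 else 0) + count E (suc a) m

count-+ : ∀ E a m k → count E a (m + k) ≡ count E a m + count E (m + a) k
count-+ E a zero    k = refl
count-+ E a (suc m) k = begin
  i + count E (suc a) (m + k)                         ≡⟨ cong (λ z → i + z) (count-+ E (suc a) m k) ⟩
  i + (count E (suc a) m + count E (m + suc a) k)     ≡⟨ +-assoc i _ _ ⟨
  i + count E (suc a) m + count E (m + suc a) k       ≡⟨ cong (λ z → i + count E (suc a) m + count E z k) (+-suc m a) ⟩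
  i + count E (suc a) m + count E (suc (m + a)) k     ∎
  where
  open ≡-Reasoning
  i = if E a then 1 else 0

count-not : ∀ E a m → count E a m + count (not ∘ E) a m ≡ m
count-not E a zero = refl
count-not E a (suc m) with E a
... | true  = cong suc (count-not E (suc a) m)
... | false = trans (+-suc _ _) (cong suc (count-not E (suc a) m))

-- `draw L a` is uniform on the `2 ^ L` numbers from `a` on, its first flip choosing between the two
-- halves of this interval. Multiplying out the denominator leaves a count.
Pr-draw : ∀ E L a → Pr E (draw L a) ℚ.* ι (2 ^ L) ≡ ι (count E a (2 ^ L))
Pr-draw E zero a with E a
... | true  = refl
... | false = refl
Pr-draw E (suc L) a = begin
  ½ ℚ.* (p ℚ.+ q) ℚ.* ι (2 * 2 ^ L)          ≡⟨ cong (½ ℚ.* (p ℚ.+ q) ℚ.*_) (ι-* 2 (2 ^ L)) ⟩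
  ½ ℚ.* (p ℚ.+ q) ℚ.* (ι 2 ℚ.* ι (2 ^ L))    ≡⟨ solve 3 (λ p q w → con ½ :* (p :+ q) :* (con (ι 2) :* w) := p :* w :+ q :* w) refl p q (ι (2 ^ L)) ⟩
  p ℚ.* ι (2 ^ L) ℚ.+ q ℚ.* ι (2 ^ L)        ≡⟨ cong₂ ℚ._+_ (Pr-draw E L a) (Pr-draw E L (2 ^ L + a)) ⟩
  ι c₁ ℚ.+ ι c₂                              ≡⟨ ι-+ c₁ c₂ ⟨
  ι (c₁ + c₂)                                ≡⟨ cong ι (count-+ E a (2 ^ L) (2 ^ L)) ⟨
  ι (count E a (2 ^ L + 2 ^ L))              ≡⟨ cong (λ z → ι (count E a (2 ^ L + z))) (+-identityʳ (2 ^ L)) ⟨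
  ι (count E a (2 * 2 ^ L))                  ∎
  where
  open ≡-Reasoning
  open ℚ-Solver.+-*-Solver
  p = Pr E (draw L a)
  q = Pr E (draw L (2 ^ L + a))
  c₁ = count E a (2 ^ L)
  c₂ = count E (2 ^ L + a) (2 ^ L)

misses : ∀ {m} → (ℕ → Bool) → Vec ℕ m → Bool
misses E []       = true
misses E (i ∷ is) = not (E i) ∧ misses E is

Pr-misses : ∀ E L m →
  Pr (misses E) (draws L m) ℚ.* ι ((2 ^ L) ^ m) ≡ ι (count (not ∘ E) 0 (2 ^ L) ^ m)
Pr-misses E L zero    = refl
Pr-misses E L (suc m) = begin
  Pr (misses E) (draws L (suc m)) ℚ.* ι (w * w ^ m)
    ≡⟨ cong (ℚ._* ι (w * w ^ m)) (Pr->>= {E = misses E} {F = not ∘ E} {p = p} (draw L 0) _ branch) ⟩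
  q ℚ.* p ℚ.* ι (w * w ^ m)                 ≡⟨ cong (q ℚ.* p ℚ.*_) (ι-* w (w ^ m)) ⟩
  q ℚ.* p ℚ.* (ι w ℚ.* ι (w ^ m))           ≡⟨ solve 4 (λ q p a b → q :* p :* (a :* b) := (q :* a) :* (p :* b)) refl q p (ι w) (ι (w ^ m)) ⟩
  (q ℚ.* ι w) ℚ.* (p ℚ.* ι (w ^ m))         ≡⟨ cong₂ ℚ._*_ (Pr-draw (not ∘ E) L 0) (Pr-misses E L m) ⟩
  ι b ℚ.* ι (b ^ m)                         ≡⟨ ι-* b (b ^ m) ⟨
  ι (b * b ^ m)                             ∎
  where
  open ≡-Reasoning
  open ℚ-Solver.+-*-Solver
  w = 2 ^ L
  b = count (not ∘ E) 0 w
  p = Pr (misses E) (draws L m)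
  q = Pr (not ∘ E) (draw L 0)
  Pr-false : ∀ {A : Set} (x : Rand A) → Pr (λ _ → false) x ≡ 0ℚ
  Pr-false (ret a) = refl
  Pr-false (flip l r) rewrite Pr-false l | Pr-false r = refl
  branch : ∀ i → Pr (misses E) (draws L m >>= λ is → ret (i ∷ is)) ≡ (if not (E i) then p else 0ℚ)
  branch i = trans (Pr-map (misses E) (draws L m) (i ∷_)) (aux (not (E i)))
    where
    aux : ∀ e → Pr (λ is → e ∧ misses E is) (draws L m) ≡ (if e then p else 0ℚ)
    aux true  = refl
    aux false = Pr-false (draws L m)

Pr-hits : ∀ E L m n c .{{_ : NonZero n}} → count (not ∘ E) 0 (2 ^ L) ^ m * n ^ c ≤ (2 ^ L) ^ m →
  whp n c ℚ.≤ Pr (not ∘ misses E) (draws L m)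
Pr-hits E L m n c le = subst (whp n c ℚ.≤_) (sym (Pr-not (misses E) (draws L m)))
  (ℚ.+-monoʳ-≤ 1ℚ {ℚ.- r} {ℚ.- p} (ℚ.neg-antimono-≤ p≤r))
  where
  open ℚ.≤-Reasoning
  open ℚ-Solver.+-*-Solver
  instance
    _ = m^n≢0 n c
    _ = m^n≢0 2 L
    _ = m^n≢0 (2 ^ L) m
  w = (2 ^ L) ^ m
  b = count (not ∘ E) 0 (2 ^ L)
  p = Pr (misses E) (draws L m)
  r = + 1 / (n ^ c)
  positive : ℚ.Positive (ι w ℚ.* ι (n ^ c))
  positive = ℚ.pos*pos⇒pos (ι w) {{ι-pos w}} (ι (n ^ c)) {{ι-pos (n ^ c)}}
  scaled : p ℚ.* (ι w ℚ.* ι (n ^ c)) ℚ.≤ r ℚ.* (ι w ℚ.* ι (n ^ c))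
  scaled = begin
    p ℚ.* (ι w ℚ.* ι (n ^ c))             ≡⟨ ℚ.*-assoc p (ι w) (ι (n ^ c)) ⟨
    p ℚ.* ι w ℚ.* ι (n ^ c)               ≡⟨ cong (ℚ._* ι (n ^ c)) (Pr-misses E L m) ⟩
    ι (b ^ m) ℚ.* ι (n ^ c)               ≡⟨ ι-* (b ^ m) (n ^ c) ⟨
    ι (b ^ m * n ^ c)                     ≤⟨ ι-mono le ⟩
    ι w                                   ≡⟨ ℚ.*-identityˡ (ι w) ⟨
    1ℚ ℚ.* ι w                            ≡⟨ cong (ℚ._* ι w) (1/k*k≡1 (n ^ c)) ⟨
    r ℚ.* ι (n ^ c) ℚ.* ι w               ≡⟨ solve 3 (λ r a b → r :* a :* b := r :* (b :* a)) refl r (ι (n ^ c)) (ι w) ⟩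
    r ℚ.* (ι w ℚ.* ι (n ^ c))             ∎
  p≤r : p ℚ.≤ r
  p≤r = ℚ.*-cancelʳ-≤-pos (ι w ℚ.* ι (n ^ c)) {{positive}} scaled

-- Bernoulli's inequality `(1 + 1/b)^k ≥ 1 + k/b` without denominators.
bernoulli : ∀ b k → b ^ k * (b + k) ≤ suc b ^ k * b
bernoulli b zero    = ≤-reflexive (cong (λ z → 1 * z) (+-identityʳ b))
bernoulli b (suc k) = begin
  b * b ^ k * (b + suc k)          ≤⟨ by-≡ (b ^ k * k) (eq b (b ^ k) k) ⟩
  suc b * (b ^ k * (b + k))        ≤⟨ *-monoʳ-≤ (suc b) (bernoulli b k) ⟩
  suc b * (suc b ^ k * b)          ≡⟨ *-assoc (suc b) (suc b ^ k) b ⟨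
  suc b * suc b ^ k * b            ∎
  where
  open ≤-Reasoning
  eq : ∀ b p k → b * p * (b + suc k) + p * k ≡ suc b * (p * (b + k))
  eq = solve-∀

-- With `a = b + 1` this is `(1 - 1/a)^a ≤ 1/2`, so `a` draws halve the chance of missing a fraction
-- `1/a`.
2*b^a≤a^a : ∀ b → 2 * b ^ suc b ≤ suc b ^ suc b
2*b^a≤a^a zero      = z≤n
2*b^a≤a^a b@(suc _) = *-cancelʳ-≤ _ _ b (begin
  2 * b ^ suc b * b                ≡⟨ eq b (b ^ suc b) ⟩
  b ^ suc b * (b + b)              ≤⟨ *-monoʳ-≤ (b ^ suc b) (+-monoʳ-≤ b (n≤1+n b)) ⟩
  b ^ suc b * (b + suc b)          ≤⟨ bernoulli b (suc b) ⟩
  suc b ^ suc b * b                ∎)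
  where
  open ≤-Reasoning
  eq : ∀ b p → 2 * p * b ≡ p * (b + b)
  eq = solve-∀

^-distribʳ-* : ∀ o m n → (m * n) ^ o ≡ m ^ o * n ^ o
^-distribʳ-* zero    m n = refl
^-distribʳ-* (suc o) m n =
  trans (cong (λ z → m * n * z) (^-distribʳ-* o m n)) (eq m n (m ^ o) (n ^ o))
  where
  eq : ∀ m n p q → m * n * (p * q) ≡ m * p * (n * q)
  eq = solve-∀

-- The range has `a * K` values, of which at least `K` are hits. Hence `a` draws all miss with
-- probability at most 1/2, and `c * L` batches of `a` draws with probability at most
-- `2^(-cL) ≤ n^(-c)`.
miss-bound : ∀ b K bad n c L → bad + K ≤ suc b * K → n ≤ 2 ^ L →
  bad ^ (suc b * (c * L)) * n ^ c ≤ (suc b * K) ^ (suc b * (c * L))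
miss-bound b K bad n c L le n≤ = begin
  bad ^ (a * e) * n ^ c                ≤⟨ *-mono-≤ (^-monoˡ-≤ (a * e) bad≤) nc≤ ⟩
  (b * K) ^ (a * e) * 2 ^ e            ≡⟨ cong (_* 2 ^ e) (^-distribʳ-* (a * e) b K) ⟩
  b ^ (a * e) * K ^ (a * e) * 2 ^ e    ≡⟨ cong (λ z → z * K ^ (a * e) * 2 ^ e) (sym (^-*-assoc b a e)) ⟩
  (b ^ a) ^ e * K ^ (a * e) * 2 ^ e    ≡⟨ eq ((b ^ a) ^ e) (K ^ (a * e)) (2 ^ e) ⟩
  2 ^ e * (b ^ a) ^ e * K ^ (a * e)    ≡⟨ cong (_* K ^ (a * e)) (sym (^-distribʳ-* e 2 (b ^ a))) ⟩
  (2 * b ^ a) ^ e * K ^ (a * e)        ≤⟨ *-monoˡ-≤ (K ^ (a * e)) (^-monoˡ-≤ e (2*b^a≤a^a b)) ⟩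
  (a ^ a) ^ e * K ^ (a * e)            ≡⟨ cong (_* K ^ (a * e)) (^-*-assoc a a e) ⟩
  a ^ (a * e) * K ^ (a * e)            ≡⟨ ^-distribʳ-* (a * e) a K ⟨
  (a * K) ^ (a * e)                    ∎
  where
  open ≤-Reasoning
  a = suc b
  e = c * L
  bad≤ : bad ≤ b * K
  bad≤ = +-cancelʳ-≤ K bad (b * K) (subst (bad + K ≤_) (+-comm K (b * K)) le)
  nc≤ : n ^ c ≤ 2 ^ e
  nc≤ = subst (n ^ c ≤_) (trans (^-*-assoc 2 L c) (cong (2 ^_) (*-comm L c))) (^-monoˡ-≤ c n≤)
  eq : ∀ x y z → x * y * z ≡ z * x * y
  eq = solve-∀

-- The wave from node 0

module Metric {n : ℕ} (G : Graph n) (dist : ∀ u v → ∃[ d ] IsDistance G u v d) where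

  d : Fin n → Fin n → ℕ
  d u v = proj₁ (dist u v)

  d-walk : ∀ u v → Walk G u v (d u v)
  d-walk u v = proj₁ (proj₂ (dist u v))

  d-min : ∀ {u v ℓ} → Walk G u v ℓ → d u v ≤ ℓ
  d-min {u} {v} {ℓ} p = proj₂ (proj₂ (dist u v)) ℓ p

  d-refl : ∀ u → d u u ≡ 0
  d-refl u = n≤0⇒n≡0 (d-min {u} [])

  d≡0⇒≡ : ∀ {u v} → d u v ≡ 0 → u ≡ v
  d≡0⇒≡ {u} {v} eq with subst (Walk G u v) eq (d-walk u v)
  ... | [] = refl

  d-sym : ∀ u v → d u v ≡ d v u
  d-sym u v = ≤-antisym (d-min (walk-reverse G (d-walk v u))) (d-min (walk-reverse G (d-walk u v)))

  d-triangle : ∀ u v w → d u w ≤ d u v + d v w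
  d-triangle u v w = d-min (_▷_ G (d-walk u v) (d-walk v w))

  d-adj : ∀ w {u v} → Adj G u v → d w v ≤ suc (d w u)
  d-adj w {u} a = d-min (walk-snoc G (d-walk w u) a)

  d-pred : ∀ w {v e} → d w v ≡ suc e → ∃[ u ] Adj G v u × d w u ≡ e
  d-pred w {v} {e} eq with subst (Walk G v w) (trans (d-sym v w) eq) (d-walk v w)
  ... | _∷_ {v = u} a p = u , a , ≤-antisym (subst (_≤ e) (d-sym u w) (d-min p))
    (s≤s⁻¹ (subst (_≤ suc (d w u)) eq (d-adj w (Adj-sym G a))))

  d-intermediate : ∀ w {v} j k → d w v ≡ k + j → ∃[ u ] d w u ≡ j
  d-intermediate w {v} j zero    eq = v , eq
  d-intermediate w     j (suc k) eq with d-pred w eq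
  ... | u , _ , eq′ = d-intermediate w j k eq′

-- A node keeps 0 until it hears from the wave started by node 0, and then
-- 1 + the largest known distance from node 0, its own being the current time.

spread : (t far heard : ℕ) → ℕ
spread t zero    zero    = 0
spread t zero    (suc f) = suc (suc t) ⊔ suc f
spread t (suc f) g       = suc f ⊔ g

spread-≥ : ∀ t far heard → far ≤ spread t far heard
spread-≥ t zero    heard = z≤n
spread-≥ t (suc f) heard = m≤m⊔n (suc f) heard

spread-heard : ∀ t far heard → heard ≤ spread t far heard
spread-heard t zero    zero    = z≤n
spread-heard t zero    (suc f) = m≤n⊔m (suc (suc t)) (suc f)
spread-heard t (suc f) heard   = m≤n⊔m (suc f) heard

module Wave (N : ℕ) (G : Graph (suc N)) where

  mutual
    far : ℕ → Fin (suc N) → ℕ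
    far zero    Fin.zero    = 1
    far zero    (Fin.suc _) = 0
    far (suc t) v           = spread t (far t v) (foldr _⊔_ 0 (map proj₁ (wave-inbox t v)))

    top : ℕ → Fin (suc N) → ℕ
    top zero    v = toℕ v
    top (suc t) v = foldr _⊔_ (top t v) (map proj₂ (wave-inbox t v))

    wave-inbox : ℕ → Fin (suc N) → List (ℕ × ℕ)
    wave-inbox t v = map (λ u → far t u , top t u) (neighbours G v)

  far-nbr : ∀ t {v u} → Adj G v u → far t u ≤ foldr _⊔_ 0 (map proj₁ (wave-inbox t v))
  far-nbr t {v} a = foldr-⊔-≥ 0 (map proj₁ (wave-inbox t v)) (∈-map⁺ proj₁ (∈-map⁺ _ (∈-neighbours⁺ G a)))

  top-≤ : ∀ t v → top t v ≤ N
  top-≤ zero    v = s≤s⁻¹ (toℕ<n v)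
  top-≤ (suc t) v = foldr-⊔-≤ _ (map proj₂ (wave-inbox t v)) (top-≤ t v) bound
    where
    bound : ∀ {x} → x ∈ map proj₂ (wave-inbox t v) → x ≤ N
    bound x∈ with ∈-map⁻ proj₂ x∈
    ... | _ , e∈ , refl with ∈-map⁻ _ e∈
    ...   | u , _ , refl = top-≤ t u

  module _ (dist : ∀ u v → ∃[ d ] IsDistance G u v d) where
    open Metric G dist

    depth : Fin (suc N) → ℕ
    depth = d Fin.zero

    top-≥ : ∀ t w v → d w v ≤ t → toℕ w ≤ top t v
    top-≥ t w v le with d w v in eq
    ... | zero rewrite d≡0⇒≡ eq = own t
      where
      own : ∀ t → toℕ v ≤ top t v
      own zero    = ≤-refl
      own (suc t) = ≤-trans (own t) (base (map proj₂ (wave-inbox t v)))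
        where
        base : ∀ {b} xs → b ≤ foldr _⊔_ b xs
        base []       = ≤-refl
        base (x ∷ xs) = ≤-trans (base xs) (m≤n⊔m x _)
    top-≥ (suc t) w v (s≤s le) | suc e with d-pred w eq
    ... | u , a , refl = ≤-trans (top-≥ t w u le)
      (foldr-⊔-≥ _ (map proj₂ (wave-inbox t v)) (∈-map⁺ proj₂ (∈-map⁺ _ (∈-neighbours⁺ G a))))

    -- Nonzero values spread from node 0 by one hop per round.
    far≢0 : ∀ t v → far t v ≢ 0 → depth v ≤ t
    far≢0 zero    Fin.zero    ne = ≤-reflexive (d-refl Fin.zero)
    far≢0 zero    (Fin.suc v) ne = contradiction refl ne
    far≢0 (suc t) v ne with far t v in eq
    ... | suc _ = m≤n⇒m≤1+n (far≢0 t v (λ e → contradiction (trans (sym e) eq) λ ()))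
    ... | zero with foldr-⊔-sel (map proj₁ (wave-inbox t v)) (λ e → ne (cong (spread t 0) e))
      where
      foldr-⊔-sel : ∀ xs → foldr _⊔_ 0 xs ≢ 0 → ∃[ x ] x ∈ xs × x ≢ 0
      foldr-⊔-sel []           ne = contradiction refl ne
      foldr-⊔-sel (zero  ∷ xs) ne with foldr-⊔-sel xs ne
      ... | x , x∈ , x≢0 = x , there x∈ , x≢0
      foldr-⊔-sel (suc x ∷ xs) ne = suc x , here refl , λ ()
    ...   | x , x∈ , x≢0 with ∈-map⁻ proj₁ x∈
    ...     | _ , e∈ , refl with ∈-map⁻ _ e∈
    ...       | u , u∈ , refl =
      ≤-trans (d-adj Fin.zero (Adj-sym G (∈-neighbours⁻ G u∈))) (s≤s (far≢0 t u x≢0))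

    -- Node `w` learns its own depth in round `depth w`, when the wave first reaches it. The news
    -- then travels one hop per round.
    far-≥ : ∀ t w v → depth w + d w v ≤ t → suc (depth w) ≤ far t v
    far-mono : ∀ t v → far t v ≤ far (suc t) v
    far-mono t v = spread-≥ t (far t v) _
    far-≥ t w v le with d w v in eq
    far-≥ (suc t) w v le | suc e with d-pred w eq
    ... | u , a , refl = ≤-trans (far-≥ t w u (s≤s⁻¹ (subst (_≤ suc t) (+-suc (depth w) _) le)))
                           (≤-trans (far-nbr t a) (spread-heard t (far t v) _))
    far-≥ zero w v le | suc e = contradiction (≤-trans (m≤n+m (suc e) (depth w)) le) λ ()
    far-≥ zero w v le | zero with d≡0⇒≡ {Fin.zero} {w} (n≤0⇒n≡0 (≤-trans (m≤m+n _ _) le)) | d≡0⇒≡ eq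
    ... | refl | refl = s≤s (≤-reflexive (d-refl Fin.zero))
    far-≥ (suc t) w v le | zero with d≡0⇒≡ eq
    ... | refl with depth v ≤? t
    ...   | yes le′ = ≤-trans (far-≥ t v v (≤-trans (≤-reflexive (trans (cong (λ z → depth v + z) (d-refl v)) (+-identityʳ _))) le′)) (far-mono t v)
    ...   | no gt = new (≤-antisym (subst (_≤ suc t) (+-identityʳ _) le) (≰⇒> gt))
      where
      -- This is the round in which the wave arrives: `far t v` is still 0, while the predecessor
      -- `u` already holds a nonzero value.
      new : depth v ≡ suc t → suc (depth v) ≤ far (suc t) v
      new dv with d-pred Fin.zero dv
      ... | u , a , du with far t v in fv
      ...   | suc _ = contradiction (far≢0 t v (λ e → contradiction (trans (sym e) fv) λ ())) gt
      ...   | zero with foldr _⊔_ 0 (map proj₁ (wave-inbox t v))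
                      | ≤-trans (far-≥ t u u (≤-trans (≤-reflexive (trans (cong (λ z → depth u + z) (d-refl u)) (+-identityʳ _))) (≤-reflexive du))) (far-nbr t a)
      ...     | suc f | _ = ≤-trans (≤-reflexive (cong suc dv)) (m≤m⊔n (suc (suc t)) (suc f))

    module _ (h : ℕ) (depth-≤h : ∀ v → depth v ≤ h) where

      far-≤ : ∀ t v → far t v ≤ suc h
      far-≤ zero    Fin.zero    = s≤s z≤n
      far-≤ zero    (Fin.suc v) = z≤n
      far-≤ (suc t) v with far t v in fv | foldr-⊔-≤ 0 (map proj₁ (wave-inbox t v)) z≤n bound
        where
        bound : ∀ {x} → x ∈ map proj₁ (wave-inbox t v) → x ≤ suc h
        bound x∈ with ∈-map⁻ proj₁ x∈
        ... | _ , e∈ , refl with ∈-map⁻ _ e∈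
        ...   | u , _ , refl = far-≤ t u
      ... | suc f | le = ⊔-lub (subst (_≤ suc h) fv (far-≤ t v)) le
      ... | zero  | le with foldr _⊔_ 0 (map proj₁ (wave-inbox t v)) in fh
      ...   | zero  = z≤n
      ...   | suc g = ⊔-lub (s≤s (≤-trans st≤ (depth-≤h v))) le
        where
        -- Had the wave been due at `v` by time `t`, `far-≥` would make `far t v` nonzero. So the
        -- recorded time does not exceed the true depth.
        st≤ : suc t ≤ depth v
        st≤ with depth v ≤? t
        ... | no gt   = ≰⇒> gt
        ... | yes le′ = contradiction (≤-trans (far-≥ t v v (≤-trans (≤-reflexive (trans (cong (λ z → depth v + z) (d-refl v)) (+-identityʳ _))) le′)) (≤-reflexive fv)) λ ()

      module _ (w : Fin (suc N)) (deepest : depth w ≡ h) where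

        d-≤2h : ∀ u v → d u v ≤ h + h
        d-≤2h u v = ≤-trans (d-triangle u Fin.zero v)
          (+-mono-≤ (≤-trans (≤-reflexive (d-sym u Fin.zero)) (depth-≤h u)) (depth-≤h v))

        -- The wave needs `h` rounds to the deepest node, and the news at most `2 h` more to any
        -- other; three rounds are to spare.
        far-final : ∀ v → far (3 * suc h) v ≡ suc h
        far-final v = ≤-antisym (far-≤ (3 * suc h) v) (subst (λ z → suc z ≤ far (3 * suc h) v) deepest
          (far-≥ (3 * suc h) w v (≤-trans (+-mono-≤ (≤-reflexive deepest) (d-≤2h w v)) (by-≡ 3 (eq h)))))
          where
          eq : ∀ h → h + (h + h) + 3 ≡ 3 * suc h
          eq = solve-∀

        top-final : ∀ v → top (3 * suc h) v ≡ N
        top-final v = ≤-antisym (top-≤ (3 * suc h) v)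
          (subst (_≤ top (3 * suc h) v) (Fin.toℕ-fromℕ N)
            (top-≥ (3 * suc h) (Fin.fromℕ N) v (≤-trans (d-≤2h _ v) (by-≡ (3 + h) (eq h)))))
          where
          eq : ∀ h → h + h + (3 + h) ≡ 3 * suc h
          eq = solve-∀

        -- If v knew depths only up to f < h, then a node at depth f + 1 would
        -- have been heard of by time (f + 1) + (f + 1) + f.
        not-ready : ∀ t v → t < 3 * suc h → far t v ≢ 0 → t < 3 * far t v
        not-ready t v t<T ne with far t v in fv
        ... | zero  = contradiction refl ne
        ... | suc f with 3 * suc f ≤? t
        ...   | no gt  = ≰⇒> gt
        ...   | yes le = contradiction (subst (suc (suc f) ≤_) fv reached) (<⇒≱ ≤-refl)
          where
          f<h : f < h
          f<h = s≤s⁻¹ (*-cancelˡ-< 3 (suc f) (suc h) (≤-<-trans le t<T))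
          dv≤f : depth v ≤ f
          dv≤f = s≤s⁻¹ (subst (suc (depth v) ≤_) fv (far-≥ t v v (≤-trans (≤-reflexive
            (trans (cong (λ z → depth v + z) (d-refl v)) (+-identityʳ _))) (far≢0 t v (λ e → contradiction (trans (sym e) fv) λ ())))))
          witness : ∃[ w ] depth w ≡ suc f
          witness = d-intermediate Fin.zero {w} (suc f) (h ∸ suc f) (trans deepest (sym (m∸n+n≡m f<h)))
          reached : suc (suc f) ≤ far t v
          reached with witness
          ... | u , du = subst (λ z → suc z ≤ far t v) du (far-≥ t u v (≤-trans
              (+-mono-≤ (≤-reflexive du) (≤-trans (d-triangle u Fin.zero v) (+-mono-≤ (≤-reflexive (trans (d-sym u Fin.zero) du)) dv≤f)))
              (≤-trans (by-≡ 1 (eq f)) le)))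
            where
            eq : ∀ f → suc f + (suc f + f) + 1 ≡ 3 * suc f
            eq = solve-∀

-- The algorithm and its executions

-- A stage with counter r lasts r + 1 more rounds.

data Proc : Set where
  output : ℕ → Proc
  flood  : (N : ℕ) (live : Bool) (ini : List ℕ) (r : ℕ) (log : List (ℕ × ℕ)) (sent : List ℕ)
           (next : List (ℕ × ℕ) → Proc) → Proc
  gossip : (r best : ℕ) (next : ℕ → Proc) → Proc

advance : Proc → List (ℕ × ℕ) → Proc
advance (output o) ms = output o
advance (flood N live ini zero log sent next) ms = next (Keys.extend N live ms log)
advance (flood N live ini (suc r) log sent next) ms =
  flood N live ini r (Keys.extend N live ms log)
    (Keys.record-sent N (Keys.pick N (Keys.keys N ini log) sent) sent) next
advance (gossip zero best next) ms = next (gossip-step best ms)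
advance (gossip (suc r) best next) ms = gossip r (gossip-step best ms) next

value : Proc → ℕ
value (output o) = 0
value (flood N live ini r log sent next) = Keys.pick N (Keys.keys N ini log) sent
value (gossip r best next) = best

data State : Set where
  wave : (self : ℕ) (nbrs : List ℕ) (t far top : ℕ) → State
  proc : Proc → State

toStatus : Proc → Status State
toStatus (output o) = halted o
toStatus p          = running (proc p)

emit : State → Message
emit (wave self nbrs t far top) = encode far ++ encode top
emit (proc p)                   = encode (value p)

decode₁ : Message → ℕ
decode₁ m = proj₁ (decode m)

decode₂ : Message → ℕ × ℕ
decode₂ m = decode₁ m , decode₁ (proj₂ (decode m))

decode₂-encode : ∀ x y → decode₂ (encode x ++ encode y) ≡ (x , y)
decode₂-encode x y = trans (cong (λ p → proj₁ p , decode₁ (proj₂ p)) (decode-encode x (encode y)))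
  (cong (λ z → x , z) (decode-encode′ y))

-- As `far` is 1 + the largest depth known, this tests `3 (h + 1) ≤ t` for the present guess of `h`.
-- By `not-ready` a premature guess fails it. The first conjunct holds back nodes not yet reached.
ready : (t far : ℕ) → Bool
ready t far = not (far ≡ᵇ 0) ∧ (3 * far ≤ᵇ t)

-- Parameters and stages.

module Parameters (c N h : ℕ) where

  -- `a` and `K` are both about `√n`, with `a * K = 2 ^ L ≥ n`. The largest delay that `R` must
  -- allow is `4 h + 1` for handicap plus distance, `m` for the sampled competitors and `K` for a
  -- ball.
  n L a K m R : ℕ
  n = suc N
  L = ⌈log₂ n ⌉
  a = 2 ^ ⌊ L /2⌋
  K = 2 ^ ⌈ L /2⌉
  m = a * (c * L)
  R = K + m + 8 * suc h

  -- exceeds every closed walk length that is ever of interest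
  none : ℕ
  none = 4 * h + 3

  -- No distance exceeds `2 h`, so at every node the keys of all sampled sources at their true
  -- distances come before those of unsampled ones.
  offset : List ℕ → ℕ → ℕ
  offset S s = if does (s ∈? S) then 0 else suc (h + h)

  -- `κ₁` and `κ₂` carry the neighbours' distances and `ks` those of the node itself: neither
  -- neighbour may be farther from the source. A key that reached a neighbour through this node
  -- fails the test.
  Valid : List ℕ → (ℕ × ℕ) × (ℕ × ℕ) → Set
  Valid ks ((y₁ , κ₁) , (y₂ , κ₂)) =
    y₁ ≢ y₂ × κ₁ % n ≡ κ₂ % n × All (λ κ → κ % n ≡ κ₁ % n → κ₁ ≤ κ × κ₂ ≤ κ) ks

  valid? : ∀ ks e → Dec (Valid ks e)
  valid? ks ((y₁ , κ₁) , (y₂ , κ₂)) =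
    ¬? (y₁ ℕ.≟ y₂) ×-dec (κ₁ % n ℕ.≟ κ₂ % n) ×-dec
    All.all? (λ κ → (κ % n ℕ.≟ κ₁ % n) →-dec ((κ₁ ≤? κ) ×-dec (κ₂ ≤? κ))) ks

  -- the length of the closed walk that leaves by y₁, visits the source and
  -- returns by y₂
  loop : List ℕ → (ℕ × ℕ) × (ℕ × ℕ) → ℕ
  loop S ((y₁ , κ₁) , (y₂ , κ₂)) =
    (κ₁ div n ∸ offset S (κ₁ % n)) + (κ₂ div n ∸ offset S (κ₁ % n)) + 2

  shortest-loop : List ℕ → List ℕ → List (ℕ × ℕ) → ℕ
  shortest-loop S ks log =
    foldr _⊓_ none (map (loop S) (filter (valid? ks) (cartesianProduct log log)))

  loop-least : ∀ S ks log {e₁ e₂} → e₁ ∈ log → e₂ ∈ log → Valid ks (e₁ , e₂) →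
    shortest-loop S ks log ≤ loop S (e₁ , e₂)
  loop-least S ks log i₁ i₂ valid =
    foldr-⊓-≤ none _ (∈-map⁺ (loop S) (∈-filter⁺ (valid? ks) (∈-cartesianProduct⁺ i₁ i₂) valid))

  loop-≤-none : ∀ S ks log → shortest-loop S ks log ≤ none
  loop-≤-none S ks log = foldr-⊓-≤ᵈ none (map (loop S) (filter (valid? ks) (cartesianProduct log log)))

  loop-attained : ∀ S ks log → shortest-loop S ks log < none →
    ∃[ e₁ ] ∃[ e₂ ] e₁ ∈ log × e₂ ∈ log × Valid ks (e₁ , e₂) × shortest-loop S ks log ≡ loop S (e₁ , e₂)
  loop-attained S ks log lt
    with foldr-⊓-sel none (map (loop S) (filter (valid? ks) (cartesianProduct log log)))
  ... | inj₁ eq = contradiction eq (<⇒≢ lt)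
  ... | inj₂ i with ∈-map⁻ (loop S) i
  ...   | (e₁ , e₂) , j , eq with ∈-filter⁻ (valid? ks) {xs = cartesianProduct log log} j
  ...     | k , valid with ∈-cartesianProduct⁻ log log k
  ...       | i₁ , i₂ = e₁ , e₂ , i₁ , i₂ , valid , eq

  -- A node's own key is left out, since it stands for the walk of length 2 from `x` to the node and
  -- back.
  through : (x self : ℕ) → List ℕ → List ℕ → ℕ
  through x self nbrs ks =
    if does (x ∈? nbrs)
    then foldr _⊓_ none (map (λ κ → κ div n + 2) (filter (λ κ → ¬? (κ % n ℕ.≟ self)) ks))
    else none

  ini₂ : List ℕ → ℕ → List ℕ
  ini₂ S self = offset S self * n + self ∷ []

  ini₃ : (x self : ℕ) → List ℕ → List ℕ
  ini₃ x self nbrs = if does (x ∈? nbrs) then self ∷ [] else []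

  sampled : List ℕ → List (ℕ × ℕ) → List ℕ
  sampled ini log = map (_% n) (Keys.keys N ini log)

  module _ (self : ℕ) (nbrs : List ℕ) where

    stage₅ : ℕ → List (ℕ × ℕ) → Proc
    stage₅ x log = gossip R (through x self nbrs (Keys.keys N (ini₃ x self nbrs) log)) output

    stage₄ : ℕ → Proc
    stage₄ x = flood N (not (does (self ℕ.≟ x))) (ini₃ x self nbrs) R [] [] (stage₅ x)

    stage₃ : List ℕ → List (ℕ × ℕ) → Proc
    stage₃ S log = gossip R (shortest-loop S (Keys.keys N (ini₂ S self) log) log * n + self)
      (λ code → stage₄ (code % n))

    stage₂ : List ℕ → Proc
    stage₂ S = flood N true (ini₂ S self) R [] [] (stage₃ S)

    stage₁ : List ℕ → Proc
    stage₁ ini = flood N true ini R [] [] (λ log → stage₂ (sampled ini log))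

  -- Fair coins give uniform numbers below `2 ^ L`, hence the reduction modulo `n`.
  launch : ℕ → List ℕ → Rand (Status State)
  launch zero       nbrs = draws L m >>= λ is → ret (toStatus (stage₁ 0 nbrs (map (_% n) (Vec.toList is))))
  launch self@(suc _) nbrs = ret (toStatus (stage₁ self nbrs []))

wave-step : (c self : ℕ) (nbrs : List ℕ) (t far top : ℕ) → List (ℕ × ℕ) → Rand (Status State)
wave-step c self nbrs t far top ms =
  if ready (suc t) far′
  then Parameters.launch c top′ (pred far′) self nbrs
  else ret (running (wave self nbrs (suc t) far′ top′))
  where
  far′ = spread t far (foldr _⊔_ 0 (map proj₁ ms))
  top′ = foldr _⊔_ top (map proj₂ ms)

algorithm : ℕ → Algorithm
algorithm c = record
  { State = State
  ; init  = λ where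
      zero         nbrs → ret (wave zero nbrs 0 1 zero)
      self@(suc _) nbrs → ret (wave self nbrs 0 0 self)
  ; send  = λ s _ → emit s
  ; step  = λ where
      (wave self nbrs t far top) ms → wave-step c self nbrs t far top (map (λ e → decode₂ (proj₂ e)) ms)
      (proc p) ms → ret (toStatus (advance p (map (λ e → proj₁ e , decode₁ (proj₂ e)) ms)))
  }

-- Executions as iterated deterministic rounds.

module Execution (c N : ℕ) (G : Graph (suc N)) where
  private
    A = algorithm c
    n = suc N

  nbrs : Fin n → List ℕ
  nbrs v = map toℕ (neighbours G v)

  message-running : ∀ (σ : Config A G) v {s} u → Vec.lookup σ v ≡ running s → message A G σ v u ≡ emit s
  message-running σ v u eq with Vec.lookup σ v | eq
  ... | _ | refl = refl

  message-halted : ∀ (σ : Config A G) v {o} u → Vec.lookup σ v ≡ halted o → message A G σ v u ≡ []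
  message-halted σ v u eq with Vec.lookup σ v | eq
  ... | _ | refl = refl

  stepNode-running : ∀ (σ : Config A G) v {s} → Vec.lookup σ v ≡ running s →
    stepNode A G σ v ≡ Algorithm.step A s (inbox A G σ v)
  stepNode-running σ v eq with Vec.lookup σ v | eq
  ... | _ | refl = refl

  stepNode-halted : ∀ (σ : Config A G) v {o} → Vec.lookup σ v ≡ halted o →
    stepNode A G σ v ≡ ret (halted o)
  stepNode-halted σ v eq with Vec.lookup σ v | eq
  ... | _ | refl = refl

  config : (Fin n → Proc) → Config A G
  config p = Vec.tabulate (toStatus ∘ p)

  pround : (Fin n → Proc) → Fin n → Proc
  pround p v = advance (p v) (map (λ u → toℕ u , value (p u)) (neighbours G v))

  prounds : ℕ → (Fin n → Proc) → Fin n → Proc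
  prounds zero    p = p
  prounds (suc j) p = pround (prounds j p)

  prounds-+ : ∀ i j p → prounds (i + j) p ≡ prounds i (prounds j p)
  prounds-+ zero    j p = refl
  prounds-+ (suc i) j p = cong pround (prounds-+ i j p)

  pround-cong : ∀ {p q} → (∀ v → p v ≡ q v) → ∀ v → pround p v ≡ pround q v
  pround-cong eq v = cong₂ advance (eq v) (map-cong (λ u → cong (λ z → toℕ u , value z) (eq u)) (neighbours G v))

  lookup-config : ∀ p v → Vec.lookup (config p) v ≡ toStatus (p v)
  lookup-config p v = lookup∘tabulate (toStatus ∘ p) v

  decode-message : ∀ p v u → decode₁ (message A G (config p) v u) ≡ value (p v)
  decode-message p v u = aux (p v) (lookup-config p v)
    where
    aux : ∀ q → Vec.lookup (config p) v ≡ toStatus q → decode₁ (message A G (config p) v u) ≡ value q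
    aux (output o)            eq = cong decode₁ (message-halted (config p) v u eq)
    aux q@(flood _ _ _ _ _ _ _) eq = trans (cong decode₁ (message-running (config p) v u eq)) (decode-encode′ (value q))
    aux q@(gossip _ _ _)      eq = trans (cong decode₁ (message-running (config p) v u eq)) (decode-encode′ (value q))

  decode-inbox : ∀ p v → map (λ e → proj₁ e , decode₁ (proj₂ e)) (inbox A G (config p) v)
                       ≡ map (λ u → toℕ u , value (p u)) (neighbours G v)
  decode-inbox p v = trans (sym (map-∘ (neighbours G v)))
    (map-cong (λ u → cong (λ z → toℕ u , z) (decode-message p u v)) (neighbours G v))

  stepNode-config : ∀ p v → stepNode A G (config p) v ≡ ret (toStatus (pround p v))
  stepNode-config p v = aux (p v) refl
    where
    running-case : ∀ q → p v ≡ q → Vec.lookup (config p) v ≡ running (proc q) →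
      stepNode A G (config p) v ≡ ret (toStatus (pround p v))
    running-case q eq lk = trans (stepNode-running (config p) v lk)
      (cong (ret ∘ toStatus) (cong₂ advance (sym eq) (decode-inbox p v)))
    aux : ∀ q → p v ≡ q → stepNode A G (config p) v ≡ ret (toStatus (pround p v))
    aux (output o) eq = trans (stepNode-halted (config p) v (trans (lookup-config p v) (cong toStatus eq)))
      (cong (λ z → ret (toStatus (advance z (map (λ u → toℕ u , value (p u)) (neighbours G v))))) (sym eq))
    aux q@(flood _ _ _ _ _ _ _) eq = running-case q eq (trans (lookup-config p v) (cong toStatus eq))
    aux q@(gossip _ _ _)        eq = running-case q eq (trans (lookup-config p v) (cong toStatus eq))

  round-config : ∀ p → round A G (config p) ≡ ret (config (pround p))
  round-config p = sequence-ret (stepNode-config p)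

  -- Once `ω` is drawn no coin is tossed any more, so associativity of `>>=` lets the later rounds
  -- act inside the draw.
  run-from : ∀ {Ω : Set} {t} (x : Rand Ω) (p : Ω → Fin n → Proc) →
    run A G t ≡ (x >>= λ ω → ret (config (p ω))) →
    ∀ j → run A G (j + t) ≡ (x >>= λ ω → ret (config (prounds j (p ω))))
  run-from x p eq zero = eq
  run-from x p eq (suc j) = trans (cong (_>>= round A G) (run-from x p eq j))
    (trans (>>=-assoc x _ _) (>>=-cong x (λ ω → round-config (prounds j (p ω)))))

  open Wave N G

  waving : ℕ → Fin n → State
  waving t v = wave (toℕ v) (nbrs v) t (far t v) (top t v)

  wave-config : ℕ → Config A G
  wave-config t = Vec.tabulate (running ∘ waving t)

  start-wave : start A G ≡ ret (wave-config 0)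
  start-wave = sequence-ret
    {f = λ u → Algorithm.init A (toℕ u) (nbrs u) >>= λ s → ret (running s)} {h = running ∘ waving 0} λ where
    Fin.zero    → refl
    (Fin.suc u) → refl

  stepNode-wave : ∀ t v → stepNode A G (wave-config t) v ≡
    (if ready (suc t) (far (suc t) v)
     then Parameters.launch c (top (suc t) v) (pred (far (suc t) v)) (toℕ v) (nbrs v)
     else ret (running (waving (suc t) v)))
  stepNode-wave t v = trans (stepNode-running (wave-config t) v (lookup∘tabulate (running ∘ waving t) v))
    (cong (wave-step c (toℕ v) (nbrs v) t (far t v) (top t v))
      (trans (sym (map-∘ (neighbours G v))) (map-cong received (neighbours G v))))
    where
    received : ∀ u → decode₂ (message A G (wave-config t) u v) ≡ (far t u , top t u)
    received u = trans (cong decode₂ (message-running (wave-config t) u v (lookup∘tabulate (running ∘ waving t) u)))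
      (decode₂-encode (far t u) (top t u))

  started : ∀ h → Vec ℕ (Parameters.m c N h) → Fin n → Proc
  started h is Fin.zero      = Parameters.stage₁ c N h 0 (nbrs Fin.zero) (map (_% n) (Vec.toList is))
  started h is v@(Fin.suc _) = Parameters.stage₁ c N h (toℕ v) (nbrs v) []

  module _ (dist : ∀ u v → ∃[ d ] IsDistance G u v d) (h : ℕ)
           (depth-≤h : ∀ v → depth dist v ≤ h) (w : Fin n) (deepest : depth dist w ≡ h) where
    open Parameters c N h hiding (n)

    T₁ : ℕ
    T₁ = 3 * suc h

    run-wave : ∀ t → t < T₁ → run A G t ≡ ret (wave-config t)
    run-wave zero    lt = start-wave
    run-wave (suc t) lt rewrite run-wave t (<-trans (n<1+n t) lt) = sequence-ret λ v →
      trans (stepNode-wave t v)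
        (cong (λ b → if b then Parameters.launch c (top (suc t) v) (pred (far (suc t) v)) (toℕ v) (nbrs v)
               else ret (running (waving (suc t) v))) (early v))
      where
      early : ∀ v → ready (suc t) (far (suc t) v) ≡ false
      early v with far (suc t) v | not-ready dist h depth-≤h w deepest (suc t) v lt
      ... | zero  | _ = refl
      ... | suc f | later with 3 * suc f ≤ᵇ suc t | ≤ᵇ⇒≤ (3 * suc f) (suc t)
      ...   | false | _  = refl
      ...   | true  | le = contradiction (le tt) (<⇒≱ (later λ ()))

    run-T₁ : run A G T₁ ≡ (draws L m >>= λ is → ret (config (started h is)))
    run-T₁ = trans (cong (_>>= round A G) (run-wave t ≤-refl))
      (sequence-head {f = stepNode A G (wave-config t)} (draws L m) {h = λ is v → toStatus (started h is v)} (launched Fin.zero) (λ is u → launched (Fin.suc u)))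
      where
      t = pred T₁
      launched : ∀ v → stepNode A G (wave-config t) v ≡ launch (toℕ v) (nbrs v)
      launched v = trans (stepNode-wave t v) (final (far T₁ v) (top T₁ v)
        (far-final dist h depth-≤h w deepest v) (top-final dist h depth-≤h w deepest v))
        where
        final : ∀ f p → f ≡ suc h → p ≡ N →
          (if ready T₁ f then Parameters.launch c p (pred f) (toℕ v) (nbrs v)
           else ret (running (wave (toℕ v) (nbrs v) T₁ f p))) ≡ launch (toℕ v) (nbrs v)
        final f p refl refl with T₁ ≤ᵇ T₁ | ≤⇒≤ᵇ (≤-refl {T₁})
        ... | true | _ = refl

    run-proc : ∀ j → run A G (j + T₁) ≡ (draws L m >>= λ is → ret (config (prounds j (started h is))))
    run-proc = run-from (draws L m) (started h) run-T₁

  Bounded : ℕ → (Fin n → Proc) → Set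
  Bounded Q p = ∀ j v → value (prounds j p v) ≤ Q

  Bounded-output : ∀ {Q p} {o : Fin n → ℕ} → (∀ v → p v ≡ output (o v)) → Bounded Q p
  Bounded-output {Q} {p} {o} eq j v = subst (λ z → value z ≤ Q) (sym (stays j v)) z≤n
    where
    stays : ∀ j v → prounds j p v ≡ output (o v)
    stays zero    v = eq v
    stays (suc j) v = pround-cong (stays j) v

  module _ {p : Fin n → Proc} {R : ℕ} where

    -- The bound is assembled from the last stage backwards. Here and below `t` is a variable with
    -- `t ≡ suc R`, so that `prounds t` does not unfold.
    Bounded-+ : ∀ {Q t} → t ≡ suc R → (∀ j → j ≤ R → ∀ v → value (prounds j p v) ≤ Q) →
      Bounded Q (prounds t p) → Bounded Q p
    Bounded-+ {Q} {t} refl first rest j v with j ≤? R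
    ... | yes le = first j le v
    ... | no nle = subst (λ z → value z ≤ Q) (cong (λ f → f v)
            (trans (sym (prounds-+ (j ∸ t) t p)) (cong (λ i → prounds i p) (m∸n+n≡m (≰⇒> nle)))))
            (rest (j ∸ t) v)

    module _ {live : Fin n → Bool} {ini : Fin n → List ℕ} {next : Fin n → List (ℕ × ℕ) → Proc}
             (eq : ∀ v → p v ≡ flood N (live v) (ini v) R [] [] (next v)) where
      open Flood N G live ini

      flooding : ∀ j r → j + r ≡ R → ∀ v →
        prounds j p v ≡ flood N (live v) (ini v) r (log j v) (sent j v) (next v)
      flooding zero    r refl v = eq v
      flooding (suc j) r e    v = pround-cong (flooding j (suc r) (trans (+-suc j r) e)) v

      flooded : ∀ {t} → t ≡ suc R → ∀ v → prounds t p v ≡ next v (log t v)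
      flooded refl v = pround-cong (flooding R 0 (+-identityʳ R)) v

      Bounded-flood : ∀ {Q t B} → t ≡ suc R → (∀ {v κ} → κ ∈ ini v → κ ≤ B) → suc (B + R * n) ≤ Q →
        Bounded Q (prounds t p) → Bounded Q p
      Bounded-flood {Q} {B = B} t≡ ini-≤B le = Bounded-+ t≡ λ j j≤R v →
        subst (λ z → value z ≤ Q) (sym (flooding j (R ∸ j) (m+[n∸m]≡n j≤R) v))
          (≤-trans (out-≤ ini-≤B j v) (≤-trans (s≤s (+-monoʳ-≤ B (*-monoˡ-≤ n j≤R))) le))

    module _ {val : Fin n → ℕ} {next : Fin n → ℕ → Proc}
             (eq : ∀ v → p v ≡ gossip R (val v) (next v)) where
      open Gossip G val

      gossiping : ∀ j r → j + r ≡ R → ∀ v → prounds j p v ≡ gossip r (best j v) (next v)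
      gossiping zero    r refl v = eq v
      gossiping (suc j) r e    v = pround-cong (gossiping j (suc r) (trans (+-suc j r) e)) v

      gossiped : ∀ {t} → t ≡ suc R → ∀ v → prounds t p v ≡ next v (best t v)
      gossiped refl v = pround-cong (gossiping R 0 (+-identityʳ R)) v

      Bounded-gossip : ∀ {Q t} → t ≡ suc R → (∀ v → val v ≤ Q) → Bounded Q (prounds t p) → Bounded Q p
      Bounded-gossip {Q} t≡ val≤ = Bounded-+ t≡ λ j j≤R v →
        subst (λ z → value z ≤ Q) (sym (gossiping j (R ∸ j) (m+[n∸m]≡n j≤R) v))
          (≤-trans (≤-reflexive (proj₂ (best-attained j v))) (val≤ _))

-- Closed trails and shortest walks

argmax : ∀ (f : ℕ → ℕ) g → ∃[ i ] i ≤ g × (∀ j → j ≤ g → f j ≤ f i)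
argmax f zero = 0 , z≤n , λ { zero z≤n → ≤-refl }
argmax f (suc g) with argmax f g
... | i , i≤g , best with f i ≤? f (suc g)
...   | yes le = suc g , ≤-refl , λ j j≤ → case m≤n⇒m<n∨m≡n j≤ of λ where
          (inj₁ j<)   → ≤-trans (best j (s≤s⁻¹ j<)) le
          (inj₂ refl) → ≤-refl
...   | no nle = i , m≤n⇒m≤1+n i≤g , λ j j≤ → case m≤n⇒m<n∨m≡n j≤ of λ where
          (inj₁ j<)   → best j (s≤s⁻¹ j<)
          (inj₂ refl) → <⇒≤ (≰⇒> nle)

module _ {n : ℕ} (G : Graph n) where

  -- A periodic sequence on all of `ℕ` has no seam and can be shifted to start at any of its
  -- vertices. `turn` makes the two neighbours of a peak distinct.
  record ClosedTrail (g : ℕ) : Set where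
    field
      at     : ℕ → Fin n
      edge   : ∀ i → Adj G (at i) (at (suc i))
      period : ∀ i → at (i + g) ≡ at i
      turn   : ∀ i → at i ≢ at (2 + i)

  open ClosedTrail

  shift : ∀ {g} → ℕ → ClosedTrail g → ClosedTrail g
  shift {g} k C = record
    { at     = λ i → at C (i + k)
    ; edge   = λ i → edge C (i + k)
    ; period = λ i → trans (cong (at C) (swap i g k)) (period C (i + k))
    ; turn   = λ i → turn C (i + k)
    }
    where
    swap : ∀ i g k → i + g + k ≡ i + k + g
    swap = solve-∀

  nth : Fin n → List (Fin n) → ℕ → Fin n
  nth z []       i       = z
  nth z (x ∷ xs) zero    = x
  nth z (x ∷ xs) (suc i) = nth z xs i

  nth-∈ : ∀ z xs i → i < length xs → nth z xs i ∈ xs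
  nth-∈ z (x ∷ xs) zero    lt       = here refl
  nth-∈ z (x ∷ xs) (suc i) (s≤s lt) = there (nth-∈ z xs i lt)

  nth-injective : ∀ z {xs} → Unique xs → ∀ i j → i < length xs → j < length xs →
    nth z xs i ≡ nth z xs j → i ≡ j
  nth-injective z {x ∷ xs} (_ ∷ _)   zero    zero    _ _ _ = refl
  nth-injective z {x ∷ xs} (x∉ ∷ _)  zero    (suc j) _ (s≤s lt) eq = contradiction eq (All.lookup x∉ (nth-∈ z xs j lt))
  nth-injective z {x ∷ xs} (x∉ ∷ _)  (suc i) zero    (s≤s lt) _ eq = contradiction (sym eq) (All.lookup x∉ (nth-∈ z xs i lt))
  nth-injective z {x ∷ xs} (_ ∷ un)  (suc i) (suc j) (s≤s li) (s≤s lj) eq = cong suc (nth-injective z un i j li lj eq)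

  length-vertices : ∀ {u v ℓ} (p : Walk G u v ℓ) → length (vertices G p) ≡ suc ℓ
  length-vertices []      = refl
  length-vertices (_ ∷ p) = cong suc (length-vertices p)

  nth-first : ∀ z {u v ℓ} (p : Walk G u v ℓ) → nth z (vertices G p) 0 ≡ u
  nth-first z []      = refl
  nth-first z (_ ∷ p) = refl

  nth-last : ∀ z {u v ℓ} (p : Walk G u v ℓ) → nth z (vertices G p) ℓ ≡ v
  nth-last z []      = refl
  nth-last z (_ ∷ p) = nth-last z p

  nth-edge : ∀ z {u v ℓ} (p : Walk G u v ℓ) i → i < ℓ →
    Adj G (nth z (vertices G p) i) (nth z (vertices G p) (suc i))
  nth-edge z (_∷_ {u = u} a p) zero    _        = subst (Adj G u) (sym (nth-first z p)) a
  nth-edge z (_ ∷ p)           (suc i) (s≤s lt) = nth-edge z p i lt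

  Cycle⇒ClosedTrail : ∀ {g} → Cycle G g → 3 ≤ g × ClosedTrail g
  Cycle⇒ClosedTrail (close {u} {v} {ℓ} p unique 2≤ℓ a) = s≤s 2≤ℓ , record
    { at     = at′
    ; edge   = edge′
    ; period = λ i → cong (nth u vs) ([m+n]%n≡m%n i g)
    ; turn   = turn′
    }
    where
    g  = suc ℓ
    vs = vertices G p
    at′ : ℕ → Fin n
    at′ i = nth u vs (i % g)
    step : ∀ k i → (k + i) % g ≡ (k + i % g) % g
    step k i = begin
      (k + i) % g                           ≡⟨ cong (λ z → (k + z) % g) (m≡m%n+[m/n]*n i g) ⟩
      (k + (i % g + i div g * g)) % g       ≡⟨ cong (_% g) (+-assoc k (i % g) _) ⟨
      (k + i % g + i div g * g) % g         ≡⟨ [m+kn]%n≡m%n (k + i % g) (i div g) g ⟩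
      (k + i % g) % g                       ∎
      where open ≡-Reasoning
    wrap : ∀ r k → r < g → g ≤ k + r → k + r < g + g → (k + r) % g + g ≡ k + r
    wrap r k r< le lt = begin
      (k + r) % g + g            ≡⟨ cong (λ z → z % g + g) (m∸n+n≡m le) ⟨
      ((k + r ∸ g) + g) % g + g  ≡⟨ cong (_+ g) ([m+n]%n≡m%n (k + r ∸ g) g) ⟩
      (k + r ∸ g) % g + g        ≡⟨ cong (_+ g) (m<n⇒m%n≡m (+-cancelʳ-< g (k + r ∸ g) g (subst (_< g + g) (sym (m∸n+n≡m le)) lt))) ⟩
      k + r ∸ g + g              ≡⟨ m∸n+n≡m le ⟩
      k + r                      ∎
      where open ≡-Reasoning
    edge-at : ∀ r → r < g → Adj G (nth u vs r) (nth u vs (suc r % g))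
    edge-at r r<g with r <? ℓ
    ... | yes lt = subst (λ z → Adj G (nth u vs r) (nth u vs z)) (sym (m<n⇒m%n≡m (s≤s lt))) (nth-edge u p r lt)
    ... | no nlt with ≤-antisym (s≤s⁻¹ r<g) (≮⇒≥ nlt)
    ...   | refl = subst (λ z → Adj G (nth u vs ℓ) (nth u vs z)) (sym (n%n≡0 g))
                     (subst (λ z → Adj G z (nth u vs 0)) (sym (nth-last u p))
                       (subst (Adj G v) (sym (nth-first u p)) a))
    edge′ : ∀ i → Adj G (at′ i) (at′ (suc i))
    edge′ i = subst (λ z → Adj G (at′ i) (nth u vs z)) (sym (step 1 i)) (edge-at (i % g) (m%n<n i g))
    len : ∀ {r} → r < g → r < length vs
    len lt = subst (_ <_) (sym (length-vertices p)) lt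
    -- Two steps that wrap around to `r` give `r + 2 = r + g`, against `3 ≤ g`.
    turn-at : ∀ r → r < g → r ≢ (2 + r) % g
    turn-at r r<g eq with 2 + r <? g
    ... | yes lt = m≢1+m+n r {1} (trans eq (trans (m<n⇒m%n≡m lt) (cong suc (+-comm 1 r))))
    ... | no nlt = <⇒≢ (s≤s 2≤ℓ) (+-cancelˡ-≡ r _ _ (trans (+-comm r 2) (trans (sym (wrap r 2 r<g (≮⇒≥ nlt)
        (+-mono-<-≤ (≤-trans (n<1+n 2) (s≤s 2≤ℓ)) (<⇒≤ r<g)))) (cong (_+ g) (sym eq)))))
    turn′ : ∀ i → at′ i ≢ at′ (2 + i)
    turn′ i eq = turn-at (i % g) (m%n<n i g) (trans
      (nth-injective u unique (i % g) ((2 + i) % g) (len (m%n<n i g)) (len (m%n<n (2 + i) g)) eq) (step 2 i))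

  -- If the first vertex occurred again, the rest of the walk from there on would be shorter.
  shortest⇒Unique : ∀ {u v ℓ} (p : Walk G u v ℓ) → (∀ ℓ′ → Walk G u v ℓ′ → ℓ ≤ ℓ′) → Unique (vertices G p)
  shortest⇒Unique []      min = [] ∷ []
  shortest⇒Unique {u} {v} (_∷_ {ℓ = ℓ} a p) min =
    All.tabulate (λ {w} w∈ u≡w → <⇒≱ ≤-refl (shorter (subst (_∈ vertices G p) (sym u≡w) w∈))) ∷
    shortest⇒Unique p (λ ℓ′ q → s≤s⁻¹ (min (suc ℓ′) (a ∷ q)))
    where
    suffix : ∀ {w x y ℓ} (p : Walk G x y ℓ) → w ∈ vertices G p → ∃[ ℓ′ ] ℓ′ ≤ ℓ × Walk G w y ℓ′
    suffix []      (here refl) = 0 , z≤n , []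
    suffix (a ∷ p) (here refl) = _ , ≤-refl , a ∷ p
    suffix (a ∷ p) (there i) with suffix p i
    ... | ℓ′ , le , q = ℓ′ , m≤n⇒m≤1+n le , q
    shorter : u ∈ vertices G p → suc ℓ ≤ ℓ
    shorter i with suffix p i
    ... | ℓ′ , le , q = ≤-trans (min ℓ′ q) le

  Unique⇒length-≤ : ∀ {xs : List (Fin n)} → Unique xs → length xs ≤ n
  Unique⇒length-≤ {xs} un with length xs ≤? n
  ... | yes le = le
  ... | no nle with Fin.pigeonhole (≰⇒> nle) (List.lookup xs)
  ...   | i , j , i<j , eq = contradiction (lookup-injective un i j eq) (λ e → <⇒≢ i<j (cong toℕ e))
    where
    lookup-injective : ∀ {xs : List (Fin n)} → Unique xs → ∀ i j → List.lookup xs i ≡ List.lookup xs j → i ≡ j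
    lookup-injective (_ ∷ _)  Fin.zero    Fin.zero    _  = refl
    lookup-injective (x∉ ∷ _) Fin.zero    (Fin.suc j) eq = contradiction eq (All.lookup x∉ (∈-lookup j))
    lookup-injective (x∉ ∷ _) (Fin.suc i) Fin.zero    eq = contradiction (sym eq) (All.lookup x∉ (∈-lookup i))
    lookup-injective (_ ∷ un) (Fin.suc i) (Fin.suc j) eq = cong Fin.suc (lookup-injective un i j eq)

  module _ (f : Fin n → Bool) where
    -- The induced subgraph, with the removed vertices kept as isolated ones so that the vertex type
    -- does not change.
    restrict : Graph n
    restrict = record
      { adj    = λ u v → Graph.adj G u v ∧ (f u ∧ f v)
      ; sym    = λ u v → cong₂ _∧_ (Graph.sym G u v) (∧-comm (f u) (f v))
      ; irrefl = λ u → cong (_∧ (f u ∧ f u)) (Graph.irrefl G u)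
      }

    restrict⁺ : ∀ {u v} → T (f u) → T (f v) → Adj G u v → Adj restrict u v
    restrict⁺ tu tv a = Equivalence.from T-∧ (a , Equivalence.from T-∧ (tu , tv))

    restrict⁻ : ∀ {u v} → Adj restrict u v → Adj G u v × T (f u) × T (f v)
    restrict⁻ a with Equivalence.to T-∧ a
    ... | b , fs = b , Equivalence.to T-∧ fs

    unrestrict : ∀ {u v ℓ} → Walk restrict u v ℓ → Walk G u v ℓ
    unrestrict []      = []
    unrestrict (a ∷ p) = proj₁ (restrict⁻ a) ∷ unrestrict p

    vertices-unrestrict : ∀ {u v ℓ} (p : Walk restrict u v ℓ) → vertices G (unrestrict p) ≡ vertices restrict p
    vertices-unrestrict []      = refl
    vertices-unrestrict (_ ∷ p) = cong (_ ∷_) (vertices-unrestrict p)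

    vertices-kept : ∀ {u v ℓ} (p : Walk restrict u v ℓ) → T (f u) → All (T ∘ f) (vertices restrict p)
    vertices-kept []      tu = tu ∷ []
    vertices-kept (a ∷ p) tu = tu ∷ vertices-kept p (proj₂ (proj₂ (restrict⁻ a)))

-- Keys as walks among the live vertices.

module _ (N : ℕ) (G : Graph (suc N)) (live : Fin (suc N) → Bool) (ini : Fin (suc N) → List ℕ) where
  open Flood N G live ini

  Reach-live : ∀ {x κ} → Reach x κ → T (live x)
  Reach-live (origin l _) = l
  Reach-live (hop l _ _)  = l

  Reach⇒walk : ∀ {x κ} → Reach x κ →
    ∃[ u ] ∃[ κ₀ ] ∃[ ℓ ] T (live u) × κ₀ ∈ ini u × Walk (restrict G live) u x ℓ × κ ≡ κ₀ + ℓ * suc N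
  Reach⇒walk (origin {x} {κ} l i) = x , κ , 0 , l , i , [] , sym (+-identityʳ κ)
  Reach⇒walk (hop {x} {y} {κ} l a r) with Reach⇒walk r
  ... | u , κ₀ , ℓ , lu , i , p , refl =
    u , κ₀ , suc ℓ , lu , i , walk-snoc (restrict G live) p (restrict⁺ G live (Reach-live r) l (Adj-sym G a)) ,
    eq κ₀ ℓ (suc N)
    where
    eq : ∀ κ ℓ n → κ + ℓ * n + n ≡ κ + suc ℓ * n
    eq = solve-∀

  walk⇒Reach : ∀ {u x κ₀ ℓ} → Reach u κ₀ → Walk (restrict G live) u x ℓ → Reach x (κ₀ + ℓ * suc N)
  walk⇒Reach {κ₀ = κ₀} r [] = subst (Reach _) (sym (+-identityʳ κ₀)) r
  walk⇒Reach {κ₀ = κ₀} {suc ℓ} r (a ∷ p) with restrict⁻ G live a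
  ... | b , _ , lv = subst (Reach _) (+-assoc κ₀ (suc N) (ℓ * suc N)) (walk⇒Reach (hop lv (Adj-sym G b) r) p)

-- The vertex of a closed trail farthest from a source.

module _ {n : ℕ} (G : Graph n) (dist : ∀ u v → ∃[ d ] IsDistance G u v d) {k half : ℕ}
         (C : ClosedTrail G (suc (k + half))) where
  open Metric G dist
  open ClosedTrail C
  private
    g = suc (k + half)

  record Peak (s : Fin n) : Set where
    field
      x y₁ y₂ : Fin n
      adj₁ : Adj G x y₁
      adj₂ : Adj G x y₂
      y₁≢y₂ : y₁ ≢ y₂
      below₁ : d s y₁ ≤ d s x
      below₂ : d s y₂ ≤ d s x

  module _ (half≤ : half ≤ suc k) (k≤ : k ≤ half) (1≤k : 1 ≤ k) (s : Fin n) where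

    private
      e : ℕ → ℕ
      e j = d s (at j)

      e-up : ∀ i j → e (i + j) ≤ e j + i
      e-up zero    j = ≤-reflexive (sym (+-identityʳ (e j)))
      e-up (suc i) j = ≤-trans (d-adj s (edge (i + j)))
        (≤-trans (s≤s (e-up i j)) (≤-reflexive (sym (+-suc (e j) i))))

      e-down : ∀ i j → e j ≤ e (i + j) + i
      e-down zero    j = ≤-reflexive (sym (+-identityʳ (e j)))
      e-down (suc i) j = ≤-trans (e-down i j) (≤-trans (+-monoˡ-≤ i (d-adj s (Adj-sym G (edge (i + j)))))
        (≤-reflexive (sym (+-suc (e (suc (i + j))) i))))

      e-period : ∀ j → e (j + g) ≡ e j
      e-period j = cong (d s) (period j)

      from-left : ∀ i → e i ≤ e 0 + i
      from-left i = subst (λ z → e z ≤ e 0 + i) (+-identityʳ i) (e-up i 0)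

      from-right : ∀ i i′ → i′ + i ≡ g → e i ≤ e 0 + i′
      from-right i i′ eq = subst (λ z → e i ≤ z + i′) (trans (cong e eq) (e-period 0)) (e-down i′ i)

    -- The maximum is taken over the indices 1 to `g`, one full period, so that `suc i` has a left
    -- neighbour. At both ends `period` carries the comparison around.
    peak : ∃[ i ] i ≤ k + half × e i ≤ e (suc i) × e (2 + i) ≤ e (suc i)
    peak with argmax (e ∘ suc) (k + half)
    ... | i , i≤ , best = i , i≤ , left i i≤ best , right
      where
      left : ∀ i → i ≤ k + half → (∀ j → j ≤ k + half → e (suc j) ≤ e (suc i)) → e i ≤ e (suc i)
      left zero    _  best = subst (_≤ e 1) (e-period 0) (best (k + half) ≤-refl)
      left (suc i) i≤ best = best i (≤-trans (n≤1+n i) i≤)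
      right : e (2 + i) ≤ e (suc i)
      right with m≤n⇒m<n∨m≡n i≤
      ... | inj₁ lt   = best (suc i) lt
      ... | inj₂ refl = subst (_≤ e g) (sym (e-period 1)) (best 0 z≤n)

    toPeak : ∀ i → e i ≤ e (suc i) → e (2 + i) ≤ e (suc i) → Peak s
    toPeak i l r = record
      { x = at (suc i) ; y₁ = at i ; y₂ = at (2 + i)
      ; adj₁ = Adj-sym G (edge i) ; adj₂ = edge (suc i) ; y₁≢y₂ = turn i
      ; below₁ = l ; below₂ = r }

    -- Along the shorter side the peak is at most `half` steps from `at 0`, hence at distance at
    -- most `k + half = g - 1` from `s`. The neighbour on that side is a step nearer to `at 0`,
    -- which gives `g - 2` for it.
    near-peak : e 0 ≤ k → ∃[ i ] ∃[ l ] ∃[ r ] let P = toPeak i l r in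
      d s (Peak.y₁ P) + d s (Peak.y₂ P) + 3 ≤ 2 * g
    near-peak e0≤k with peak
    ... | i , i≤ , l , r = i , l , r , sum
      where
      top≤ : e (suc i) ≤ k + half
      top≤ with suc i ≤? half
      ... | yes le = ≤-trans (from-left (suc i)) (+-mono-≤ e0≤k le)
      ... | no nle = ≤-trans (from-right (suc i) (k + half ∸ i) (cong′ i≤))
                       (+-mono-≤ e0≤k (≤-trans (∸-monoʳ-≤ (k + half) (s≤s⁻¹ (≰⇒> nle))) (≤-trans (≤-reflexive (m+n∸n≡m k half)) k≤)))
        where
        cong′ : i ≤ k + half → (k + half ∸ i) + suc i ≡ g
        cong′ le = trans (+-suc _ i) (cong suc (m∸n+n≡m le))
      add : ∀ {a b} → a ≤ k + half → suc b ≤ k + half → a + b + 3 ≤ 2 * g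
      add {a} {b} p q = ≤-trans (≤-reflexive (eq a b)) (≤-trans (+-monoˡ-≤ 2 (+-mono-≤ p q)) (≤-reflexive (eq′ (k + half))))
        where
        eq : ∀ a b → a + b + 3 ≡ a + suc b + 2
        eq = solve-∀
        eq′ : ∀ z → z + z + 2 ≡ 2 * suc z
        eq′ = solve-∀
      sum : e i + e (2 + i) + 3 ≤ 2 * g
      sum with suc i ≤? half
      ... | yes le = subst (λ z → z + 3 ≤ 2 * g) (+-comm (e (2 + i)) (e i))
            (add (≤-trans r top≤) (≤-trans (s≤s (from-left i)) (≤-trans (≤-reflexive (sym (+-suc (e 0) i))) (+-mono-≤ e0≤k le))))
      ... | no nle with m≤n⇒m<n∨m≡n i≤
      -- The peak is `at g`, which is `at 0` again: the right neighbour is within `k`, and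
      -- `suc k ≤ k + half` because `1 ≤ k ≤ half`.
      ...   | inj₂ refl = add (≤-trans l top≤) (≤-trans (s≤s (≤-trans r (≤-trans (≤-reflexive (e-period 0)) e0≤k)))
              (≤-trans (≤-reflexive (+-comm 1 k)) (+-monoʳ-≤ k (≤-trans 1≤k k≤))))
      ...   | inj₁ lt = add (≤-trans l top≤) (≤-trans (s≤s (from-right (2 + i) j eqj))
              (≤-trans (≤-reflexive (sym (+-suc (e 0) j))) (+-mono-≤ e0≤k (≤-trans j<k k≤))))
        where
        j = k + half ∸ suc i
        eqj : j + (2 + i) ≡ g
        eqj = trans (+-suc j (suc i)) (cong suc (m∸n+n≡m lt))
        j<k : suc j ≤ k
        j<k = +-cancelʳ-≤ (suc i) (suc j) k (≤-trans (≤-reflexive (cong suc (m∸n+n≡m lt)))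
          (≤-trans (≤-reflexive (sym (+-suc k half))) (+-monoʳ-≤ k (≰⇒> nle))))

    -- A peak beyond distance `k` is more than `k` steps from `at 0` both ways. The two step counts
    -- add up to `g ≤ 2 (k + 1)`, so both are `k + 1`, and its neighbours are `k` steps away.
    close-peak : e 0 ≡ 0 → ∃[ i ] ∃[ l ] ∃[ r ] let P = toPeak i l r in
      d s (Peak.y₁ P) ≤ k × d s (Peak.y₂ P) ≤ k
    close-peak e0≡0 with peak
    ... | i , i≤ , l , r with e (suc i) ≤? k
    ...   | yes le = i , l , r , ≤-trans l le , ≤-trans r le
    ...   | no nle = i , l , r , ≤-trans left′ i≤k , right′
      where
      j = k + half ∸ i
      eqj : j + suc i ≡ g
      eqj = trans (+-suc j i) (cong suc (m∸n+n≡m i≤))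
      left′ : e i ≤ i
      left′ = subst (λ z → e i ≤ z + i) e0≡0 (from-left i)
      k<i : k < suc i
      k<i = <-≤-trans (≰⇒> nle) (subst (λ z → e (suc i) ≤ z + suc i) e0≡0 (from-left (suc i)))
      k<j : k < j
      k<j = <-≤-trans (≰⇒> nle) (subst (λ z → e (suc i) ≤ z + j) e0≡0 (from-right (suc i) j eqj))
      g≤ : g ≤ suc k + suc k
      g≤ = s≤s (≤-trans (+-monoʳ-≤ k half≤) ≤-refl)
      i≤k : i ≤ k
      i≤k = s≤s⁻¹ (+-cancelˡ-≤ j _ _ (≤-trans (≤-reflexive eqj) (≤-trans g≤ (+-monoˡ-≤ (suc k) k<j))))
      j≤ : j ≤ suc k
      j≤ = +-cancelʳ-≤ (suc i) _ _ (≤-trans (≤-reflexive eqj) (≤-trans g≤ (+-monoʳ-≤ (suc k) k<i)))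
      right′ : e (2 + i) ≤ k
      right′ with j in eq
      ... | zero  = contradiction (subst (k <_) eq k<j) λ ()
      ... | suc j′ = ≤-trans (subst (λ z → e (2 + i) ≤ z + j′) e0≡0 (from-right (2 + i) j′
              (trans (+-suc j′ (suc i)) (trans (cong (_+ suc i) (sym eq)) eqj)))) (s≤s⁻¹ (subst (_≤ suc k) eq j≤))

-- Correctness

module _ (N : ℕ) where
  private
    n = suc N

  key-mod : ∀ D {s} → s < n → (D * n + s) % n ≡ s
  key-mod D {s} s<n = trans (cong (_% n) (+-comm (D * n) s)) (trans ([m+kn]%n≡m%n s D n) (m<n⇒m%n≡m s<n))

  key-div : ∀ D {s} → s < n → (D * n + s) div n ≡ D
  key-div D {s} s<n = *-cancelʳ-≡ _ D n (+-cancelʳ-≡ s _ (D * n) (begin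
    (κ div n) * n + s        ≡⟨ +-comm _ s ⟩
    s + (κ div n) * n        ≡⟨ cong (_+ (κ div n) * n) (key-mod D s<n) ⟨
    κ % n + (κ div n) * n    ≡⟨ m≡m%n+[m/n]*n κ n ⟨
    κ                        ∎))
    where
    open ≡-Reasoning
    κ = D * n + s

everyone : ∀ {n} → Fin n → Bool
everyone _ = true

lift-walk : ∀ {n} (G : Graph n) {u v ℓ} → Walk G u v ℓ → Walk (restrict G everyone) u v ℓ
lift-walk G []      = []
lift-walk G (a ∷ p) = restrict⁺ G everyone tt tt a ∷ lift-walk G p

-- The first two source detections.

module Correctness (c N : ℕ) (G : Graph (suc N)) (dist : ∀ u v → ∃[ d ] IsDistance G u v d)
  (h : ℕ) (depth-≤h : ∀ v → Metric.d G dist Fin.zero v ≤ h)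
  (is : Vec ℕ (Parameters.m c N h)) (t : ℕ) (R<t : Parameters.R c N h < t) where

  open Parameters c N h
  open Execution c N G using (nbrs)
  open Metric G dist

  diam : ∀ u v → d u v ≤ h + h
  diam u v = ≤-trans (d-triangle u Fin.zero v)
    (+-mono-≤ (≤-trans (≤-reflexive (d-sym u Fin.zero)) (depth-≤h u)) (depth-≤h v))

  S* : List ℕ
  S* = map (_% n) (Vec.toList is)

  length-S* : length S* ≡ m
  length-S* = trans (length-map (_% n) (Vec.toList is)) (Vec.length-toList is)

  ini-S : Fin n → List ℕ
  ini-S Fin.zero    = S*
  ini-S (Fin.suc _) = []

  module F₁ = Flood N G everyone ini-S

  S : Fin n → List ℕ
  S v = sampled (ini-S v) (F₁.log t v)

  m-rounds : ∀ {x} → x ≤ h + h → x + m < t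
  m-rounds {x} le = ≤-<-trans (≤-trans (+-monoˡ-≤ m le) (by-≡ (K + 6 * h + 8) (eq h m K))) R<t
    where
    eq : ∀ h m K → h + h + m + (K + 6 * h + 8) ≡ K + m + 8 * suc h
    eq = solve-∀

  S⇒S* : ∀ v {s} → s ∈ S v → s ∈ S*
  S⇒S* v s∈ with ∈-map⁻ (_% n) s∈
  ... | κ , κ∈ , refl with Reach⇒walk N G everyone ini-S (F₁.known⇒Reach _ t κ∈)
  ...   | Fin.zero , κ₀ , ℓ , _ , κ₀∈ , _ , refl = subst (_∈ S*) (sym (trans ([m+kn]%n≡m%n κ₀ ℓ n) (reduced κ₀∈))) κ₀∈
    where
    reduced : ∀ {κ} → κ ∈ S* → κ % n ≡ κ
    reduced i with ∈-map⁻ (_% n) i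
    ... | j , _ , refl = m%n%n≡m%n j n

  -- All keys start at node 0 with classes in `S*`, so `S*` itself lists the competitors and
  -- `d 0 v + m` rounds suffice.
  S*⇒S : ∀ v {s} → s ∈ S* → s ∈ S v
  S*⇒S v {s} s∈ with find (F₁.Progress.announce (λ _ → tt) S* t reach cover time)
    where
    s<n : s < n
    s<n with ∈-map⁻ (_% n) s∈
    ... | j , _ , refl = m%n<n j n
    κ = s + d Fin.zero v * n
    κ≡ : κ ≡ d Fin.zero v * n + s
    κ≡ = +-comm s _
    reach : F₁.Reach v κ
    reach = walk⇒Reach N G everyone ini-S {u = Fin.zero} (F₁.origin tt s∈) (lift-walk G (d-walk Fin.zero v))
    cover : F₁.Covers (λ _ → tt) v κ S*
    cover {κ′} _ r _ with Reach⇒walk N G everyone ini-S r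
    ... | Fin.zero , κ₀ , ℓ , _ , κ₀∈ , _ , refl with ∈-map⁻ (_% n) κ₀∈
    ...   | j , _ , refl = subst (_∈ S*) (sym (trans ([m+kn]%n≡m%n (j % n) ℓ n) (m%n%n≡m%n j n))) κ₀∈
    time : κ div n + length S* < t
    time = subst (λ z → z + length S* < t) (sym (trans (cong (_div n) κ≡) (key-div N (d Fin.zero v) s<n)))
      (subst (λ z → d Fin.zero v + z < t) (sym length-S*) (m-rounds (diam Fin.zero v)))
  ... | κ , κ∈ , _ , cl = subst (_∈ S v) (trans cl class)
    (∈-map⁺ (_% n) (F₁.sent⇒known t κ∈))
    where
    class : (s + d Fin.zero v * n) % n ≡ s
    class with ∈-map⁻ (_% n) s∈
    ... | j , _ , refl = trans ([m+kn]%n≡m%n (j % n) (d Fin.zero v) n) (m%n%n≡m%n j n)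

  off : Fin n → ℕ
  off u = offset S* (toℕ u)

  offset-∈ : ∀ {s X} → s ∈ X → offset X s ≡ 0
  offset-∈ {s} {X} i with s ∈? X
  ... | yes _ = refl
  ... | no ¬i = contradiction i ¬i

  offset-∉ : ∀ {s X} → s ∉ X → offset X s ≡ suc (h + h)
  offset-∉ {s} {X} ¬i with s ∈? X
  ... | yes i = contradiction i ¬i
  ... | no _  = refl

  offset-S : ∀ v s → offset (S v) s ≡ offset S* s
  offset-S v s = aux (s ∈? S*)
    where
    aux : Dec (s ∈ S*) → offset (S v) s ≡ offset S* s
    aux (yes i) = trans (offset-∈ (S*⇒S v i)) (sym (offset-∈ i))
    aux (no ¬i) = trans (offset-∉ (¬i ∘ S⇒S* v)) (sym (offset-∉ ¬i))

  off-∈ : ∀ {u} → toℕ u ∈ S* → off u ≡ 0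
  off-∈ = offset-∈

  off-cases : ∀ u → toℕ u ∈ S* × off u ≡ 0 ⊎ off u ≡ suc (h + h)
  off-cases u = aux (toℕ u ∈? S*)
    where
    aux : Dec (toℕ u ∈ S*) → toℕ u ∈ S* × off u ≡ 0 ⊎ off u ≡ suc (h + h)
    aux (yes i) = inj₁ (i , offset-∈ i)
    aux (no ¬i) = inj₂ (offset-∉ ¬i)

  off-≤ : ∀ u → off u ≤ suc (h + h)
  off-≤ u with off-cases u
  ... | inj₁ (_ , eq) = ≤-trans (≤-reflexive eq) z≤n
  ... | inj₂ eq       = ≤-reflexive eq

  ini-V : Fin n → List ℕ
  ini-V v = ini₂ (S v) (toℕ v)

  module F₂ = Flood N G everyone ini-V

  ini-V⁻ : ∀ {u κ} → κ ∈ ini-V u → κ ≡ off u * n + toℕ u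
  ini-V⁻ {u} (here eq) = trans eq (cong (λ z → z * n + toℕ u) (offset-S u (toℕ u)))

  opaque
    -- The key delivered by a walk of length `ℓ` from `u`. It is opaque, so that keys are handled
    -- only through the four laws that follow and never unfold to arithmetic.
    key : Fin n → ℕ → ℕ
    key u ℓ = (off u + ℓ) * n + toℕ u

    key-+ : ∀ u ℓ → off u * n + toℕ u + ℓ * n ≡ key u ℓ
    key-+ u ℓ = eq (off u) n (toℕ u) ℓ
      where
      eq : ∀ o n u ℓ → o * n + u + ℓ * n ≡ (o + ℓ) * n + u
      eq = solve-∀

    key-class : ∀ u ℓ → key u ℓ % n ≡ toℕ u
    key-class u ℓ = key-mod N (off u + ℓ) (toℕ<n u)

    key-value : ∀ u ℓ → key u ℓ div n ≡ off u + ℓ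
    key-value u ℓ = key-div N (off u + ℓ) (toℕ<n u)

    key-mono : ∀ u {ℓ ℓ′} → ℓ ≤ ℓ′ → key u ℓ ≤ key u ℓ′
    key-mono u le = +-monoˡ-≤ (toℕ u) (*-monoˡ-≤ n (+-monoʳ-≤ (off u) le))

  Reach₂⇒ : ∀ {x κ} → F₂.Reach x κ → ∃[ u ] ∃[ ℓ ] Walk G u x ℓ × κ ≡ key u ℓ
  Reach₂⇒ r with Reach⇒walk N G everyone ini-V r
  ... | u , κ₀ , ℓ , _ , i , p , eq = u , ℓ , unrestrict G everyone p ,
    trans eq (trans (cong (_+ ℓ * n) (ini-V⁻ i)) (key-+ u ℓ))

  ⇒Reach₂ : ∀ {u x ℓ} → Walk G u x ℓ → F₂.Reach x (key u ℓ)
  ⇒Reach₂ {u} {ℓ = ℓ} p = subst (F₂.Reach _) (trans (cong (_+ ℓ * n)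
      (cong (λ z → z * n + toℕ u) (offset-S u (toℕ u)))) (key-+ u ℓ))
    (walk⇒Reach N G everyone ini-V (F₂.origin tt (here refl)) (lift-walk G p))

  ball : Fin n → ℕ → List (Fin n)
  ball y k = filter (λ u → d u y ≤? k) (allFin n)

  -- The two grounds on which `y` learns its exact distance to `s` in time: `s` is sampled, or few
  -- vertices are as near to `y` as `s`.
  Informed : Fin n → Fin n → Set
  Informed s y = toℕ s ∈ S* ⊎ length (ball y (d s y)) ≤ K

  key-order : ∀ {u s ℓ ℓ′} → key u ℓ ≤ key s ℓ′ → off u + ℓ ≤ off s + ℓ′
  key-order {u} {s} {ℓ} {ℓ′} le = subst₂ _≤_ (key-value u ℓ) (key-value s ℓ′) (/-monoˡ-≤ n le)

  -- What precedes the key of `s` at `y` is either sampled or, if `s` itself is handicapped, an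
  -- unsampled vertex no farther from `y`. The announced key is the exact one, because every key in
  -- the class of `s` comes from a walk and none is shorter than `d s y`.
  informed⇒sent : ∀ s y → Informed s y → key s (d s y) ∈ F₂.sent t y
  informed⇒sent s y inf = aux inf
    where
    κ = key s (d s y)
    exact : ∀ {κ′} → κ′ ∈ F₂.sent t y → κ′ ≤ κ → κ′ % n ≡ κ % n →
      (∃[ u ] ∃[ ℓ ] Walk G u y ℓ × κ′ ≡ key u ℓ) → κ ∈ F₂.sent t y
    exact κ′∈ κ′≤ cl (u , ℓ , p , eq)
      with toℕ-injective (trans (sym (key-class u ℓ)) (trans (cong (_% n) (sym eq)) (trans cl (key-class s (d s y)))))
    ... | refl = subst (_∈ F₂.sent t y) (≤-antisym κ′≤ (subst (κ ≤_) (sym eq) (key-mono s (d-min p)))) κ′∈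
    extract : ∀ {κ′} → κ′ ∈ F₂.sent t y × κ′ ≤ κ × κ′ % n ≡ κ % n → κ ∈ F₂.sent t y
    extract (κ′∈ , κ′≤ , cl) =
      exact κ′∈ κ′≤ cl (Reach₂⇒ (F₂.known⇒Reach (λ _ → tt) t (F₂.sent⇒known t κ′∈)))
    conclude : ∀ us → F₂.Covers (λ _ → tt) y κ us → κ div n + length us < t → κ ∈ F₂.sent t y
    conclude us cover time =
      extract (proj₂ (find (F₂.Progress.announce (λ _ → tt) us t (⇒Reach₂ (d-walk s y)) cover time)))
    D≤ : ∀ b → off s ≤ b → κ div n ≤ b + (h + h)
    D≤ b le = ≤-trans (≤-reflexive (key-value s (d s y))) (+-mono-≤ le (diam s y))
    aux : Informed s y → κ ∈ F₂.sent t y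
    aux (inj₁ s∈) = conclude S* cover time
      where
      cover : F₂.Covers (λ _ → tt) y κ S*
      cover lt r _ with Reach₂⇒ r
      ... | u , ℓ , p , refl with off-cases u
      ...   | inj₁ (u∈ , _) = subst (_∈ S*) (sym (key-class u ℓ)) u∈
      ...   | inj₂ eq = contradiction (key-order (<⇒≤ lt)) (<⇒≱ (≤-trans
                (s≤s (≤-trans (≤-reflexive (cong (_+ d s y) (off-∈ s∈))) (diam s y)))
                (≤-trans (≤-reflexive (sym eq)) (m≤m+n (off u) ℓ))))
      time : κ div n + length S* < t
      time = subst (λ z → κ div n + z < t) (sym length-S*)
        (m-rounds (D≤ 0 (≤-reflexive (off-∈ s∈))))
    aux (inj₂ small) = conclude (S* ++ map toℕ (ball y (d s y))) cover time
      where
      cover : F₂.Covers (λ _ → tt) y κ (S* ++ map toℕ (ball y (d s y)))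
      cover lt r _ with Reach₂⇒ r
      ... | u , ℓ , p , refl with off-cases u
      ...   | inj₁ (u∈ , _) = subst (_∈ S* ++ map toℕ (ball y (d s y))) (sym (key-class u ℓ)) (∈-++⁺ˡ u∈)
      ...   | inj₂ eq = subst (_∈ S* ++ map toℕ (ball y (d s y))) (sym (key-class u ℓ)) (∈-++⁺ʳ S* (∈-map⁺ toℕ
                (∈-filter⁺ (λ u → d u y ≤? d s y) (∈-allFin u) (≤-trans (d-min p) ℓ≤))))
        where
        ℓ≤ : ℓ ≤ d s y
        ℓ≤ = +-cancelˡ-≤ (suc (h + h)) _ _ (≤-trans (≤-reflexive (cong (_+ ℓ) (sym eq)))
               (≤-trans (key-order (<⇒≤ lt)) (+-monoˡ-≤ (d s y) (off-≤ s))))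
      time : κ div n + length (S* ++ map toℕ (ball y (d s y))) < t
      time = ≤-<-trans (≤-trans (+-mono-≤ (D≤ (suc (h + h)) (off-≤ s)) (≤-trans (≤-reflexive (trans (length-++ S*)
          (cong₂ _+_ length-S* (length-map toℕ (ball y (d s y)))))) (+-monoʳ-≤ m small)))
        (by-≡ (4 * h + 7) (eq h m K))) R<t
        where
        eq : ∀ h m K → suc (h + h) + (h + h) + (m + K) + (4 * h + 7) ≡ K + m + 8 * suc h
        eq = solve-∀

  loop-at : Fin n → ℕ
  loop-at x = shortest-loop (S x) (F₂.known t x) (F₂.log t x)

  -- Every key of `s` known at `x` stands for a walk of length at least `d s x`, so the neighbours'
  -- exact keys pass `Valid`. The handicap cancels, as `S x` and `S*` have the same members.
  loop-≤ : ∀ {s x y₁ y₂} → Adj G x y₁ → Adj G x y₂ → y₁ ≢ y₂ → d s y₁ ≤ d s x → d s y₂ ≤ d s x →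
    Informed s y₁ → Informed s y₂ → loop-at x ≤ d s y₁ + d s y₂ + 2
  loop-≤ {s} {x} {y₁} {y₂} a₁ a₂ ne le₁ le₂ i₁ i₂ =
    subst (loop-at x ≤_) value-≡ (loop-least (S x) ks (F₂.log t x) (heard-at a₁ i₁) (heard-at a₂ i₂) valid)
    where
    ks = F₂.known t x
    heard-at : ∀ {y} → Adj G x y → Informed s y → (toℕ y , key s (d s y)) ∈ F₂.log t x
    heard-at a i = F₂.sent⇒log t tt a (informed⇒sent s _ i)
    minimal : ∀ {y κ} → d s y ≤ d s x → κ ∈ ks → κ % n ≡ key s (d s y₁) % n → key s (d s y) ≤ κ
    minimal le κ∈ cl with Reach₂⇒ (F₂.known⇒Reach (λ _ → tt) t κ∈)
    ... | u , ℓ , p , refl with toℕ-injective (trans (sym (key-class u ℓ)) (trans cl (key-class s (d s y₁))))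
    ...   | refl = key-mono s (≤-trans le (d-min p))
    valid : Valid ks ((toℕ y₁ , key s (d s y₁)) , (toℕ y₂ , key s (d s y₂)))
    valid = (λ eq → ne (toℕ-injective eq)) , trans (key-class s (d s y₁)) (sym (key-class s (d s y₂))) ,
      All.tabulate (λ κ∈ cl → minimal le₁ κ∈ cl , minimal le₂ κ∈ cl)
    o≡ : offset (S x) (key s (d s y₁) % n) ≡ off s
    o≡ = trans (cong (offset (S x)) (key-class s (d s y₁))) (offset-S x (toℕ s))
    dist-≡ : ∀ ℓ → key s ℓ div n ∸ offset (S x) (key s (d s y₁) % n) ≡ ℓ
    dist-≡ ℓ = trans (cong₂ _∸_ (key-value s ℓ) o≡) (m+n∸m≡n (off s) ℓ)
    value-≡ : loop (S x) ((toℕ y₁ , key s (d s y₁)) , (toℕ y₂ , key s (d s y₂))) ≡ d s y₁ + d s y₂ + 2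
    value-≡ = cong₂ (λ p q → p + q + 2) (dist-≡ (d s y₁)) (dist-≡ (d s y₂))

  -- If a key had reached a neighbour through `x`, then `x` would know a smaller key of its class,
  -- which `Valid` excludes. So both keys belong to walks in `G - x`, and these meet at the common
  -- source.
  loop-sound : ∀ x → loop-at x < none → ∃[ y₁ ] ∃[ y₂ ] ∃[ ℓ ]
    Adj G x y₁ × Adj G x y₂ × y₁ ≢ y₂ × Walk (restrict G (others x)) y₁ y₂ ℓ × loop-at x ≡ ℓ + 2
  loop-sound x lt = from-entries (loop-attained (S x) (F₂.known t x) (F₂.log t x) lt)
    where
    Result : Set
    Result = ∃[ y₁ ] ∃[ y₂ ] ∃[ ℓ ]
      Adj G x y₁ × Adj G x y₂ × y₁ ≢ y₂ × Walk (restrict G (others x)) y₁ y₂ ℓ × loop-at x ≡ ℓ + 2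
    Origin : Fin n → ℕ → Set
    Origin y κ = ∃[ u ] ∃[ ℓ ] Walk (restrict G (others x)) u y ℓ × κ ≡ key u ℓ
    from-Reach : ∀ {y κ} → Flood.Reach N G (others x) ini-V y κ → Origin y κ
    from-Reach r = let (u , κ₀ , ℓ , _ , i , p , eq) = Reach⇒walk N G (others x) ini-V r in
      u , ℓ , p , trans eq (trans (cong (_+ ℓ * n) (ini-V⁻ i)) (key-+ u ℓ))
    avoiding : ∀ {y κ} → Adj G x y → κ ∈ F₂.sent t y →
      (∀ {κ′} → κ′ ∈ F₂.known t x → κ′ % n ≡ κ % n → κ ≤ κ′) → Origin y κ
    avoiding {y} {κ} a s min =
      cases (known⇒Reach-avoiding N G everyone ini-V x t (λ { refl → Adj-irrefl G a }) (F₂.sent⇒known t s))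
      where
      cases : Flood.Reach N G (others x) ini-V y κ ⊎ ∃[ κ′ ] κ′ ∈ F₂.known t x × κ′ < κ × κ′ % n ≡ κ % n → Origin y κ
      cases (inj₁ r)                  = from-Reach r
      cases (inj₂ (κ′ , κ′∈ , lt , eq)) = contradiction (min κ′∈ eq) (<⇒≱ lt)
    combine : ∀ {y₁ y₂ κ₁ κ₂} → Adj G x y₁ → Adj G x y₂ → y₁ ≢ y₂ → κ₁ % n ≡ κ₂ % n →
      loop-at x ≡ loop (S x) ((toℕ y₁ , κ₁) , (toℕ y₂ , κ₂)) → Origin y₁ κ₁ → Origin y₂ κ₂ → Result
    combine {y₁} {y₂} a₁ a₂ ne cl loop≡ (u , ℓ₁ , p₁ , refl) (u′ , ℓ₂ , p₂ , refl) =
      y₁ , y₂ , ℓ₁ + ℓ₂ , a₁ , a₂ , ne , _▷_ (restrict G (others x)) (walk-reverse (restrict G (others x)) p₁)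
        (subst (λ z → Walk (restrict G (others x)) z y₂ ℓ₂) (sym u≡u′) p₂) ,
      trans loop≡ (cong₂ (λ p q → p + q + 2) (dist-≡ ℓ₁) (trans (cong (λ z → key z ℓ₂ div n ∸ offset (S x) (key u ℓ₁ % n)) (sym u≡u′)) (dist-≡ ℓ₂)))
      where
      u≡u′ : u ≡ u′
      u≡u′ = toℕ-injective (trans (sym (key-class u ℓ₁)) (trans cl (key-class u′ ℓ₂)))
      dist-≡ : ∀ ℓ → key u ℓ div n ∸ offset (S x) (key u ℓ₁ % n) ≡ ℓ
      dist-≡ ℓ = trans (cong₂ _∸_ (key-value u ℓ)
        (trans (cong (offset (S x)) (key-class u ℓ₁)) (offset-S x (toℕ u)))) (m+n∸m≡n (off u) ℓ)
    from-senders : ∀ {y₁ κ₁ y₂ κ₂} → Valid (F₂.known t x) ((y₁ , κ₁) , (y₂ , κ₂)) →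
      loop-at x ≡ loop (S x) ((y₁ , κ₁) , (y₂ , κ₂)) →
      (∃[ v ] y₁ ≡ toℕ v × T (everyone x) × Adj G x v × κ₁ ∈ F₂.sent t v) →
      (∃[ v ] y₂ ≡ toℕ v × T (everyone x) × Adj G x v × κ₂ ∈ F₂.sent t v) → Result
    from-senders (ne , cl , minimal) loop≡ (v₁ , refl , _ , a₁ , s₁) (v₂ , refl , _ , a₂ , s₂) =
      combine a₁ a₂ (λ eq → ne (cong toℕ eq)) cl loop≡
        (avoiding a₁ s₁ λ κ′∈ eq → proj₁ (All.lookup minimal κ′∈ eq))
        (avoiding a₂ s₂ λ κ′∈ eq → proj₂ (All.lookup minimal κ′∈ (trans eq (sym cl))))
    from-entries : (∃[ e₁ ] ∃[ e₂ ] e₁ ∈ F₂.log t x × e₂ ∈ F₂.log t x ×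
      Valid (F₂.known t x) (e₁ , e₂) × loop-at x ≡ loop (S x) (e₁ , e₂)) → Result
    from-entries (_ , _ , i₁ , i₂ , valid , loop≡) =
      from-senders valid loop≡ (F₂.log⇒sent t i₁) (F₂.log⇒sent t i₂)

-- A shortest cycle through a fixed vertex.

module Through (c N h : ℕ) (G : Graph (suc N)) (X : Fin (suc N))
  (t : ℕ) (R<t : Parameters.R c N h < t) where
  open Parameters c N h
  open Execution c N G using (nbrs)

  ini-X : Fin n → List ℕ
  ini-X v = ini₃ (toℕ X) (toℕ v) (nbrs v)

  module F₃ = Flood N G (others X) ini-X

  ∈-nbrs⁻ : ∀ {v} → toℕ X ∈ nbrs v → Adj G v X
  ∈-nbrs⁻ i with ∈-map⁻ toℕ i
  ... | u , u∈ , eq with toℕ-injective eq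
  ...   | refl = ∈-neighbours⁻ G u∈

  ∈-nbrs⁺ : ∀ {v} → Adj G v X → toℕ X ∈ nbrs v
  ∈-nbrs⁺ a = ∈-map⁺ toℕ (∈-neighbours⁺ G a)

  if-yes : ∀ {A : Set} {x : ℕ} {xs} {a b : A} → x ∈ xs → (if does (x ∈? xs) then a else b) ≡ a
  if-yes {x = x} {xs} i with x ∈? xs
  ... | yes _ = refl
  ... | no ¬i = contradiction i ¬i

  if-no : ∀ {A : Set} {x : ℕ} {xs} {a b : A} → x ∉ xs → (if does (x ∈? xs) then a else b) ≡ b
  if-no {x = x} {xs} ¬i with x ∈? xs
  ... | yes i = contradiction i ¬i
  ... | no _  = refl

  ini-X⁻ : ∀ {v κ} → κ ∈ ini-X v → Adj G v X × κ ≡ toℕ v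
  ini-X⁻ {v} {κ} i = aux (toℕ X ∈? nbrs v)
    where
    aux : Dec (toℕ X ∈ nbrs v) → Adj G v X × κ ≡ toℕ v
    aux (yes j) with subst (κ ∈_) (if-yes j) i
    ... | here eq = ∈-nbrs⁻ j , eq
    aux (no ¬j) with subst (κ ∈_) (if-no ¬j) i
    ... | ()

  ini-X⁺ : ∀ {v} → Adj G v X → toℕ v ∈ ini-X v
  ini-X⁺ {v} a = subst (toℕ v ∈_) (sym (if-yes (∈-nbrs⁺ a))) (here refl)

  ini-X-live : ∀ {v κ} → κ ∈ ini-X v → T (others X v)
  ini-X-live {v} i = T-others {x = X} {v} λ { refl → Adj-irrefl G (proj₁ (ini-X⁻ i)) }

  known : Fin n → List ℕ
  known = F₃.known t

  through-at : Fin n → ℕ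
  through-at v = through (toℕ X) (toℕ v) (nbrs v) (known v)

  private
    foreign : Fin n → List ℕ
    foreign b = map (λ κ → κ div n + 2) (filter (λ κ → ¬? (κ % n ℕ.≟ toℕ b)) (known b))

  through⁺ : ∀ {b κ} → Adj G b X → κ ∈ known b → κ % n ≢ toℕ b → through-at b ≤ κ div n + 2
  through⁺ {b} {κ} a κ∈ ne = ≤-trans (≤-reflexive (if-yes (∈-nbrs⁺ a)))
    (foldr-⊓-≤ none (foreign b) (∈-map⁺ _ (∈-filter⁺ (λ κ → ¬? (κ % n ℕ.≟ toℕ b)) κ∈ ne)))

  through⁻ : ∀ {b} → through-at b ≢ none →
    Adj G b X × ∃[ κ ] κ ∈ known b × κ % n ≢ toℕ b × through-at b ≡ κ div n + 2
  through⁻ {b} ne = aux (toℕ X ∈? nbrs b)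
    where
    aux : Dec (toℕ X ∈ nbrs b) → _
    aux (no ¬j) = contradiction (if-no ¬j) ne
    aux (yes j) with foldr-⊓-sel none (foreign b)
    ... | inj₁ eq = contradiction (trans (if-yes j) eq) ne
    ... | inj₂ i with ∈-map⁻ _ i
    ...   | κ , κ∈ , eq with ∈-filter⁻ (λ κ → ¬? (κ % n ℕ.≟ toℕ b)) {xs = known b} κ∈
    ...     | κ∈′ , cl = ∈-nbrs⁻ j , κ , κ∈′ , cl , trans (if-yes j) eq

  through-≤-none : ∀ b → through-at b ≤ none
  through-≤-none b = aux (toℕ X ∈? nbrs b)
    where
    aux : Dec (toℕ X ∈ nbrs b) → through-at b ≤ none
    aux (yes j) = ≤-trans (≤-reflexive (if-yes j)) (foldr-⊓-≤ᵈ none (foreign b))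
    aux (no ¬j) = ≤-reflexive (if-no ¬j)

  Reach₃⇒ : ∀ {x κ} → F₃.Reach x κ →
    ∃[ u ] ∃[ ℓ ] Adj G u X × Walk (restrict G (others X)) u x ℓ × κ ≡ ℓ * n + toℕ u
  Reach₃⇒ r with Reach⇒walk N G (others X) ini-X r
  ... | u , κ₀ , ℓ , _ , i , p , eq with ini-X⁻ i
  ...   | a , refl = u , ℓ , a , p , trans eq (+-comm (toℕ u) (ℓ * n))

  ⇒Reach₃ : ∀ {u x ℓ} → Adj G u X → Walk (restrict G (others X)) u x ℓ → F₃.Reach x (ℓ * n + toℕ u)
  ⇒Reach₃ {u} {ℓ = ℓ} a p = subst (F₃.Reach _) (+-comm (toℕ u) (ℓ * n))
    (walk⇒Reach N G (others X) ini-X (F₃.origin (ini-X-live (ini-X⁺ a)) (ini-X⁺ a)) p)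

  4h-rounds : ∀ {ℓ} → ℓ ≤ 4 * h → ℓ + 1 < t
  4h-rounds le = ≤-<-trans (≤-trans (+-monoˡ-≤ 1 le) (by-≡ (K + m + 4 * h + 7) (eq h m K))) R<t
    where
    eq : ∀ h m K → 4 * h + 1 + (K + m + 4 * h + 7) ≡ K + m + 8 * suc h
    eq = solve-∀

  -- Among the sources other than b itself, only the one with the least key
  -- at b is needed, and nothing but b's own key can delay it.
  through-≤ : ∀ {u b ℓ} → Adj G u X → Adj G b X → u ≢ b → Walk (restrict G (others X)) u b ℓ →
    ℓ ≤ 4 * h → through-at b ≤ ℓ + 2
  through-≤ {u} {b} {ℓ} au ab u≢b p ℓ≤ with find (go (<-wellFounded _) (⇒Reach₃ au p)
      (λ eq → u≢b (toℕ-injective (trans (sym (key-mod N ℓ (toℕ<n u))) eq)))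
      (≤-reflexive (key-div N ℓ (toℕ<n u))))
    where
    Goal : Set
    Goal = Any (λ κ → κ % n ≢ toℕ b × κ div n ≤ ℓ) (known b)
    goal? : Dec Goal
    goal? = any? (λ κ → ¬? (κ % n ℕ.≟ toℕ b) ×-dec (κ div n ≤? ℓ)) (known b)
    go : ∀ {κ} → Acc _<_ κ → F₃.Reach b κ → κ % n ≢ toℕ b → κ div n ≤ ℓ → Goal
    go {κ} (acc rs) r ne le with goal?
    ... | yes g = g
    ... | no ¬g with find (F₃.Progress.announce ini-X-live (toℕ b ∷ []) t r cover
                      (≤-<-trans (+-monoˡ-≤ 1 le) (4h-rounds ℓ≤)))
      where
      cover : F₃.Covers ini-X-live b κ (toℕ b ∷ [])
      cover {κ′} lt r′ _ with κ′ % n ℕ.≟ toℕ b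
      ... | yes eq = here eq
      ... | no ne′ = contradiction (go (rs lt) r′ ne′ (≤-trans (/-monoˡ-≤ n (<⇒≤ lt)) le)) ¬g
    ...   | κ′ , κ′∈ , κ′≤ , cl = contradiction
      (Any.map (λ { refl → (λ eq → ne (trans (sym cl) eq)) , ≤-trans (/-monoˡ-≤ n κ′≤) le })
        (F₃.sent⇒known t κ′∈)) ¬g
  ... | κ , κ∈ , ne , le = ≤-trans (through⁺ ab κ∈ ne) (+-monoˡ-≤ 2 le)

  -- Minimality of `o` makes the walk from `u` to `b` shortest in `G - X`, hence simple, and `X`
  -- closes it. Walks longer than `4 h`, beyond the reach of `through-≤`, do not compete, since
  -- `o < none` bounds `ℓ` by `4 h`.
  minimum-is-Cycle : ∀ {o} b → o ≡ through-at b → (∀ v → o ≤ through-at v) → o < none → Cycle G o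
  minimum-is-Cycle {o} b eq least lt with through⁻ {b} (λ e → <⇒≢ lt (trans eq e))
  ... | ab , κ , κ∈ , ne , eq′ with Reach₃⇒ (F₃.known⇒Reach ini-X-live t κ∈)
  ...   | u , ℓ , au , p , refl = subst (Cycle G) (sym o≡) (cycle p shortest)
    where
    o≡ : o ≡ suc (suc ℓ)
    o≡ = trans eq (trans eq′ (trans (cong (_+ 2) (key-div N ℓ (toℕ<n u))) (+-comm ℓ 2)))
    u≢b : u ≢ b
    u≢b refl = ne (key-mod N ℓ (toℕ<n u))
    ℓ≤4h : ℓ ≤ 4 * h
    ℓ≤4h = s≤s⁻¹ (+-cancelˡ-≤ 2 _ _ (≤-trans (s≤s (≤-reflexive (sym o≡))) (≤-trans lt (≤-reflexive (+-comm (4 * h) 3)))))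
    shortest : ∀ ℓ′ → Walk (restrict G (others X)) u b ℓ′ → ℓ ≤ ℓ′
    shortest ℓ′ q with ℓ′ ≤? 4 * h
    ... | no nle = ≤-trans ℓ≤4h (<⇒≤ (≰⇒> nle))
    ... | yes le = +-cancelˡ-≤ 2 _ _ (≤-trans (≤-reflexive (sym o≡))
          (≤-trans (least b) (≤-trans (through-≤ au ab u≢b q le) (≤-reflexive (+-comm ℓ′ 2)))))
    cycle : ∀ {ℓ} (p : Walk (restrict G (others X)) u b ℓ) →
      (∀ ℓ′ → Walk (restrict G (others X)) u b ℓ′ → ℓ ≤ ℓ′) → Cycle G (suc (suc ℓ))
    cycle []        _        = contradiction refl u≢b
    cycle p@(_ ∷ _) shortest = close (Adj-sym G au ∷ unrestrict G (others X) p)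
      (subst (λ vs → Unique (X ∷ vs)) (sym (vertices-unrestrict G (others X) p))
        (All.map (λ kept eq → others-T {x = X} kept (sym eq)) (vertices-kept G (others X) p (ini-X-live (ini-X⁺ au))) ∷
         shortest⇒Unique (restrict G (others X)) p shortest))
      (s≤s (s≤s z≤n)) ab

-- The common answer for given draws.

module Final (c N : ℕ) (G : Graph (suc N)) (dist : ∀ u v → ∃[ d ] IsDistance G u v d)
  (h : ℕ) (depth-≤h : ∀ v → Metric.d G dist Fin.zero v ≤ h)
  (is : Vec ℕ (Parameters.m c N h)) (t : ℕ) (t≡ : t ≡ suc (Parameters.R c N h)) where

  open Parameters c N h
  open Execution c N G
  open Metric G dist

  R<t : R < t
  R<t = ≤-reflexive (sym t≡)

  open Correctness c N G dist h depth-≤h is t R<t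

  p₀ p₁ p₂ p₃ p₄ p₅ : Fin n → Proc
  p₀ = started h is
  p₁ = prounds t p₀
  p₂ = prounds t p₁
  p₃ = prounds t p₂
  p₄ = prounds t p₃
  p₅ = prounds t p₄

  reachable : ∀ u v → ∃[ ℓ ] Walk G u v ℓ × ℓ ≤ t
  reachable u v = d u v , d-walk u v , ≤-trans (m≤m+n _ m) (<⇒≤ (m-rounds (diam u v)))

  at₀ : ∀ v → p₀ v ≡ flood N (everyone v) (ini-S v) R [] []
    (λ log → stage₂ (toℕ v) (nbrs v) (sampled (ini-S v) log))
  at₀ Fin.zero    = refl
  at₀ (Fin.suc v) = refl

  at₁ : ∀ v → p₁ v ≡ stage₂ (toℕ v) (nbrs v) (S v)
  at₁ = flooded at₀ t≡

  val₁ : Fin n → ℕ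
  val₁ v = loop-at v * n + toℕ v

  at₂ : ∀ v → p₂ v ≡ gossip R (val₁ v) (λ code → stage₄ (toℕ v) (nbrs v) (code % n))
  at₂ = flooded {live = everyone} {ini = ini-V} at₁ t≡

  module G₁ = Gossip G val₁

  X : Fin n
  X = proj₁ (G₁.best-attained t Fin.zero)

  best₁ : ∀ v → G₁.best t v ≡ val₁ X
  best₁ v = trans (G₁.best-agree t reachable v Fin.zero) (proj₂ (G₁.best-attained t Fin.zero))

  at₃ : ∀ v → p₃ v ≡ stage₄ (toℕ v) (nbrs v) (toℕ X)
  at₃ v = trans (gossiped at₂ t≡ v)
    (cong (stage₄ (toℕ v) (nbrs v)) (trans (cong (_% n) (best₁ v)) (key-mod N (loop-at X) (toℕ<n X))))

  open Through c N h G X t R<t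

  at₄ : ∀ v → p₄ v ≡ gossip R (through-at v) output
  at₄ = flooded {live = others X} {ini = ini-X} at₃ t≡

  module G₂ = Gossip G through-at

  at₅ : ∀ v → p₅ v ≡ output (G₂.best t v)
  at₅ = gossiped at₄ t≡

  answer : ℕ
  answer = G₂.best t Fin.zero

  rounds : ℕ
  rounds = t + (t + (t + (t + t)))

  all-halted : ∀ v → prounds rounds p₀ v ≡ output answer
  all-halted v = trans (cong (λ f → f v) chain)
    (trans (at₅ v) (cong output (G₂.best-agree t reachable v Fin.zero)))
    where
    chain : prounds rounds p₀ ≡ p₅
    chain = trans (prounds-+ t _ p₀) (cong (prounds t) (trans (prounds-+ t _ p₀) (cong (prounds t)
              (trans (prounds-+ t _ p₀) (cong (prounds t) (prounds-+ t t p₀))))))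

  X-least : ∀ v → loop-at X ≤ loop-at v
  X-least v = subst₂ _≤_ (key-div N (loop-at X) (toℕ<n X)) (key-div N (loop-at v) (toℕ<n v))
    (/-monoˡ-≤ n (≤-trans (≤-reflexive (sym (best₁ Fin.zero)))
      (let (_ , p , le) = reachable Fin.zero v in G₁.best-≤ t p le)))

  answer-least : ∀ v → answer ≤ through-at v
  answer-least v = let (_ , p , le) = reachable Fin.zero v in G₂.best-≤ t p le

  -- The loop at `X` is the least of all, so it is below `none` too. The walk that it certifies in
  -- `G - X` bounds `through-at` at one of its ends.
  answer-correct : ∀ x → loop-at x < none → answer ≤ loop-at x × Cycle G answer
  answer-correct x lt = from-loop (loop-sound X (≤-<-trans (X-least x) lt))
    where
    from-loop : (∃[ y₁ ] ∃[ y₂ ] ∃[ ℓ ]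
      Adj G X y₁ × Adj G X y₂ × y₁ ≢ y₂ × Walk (restrict G (others X)) y₁ y₂ ℓ × loop-at X ≡ ℓ + 2) →
      answer ≤ loop-at x × Cycle G answer
    from-loop (y₁ , y₂ , ℓ , a₁ , a₂ , ne , p , eq) =
      ≤-trans answer≤ (X-least x) ,
      minimum-is-Cycle (proj₁ (G₂.best-attained t Fin.zero)) (proj₂ (G₂.best-attained t Fin.zero)) answer-least
        (≤-<-trans answer≤ (≤-<-trans (X-least x) lt))
      where
      ℓ≤ : ℓ ≤ 4 * h
      ℓ≤ = s≤s⁻¹ (+-cancelˡ-≤ 2 _ _ (≤-trans (≤-reflexive (trans (cong suc (+-comm 2 ℓ)) (cong suc (sym eq))))
        (≤-trans (≤-<-trans (X-least x) lt) (≤-reflexive (+-comm (4 * h) 3)))))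
      answer≤ : answer ≤ loop-at X
      answer≤ = ≤-trans (answer-least y₂)
        (≤-trans (through-≤ (Adj-sym G a₁) (Adj-sym G a₂) ne p ℓ≤) (≤-reflexive (sym eq)))

  -- One bound for every stage. The second detection dominates: its keys start below `(2 h + 2) n`
  -- and grow by at most `n` per round.
  Q : ℕ
  Q = (R + 4 * h + 10) * n

  bounded : Bounded Q p₀
  bounded = Bounded-flood at₀ t≡ (λ {v} → ini-S≤ v) (le-Q 0 (by-≡ (4 * h + 9) (eq₁ R h)))
    (Bounded-flood {live = everyone} {ini = ini-V} at₁ t≡ (λ {v} → ini-V≤ v) (le-Q (suc (h + h)) (by-≡ (2 * h + 8) (eq₂ R h)))
    (Bounded-gossip at₂ t≡ val₁≤
    (Bounded-flood {live = others X} {ini = ini-X} at₃ t≡ (λ {v} → ini-X≤ v) (le-Q 0 (by-≡ (4 * h + 9) (eq₁ R h)))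
    (Bounded-gossip at₄ t≡ through≤ (Bounded-output at₅)))))
    where
    eq₁ : ∀ R h → suc R + (4 * h + 9) ≡ R + 4 * h + 10
    eq₁ = solve-∀
    eq₂ : ∀ R h → suc (suc (h + h) + R) + (2 * h + 8) ≡ R + 4 * h + 10
    eq₂ = solve-∀
    le-Q : ∀ D → suc (D + R) ≤ R + 4 * h + 10 → suc (D * n + N + R * n) ≤ Q
    le-Q D le = ≤-trans (≤-reflexive (eq D N R)) (*-monoˡ-≤ n le)
      where
      eq : ∀ D N R → suc (D * suc N + N + R * suc N) ≡ suc (D + R) * suc N
      eq = solve-∀
    below : ∀ {D D′} (v : Fin n) → D ≤ D′ → D * n + toℕ v ≤ D′ * n + N
    below v le = +-mono-≤ (*-monoˡ-≤ n le) (s≤s⁻¹ (toℕ<n v))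
    ini-S≤ : ∀ v {κ} → κ ∈ ini-S v → κ ≤ N
    ini-S≤ Fin.zero i with ∈-map⁻ (_% n) i
    ... | j , _ , refl = s≤s⁻¹ (m%n<n j n)
    ini-V≤ : ∀ v {κ} → κ ∈ ini-V v → κ ≤ suc (h + h) * n + N
    ini-V≤ v i = ≤-trans (≤-reflexive (ini-V⁻ {v} i)) (below v (off-≤ v))
    ini-X≤ : ∀ v {κ} → κ ∈ ini-X v → κ ≤ N
    ini-X≤ v i = ≤-trans (≤-reflexive (proj₂ (ini-X⁻ {v} i))) (s≤s⁻¹ (toℕ<n v))
    none≤ : suc none ≤ R + 4 * h + 10
    none≤ = by-≡ (R + 6) (eq R h)
      where
      eq : ∀ R h → suc (4 * h + 3) + (R + 6) ≡ R + 4 * h + 10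
      eq = solve-∀
    loop≤ : ∀ v → loop-at v ≤ none
    loop≤ v = loop-≤-none (S v) (F₂.known t v) (F₂.log t v)
    val₁≤ : ∀ v → val₁ v ≤ Q
    val₁≤ v = ≤-trans (below v (loop≤ v)) (≤-trans (+-monoʳ-≤ (none * n) (n≤1+n N))
      (≤-trans (≤-reflexive (+-comm (none * n) n)) (*-monoˡ-≤ n none≤)))
    through≤ : ∀ v → through-at v ≤ Q
    through≤ v = ≤-trans (through-≤-none v) (≤-trans (n≤1+n none) (≤-trans none≤ (m≤m*n (R + 4 * h + 10) n)))

-- Bounds on time, messages and failure

-- The upper bound is `2 n - 2` and not `2 n` so that the induction goes through: rounding up when
-- halving gives only `2 m ≤ n + 1`, and the slack absorbs the 1.
2^⌈log₂⌉-bounds : ∀ n → 2 ≤ n → n ≤ 2 ^ ⌈log₂ n ⌉ × 2 ^ ⌈log₂ n ⌉ + 2 ≤ 2 * n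
2^⌈log₂⌉-bounds n = go n (<-wellFounded n)
  where
  go : ∀ n → Acc _<_ n → 2 ≤ n → n ≤ 2 ^ ⌈log₂ n ⌉ × 2 ^ ⌈log₂ n ⌉ + 2 ≤ 2 * n
  go 2 _ _ = ≤-refl , ≤-refl
  go 1 _ (s≤s ())
  go n@(suc (suc (suc n′))) (acc rs) _ = lower , upper
    where
    m = ⌈ n /2⌉
    ih = go m (rs (⌈n/2⌉<n (suc n′))) (s≤s (s≤s z≤n))
    log≡ : ⌈log₂ n ⌉ ≡ suc ⌈log₂ m ⌉
    log≡ = begin
      ⌈log₂ n ⌉              ≡⟨ m+[n∸m]≡n (⌈log₂⌉-mono-≤ {2} {n} (s≤s (s≤s z≤n))) ⟨
      suc (⌈log₂ n ⌉ ∸ 1)    ≡⟨ cong suc (⌈log₂⌈n/2⌉⌉≡⌈log₂n⌉∸1 n) ⟨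
      suc ⌈log₂ m ⌉          ∎
      where open ≡-Reasoning
    n≤2m : n ≤ 2 * m
    n≤2m = ≤-trans (≤-reflexive (sym (⌊n/2⌋+⌈n/2⌉≡n n))) (+-mono-≤ (⌊n/2⌋≤⌈n/2⌉ n) (≤-reflexive (sym (+-identityʳ m))))
    2m≤1+n : 2 * m ≤ suc n
    2m≤1+n = ≤-trans (+-monoʳ-≤ m (≤-trans (≤-reflexive (+-identityʳ m)) (⌊n/2⌋≤⌈n/2⌉ (suc n))))
      (≤-reflexive (⌊n/2⌋+⌈n/2⌉≡n (suc n)))
    lower : n ≤ 2 ^ ⌈log₂ n ⌉
    lower = subst (λ z → n ≤ 2 ^ z) (sym log≡) (≤-trans n≤2m (*-monoʳ-≤ 2 (proj₁ ih)))
    upper : 2 ^ ⌈log₂ n ⌉ + 2 ≤ 2 * n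
    upper = subst (λ z → 2 ^ z + 2 ≤ 2 * n) (sym log≡) (+-cancelʳ-≤ 2 _ _ (begin
      2 * 2 ^ ⌈log₂ m ⌉ + 2 + 2    ≡⟨ eq (2 ^ ⌈log₂ m ⌉) ⟩
      2 * (2 ^ ⌈log₂ m ⌉ + 2)      ≤⟨ *-monoʳ-≤ 2 (proj₂ ih) ⟩
      2 * (2 * m)                  ≤⟨ *-monoʳ-≤ 2 2m≤1+n ⟩
      2 * suc n                    ≡⟨ eq′ n ⟩
      2 * n + 2                    ∎))
      where
      open ≤-Reasoning
      eq : ∀ z → 2 * z + 2 + 2 ≡ 2 * (z + 2)
      eq = solve-∀
      eq′ : ∀ z → 2 * suc z ≡ 2 * z + 2
      eq′ = solve-∀

n<2^n : ∀ n → n < 2 ^ n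
n<2^n zero    = s≤s z≤n
n<2^n (suc n) = ≤-trans (+-mono-≤ (m^n>0 2 n) (n<2^n n))
  (≤-reflexive (cong (λ z → 2 ^ n + z) (sym (+-identityʳ (2 ^ n)))))

module Bounds (c N h D : ℕ) (2≤n : 2 ≤ suc N) (h≤D : h ≤ D) (D≤N : D ≤ N) where
  open Parameters c N h

  n≤z : n ≤ 2 ^ L
  n≤z = proj₁ (2^⌈log₂⌉-bounds n 2≤n)

  z≤2n : 2 ^ L + 2 ≤ 2 * n
  z≤2n = proj₂ (2^⌈log₂⌉-bounds n 2≤n)

  1≤L : 1 ≤ L
  1≤L = ⌈log₂⌉-mono-≤ {2} {n} 2≤n

  aK≡z : a * K ≡ 2 ^ L
  aK≡z = trans (sym (^-distribˡ-+-* 2 ⌊ L /2⌋ ⌈ L /2⌉)) (cong (2 ^_) (⌊n/2⌋+⌈n/2⌉≡n L))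

  a≤K : a ≤ K
  a≤K = ^-monoʳ-≤ 2 (⌊n/2⌋≤⌈n/2⌉ L)

  K≤z : K ≤ 2 ^ L
  K≤z = ^-monoʳ-≤ 2 (⌈n/2⌉≤n L)

  K≤2a : K ≤ 2 * a
  K≤2a = ^-monoʳ-≤ 2 (⌊n/2⌋-mono (n≤1+n (suc L)))

  s : ℕ
  s = ⌊√ n ⌋

  1≤s : 1 ≤ s
  1≤s with s | proj₂ (⌊√⌋-correct n)
  ... | zero  | s≤s ()
  ... | suc _ | _      = s≤s z≤n

  -- `K² ≤ 2 a K = 2 · 2^L ≤ 4 n < 4 (s + 1)²`, so `K ≤ 2 s + 1`, and `1 ≤ s`.
  K≤4s : K ≤ 4 * s
  K≤4s = ≤-trans (s≤s⁻¹ K<) (≤-trans (+-monoʳ-≤ (2 * s) (≤-trans 1≤s (m≤m+n s _))) (≤-reflexive (eq s)))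
    where
    open ≤-Reasoning
    eq : ∀ s → 2 * s + (s + (s + 0)) ≡ 4 * s
    eq = solve-∀
    eq₁ : ∀ s → 4 * (suc s * suc s) ≡ (2 * suc s) * (2 * suc s)
    eq₁ = solve-∀
    eq₂ : ∀ a K → 2 * a * K ≡ 2 * (a * K)
    eq₂ = solve-∀
    eq₃ : ∀ s → suc (2 * s + 1) ≡ 2 * suc s
    eq₃ = solve-∀
    square : K * K < (2 * suc s) * (2 * suc s)
    square = begin-strict
      K * K                       ≤⟨ *-monoˡ-≤ K K≤2a ⟩
      2 * a * K                   ≡⟨ eq₂ a K ⟩
      2 * (a * K)                 ≡⟨ cong (2 *_) aK≡z ⟩
      2 * 2 ^ L                   ≤⟨ *-monoʳ-≤ 2 (≤-trans (m≤m+n _ 2) z≤2n) ⟩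
      2 * (2 * n)                 ≡⟨ *-assoc 2 2 n ⟨
      4 * n                       <⟨ *-monoʳ-< 4 (proj₂ (⌊√⌋-correct n)) ⟩
      4 * (suc s * suc s)         ≡⟨ eq₁ s ⟩
      (2 * suc s) * (2 * suc s)   ∎
    K< : K < suc (2 * s + 1)
    K< with K <? suc (2 * s + 1)
    ... | yes lt = lt
    ... | no nlt = contradiction square (≤⇒≯ (subst (λ z → z * z ≤ K * K) (eq₃ s) (*-mono-≤ (≮⇒≥ nlt) (≮⇒≥ nlt))))

  C : ℕ
  C = 20 + 20 * c + 48

  -- Five stages and the wave take `5 K + 5 m + 43 h + 48` rounds. `K` and `a` are at most `4 s`,
  -- the constant is absorbed by `1 ≤ s`, and terms without a logarithm by `1 ≤ L`.
  time-≤ : suc R + (suc R + (suc R + (suc R + suc R))) + 3 * suc h ≤ C * (s + D) * L ^ 1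
  time-≤ = begin
    suc R + (suc R + (suc R + (suc R + suc R))) + 3 * suc h
      ≡⟨ eq K a (c * L) h ⟩
    5 * K + 5 * (a * (c * L)) + (43 * h + 48)
      ≤⟨ +-mono-≤ (+-mono-≤ (*-monoʳ-≤ 5 K≤4s) (*-monoʳ-≤ 5 (*-monoˡ-≤ (c * L) (≤-trans a≤K K≤4s))))
           (+-mono-≤ (*-mono-≤ {43} {48} (by-≡ 5 refl) h≤D) (*-monoʳ-≤ 48 1≤s)) ⟩
    5 * (4 * s) + 5 * (4 * s * (c * L)) + (48 * D + 48 * s)
      ≤⟨ by-≡ (20 * D + 20 * c * L * D) (eq′ s D c L) ⟩
    (20 * c) * (s + D) * L + (20 + 48) * (s + D)
      ≤⟨ +-monoʳ-≤ ((20 * c) * (s + D) * L) (≤-trans (≤-reflexive (sym (*-identityʳ _))) (*-monoʳ-≤ ((20 + 48) * (s + D)) 1≤L)) ⟩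
    (20 * c) * (s + D) * L + (20 + 48) * (s + D) * L
      ≡⟨ eq″ c (s + D) L ⟩
    C * (s + D) * (L * 1)  ∎
    where
    open ≤-Reasoning
    eq : ∀ K a q h → suc (K + a * q + 8 * suc h) + (suc (K + a * q + 8 * suc h) + (suc (K + a * q + 8 * suc h) +
           (suc (K + a * q + 8 * suc h) + suc (K + a * q + 8 * suc h)))) + 3 * suc h ≡ 5 * K + 5 * (a * q) + (43 * h + 48)
    eq = solve-∀
    eq′ : ∀ s D c L → 5 * (4 * s) + 5 * (4 * s * (c * L)) + (48 * D + 48 * s) + (20 * D + 20 * c * L * D)
                      ≡ (20 * c) * (s + D) * L + (20 + 48) * (s + D)
    eq′ = solve-∀
    eq″ : ∀ c x L → (20 * c) * x * L + (20 + 48) * x * L ≡ (20 + 20 * c + 48) * x * (L * 1)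
    eq″ = solve-∀

  e : ℕ
  e = (8 + c) * L

  -- Only `m` grows with `c`, and `c * L < 2 ^ (c * L)`; all other terms are constant multiples of
  -- `2 ^ L` at most. The total is at most `64 z² y`, and `64 ≤ z ^ 6`.
  value-bits : suc ((R + 4 * h + 10) * n) ≤ 2 ^ e
  value-bits = begin
    suc ((R + 4 * h + 10) * n)          ≤⟨ s≤s (*-mono-≤ (+-monoˡ-≤ 10 (+-mono-≤ R≤ (*-monoʳ-≤ 4 (≤-trans h≤z z≤zy)))) n≤z) ⟩
    suc ((18 * zy + 4 * zy + 10) * z)   ≤⟨ +-mono-≤ 1≤zyz (*-monoˡ-≤ z (+-monoʳ-≤ (18 * zy + 4 * zy) (*-monoʳ-≤ 10 1≤zy))) ⟩
    zy * z + (18 * zy + 4 * zy + 10 * zy) * z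
                                        ≤⟨ by-≡ (31 * (zy * z)) (eq zy z) ⟩
    64 * (zy * z)                       ≤⟨ *-monoˡ-≤ (zy * z) (^-monoˡ-≤ 6 2≤z) ⟩
    z ^ 6 * (z * y * z)                 ≡⟨ eq′ (z ^ 6) z y ⟩
    z ^ 6 * z * z * y                   ≡⟨ cong (_* y) z^8 ⟩
    2 ^ (8 * L) * 2 ^ (c * L)           ≡⟨ ^-distribˡ-+-* 2 (8 * L) (c * L) ⟨
    2 ^ (8 * L + c * L)                 ≡⟨ cong (2 ^_) (*-distribʳ-+ L 8 c) ⟨
    2 ^ e                               ∎
    where
    open ≤-Reasoning
    z y zy : ℕ
    z = 2 ^ L
    y = 2 ^ (c * L)
    zy = z * y
    2≤z : 2 ≤ z
    2≤z = ^-monoʳ-≤ 2 1≤L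
    1≤y : 1 ≤ y
    1≤y = m^n>0 2 (c * L)
    z≤zy : z ≤ zy
    z≤zy = ≤-trans (≤-reflexive (sym (*-identityʳ z))) (*-monoʳ-≤ z 1≤y)
    1≤zy : 1 ≤ zy
    1≤zy = *-mono-≤ (≤-trans (s≤s z≤n) 2≤z) 1≤y
    1≤zyz : 1 ≤ zy * z
    1≤zyz = *-mono-≤ 1≤zy (≤-trans (s≤s z≤n) 2≤z)
    h≤z : h ≤ z
    h≤z = ≤-trans h≤D (≤-trans D≤N (≤-trans (n≤1+n N) n≤z))
    R≤ : R ≤ 18 * zy
    R≤ = begin
      K + m + 8 * suc h                  ≤⟨ +-mono-≤ (+-mono-≤ (≤-trans K≤z z≤zy) (*-mono-≤ (≤-trans a≤K K≤z) (<⇒≤ (n<2^n (c * L)))))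
                                             (≤-trans (≤-reflexive (*-suc 8 h)) (+-mono-≤ (*-monoʳ-≤ 8 1≤zy) (*-monoʳ-≤ 8 (≤-trans h≤z z≤zy)))) ⟩
      zy + zy + (8 * zy + 8 * zy)        ≡⟨ eq zy ⟩
      18 * zy                            ∎
      where
      eq : ∀ x → x + x + (8 * x + 8 * x) ≡ 18 * x
      eq = solve-∀
    eq : ∀ x z → x * z + (18 * x + 4 * x + 10 * x) * z + 31 * (x * z) ≡ 64 * (x * z)
    eq = solve-∀
    eq′ : ∀ w z y → w * (z * y * z) ≡ w * z * z * y
    eq′ = solve-∀
    z^8 : z ^ 6 * z * z ≡ 2 ^ (8 * L)
    z^8 = trans (eq₆ z) (trans (^-*-assoc 2 L 8) (cong (2 ^_) (*-comm L 8)))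
      where
      eq₆ : ∀ z → z ^ 6 * z * z ≡ z ^ 8
      eq₆ z = trans (*-assoc (z ^ 6) z z)
        (trans (cong (λ w → z ^ 6 * (z * w)) (sym (*-identityʳ z))) (sym (^-distribˡ-+-* z 6 2)))

  b : ℕ
  b = 4 * (8 + c) + 2

  pair-bits : suc (2 * e) + suc (2 * e) ≤ b * L
  pair-bits = begin
    suc (2 * e) + suc (2 * e)        ≡⟨ eq c L ⟩
    4 * (8 + c) * L + 2 * 1          ≤⟨ +-monoʳ-≤ (4 * (8 + c) * L) (*-monoʳ-≤ 2 1≤L) ⟩
    4 * (8 + c) * L + 2 * L          ≡⟨ *-distribʳ-+ L (4 * (8 + c)) 2 ⟨
    b * L                            ∎
    where
    open ≤-Reasoning
    eq : ∀ c L → suc (2 * ((8 + c) * L)) + suc (2 * ((8 + c) * L)) ≡ 4 * (8 + c) * L + 2 * 1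
    eq = solve-∀

  miss-probability : ∀ bad → bad + K ≤ 2 ^ L → bad ^ m * n ^ c ≤ (2 ^ L) ^ m
  miss-probability bad le = subst (λ z → bad ^ m * n ^ c ≤ z ^ m) aK≡z
    (subst (λ a → bad ^ (a * (c * L)) * n ^ c ≤ (a * K) ^ (a * (c * L))) (suc-pred a {{m^n≢0 2 ⌊ L /2⌋}})
      (miss-bound (pred a) K bad n c L
        (subst (λ a → bad + K ≤ a * K) (sym (suc-pred a {{m^n≢0 2 ⌊ L /2⌋}})) (subst (bad + K ≤_) (sym aK≡z) le)) n≤z))

-- Counting vertices and deciding cycles.

does⁺ : ∀ {P : Set} (P? : Dec P) → P → T (does P?)
does⁺ (yes _) p = tt
does⁺ (no ¬p) p = ¬p p

does⁻ : ∀ {P : Set} (P? : Dec P) → T (does P?) → P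
does⁻ (yes p) _ = p

count-filter : ∀ {n} {A : Set} {P : A → Set} (P? : ∀ x → Dec (P x)) (E : ℕ → Bool) a (f : Fin n → A) →
  (∀ u → P (f u) → T (E (toℕ u + a))) → length (filter P? (List.tabulate f)) ≤ count E a n
count-filter {zero}  P? E a f imp = z≤n
count-filter {suc n} P? E a f imp with P? (f Fin.zero) | E a in eq
... | yes p | false = ⊥-elim (subst T eq (imp Fin.zero p))
... | yes p | true  = s≤s (count-filter P? E (suc a) (f ∘ Fin.suc) λ u q → subst (T ∘ E) (sym (+-suc (toℕ u) a)) (imp (Fin.suc u) q))
... | no _  | b     = ≤-trans (count-filter P? E (suc a) (f ∘ Fin.suc) λ u q → subst (T ∘ E) (sym (+-suc (toℕ u) a)) (imp (Fin.suc u) q))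
                        (m≤n+m _ (if b then 1 else 0))

length-filter-mono : ∀ {A : Set} {P Q : A → Set} (P? : ∀ x → Dec (P x)) (Q? : ∀ x → Dec (Q x)) →
  (∀ {x} → P x → Q x) → ∀ xs → length (filter P? xs) ≤ length (filter Q? xs)
length-filter-mono P? Q? imp [] = z≤n
length-filter-mono P? Q? imp (x ∷ xs) with P? x | Q? x
... | yes p | yes q = s≤s (length-filter-mono P? Q? imp xs)
... | yes p | no ¬q = contradiction (imp p) ¬q
... | no _  | yes _ = m≤n⇒m≤1+n (length-filter-mono P? Q? imp xs)
... | no _  | no _  = length-filter-mono P? Q? imp xs

hit : ∀ E {m} (is : Vec ℕ m) → T (not (misses E is)) → ∃[ i ] i ∈ Vec.toList is × T (E i)
hit E (i ∷ is) t with E i in eq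
... | true  = i , here refl , subst T (sym eq) tt
... | false with hit E is t
...   | j , j∈ , Ej = j , there j∈ , Ej

count-true : ∀ a m → count (λ _ → true) a m ≡ m
count-true a zero    = refl
count-true a (suc m) = cong suc (count-true (suc a) m)

argmax-Fin : ∀ {n} (f : Fin (suc n) → ℕ) → ∃[ w ] ∀ v → f v ≤ f w
argmax-Fin {zero}  f = Fin.zero , λ { Fin.zero → ≤-refl }
argmax-Fin {suc n} f with argmax-Fin (f ∘ Fin.suc)
... | w , best with f Fin.zero ≤? f (Fin.suc w)
...   | yes le = Fin.suc w , λ { Fin.zero → le ; (Fin.suc v) → best v }
...   | no nle = Fin.zero , λ { Fin.zero → ≤-refl ; (Fin.suc v) → ≤-trans (best v) (<⇒≤ (≰⇒> nle)) }

module _ {n : ℕ} (G : Graph n) where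

  -- The predicate on vertex lists is arbitrary so that the recursion can absorb the first vertex
  -- into it.
  walk? : ∀ {P : List (Fin n) → Set} → (∀ xs → Dec (P xs)) → ∀ ℓ u v → Dec (Σ[ p ∈ Walk G u v ℓ ] P (vertices G p))
  walk? P? zero u v with u Fin.≟ v
  ... | no ne = no λ { ([] , _) → ne refl }
  ... | yes refl = map′ (λ p → [] , p) (λ { ([] , p) → p }) (P? (u ∷ []))
  walk? P? (suc ℓ) u v = map′ (λ { (w , a , p , x) → a ∷ p , x }) (λ { (_∷_ {v = w} a p , x) → w , a , p , x })
    (Fin.any? λ w → T? (Graph.adj G u w) ×-dec walk? (λ xs → P? (u ∷ xs)) ℓ w v)

  cycle? : ∀ ℓ → Dec (Cycle G ℓ)
  cycle? zero    = no λ ()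
  cycle? (suc ℓ) = map′ (λ { (u , v , (p , un) , le , a) → close p un le a })
    (λ { (close {u} {v} p un le a) → u , v , (p , un) , le , a })
    (Fin.any? λ u → Fin.any? λ v → walk? (UniqueDec.unique? Fin._≟_) ℓ u v ×-dec (2 ≤? ℓ) ×-dec T? (Graph.adj G v u))

  at-mod : ∀ {g} .{{_ : NonZero g}} (C : ClosedTrail G g) i → ClosedTrail.at C i ≡ ClosedTrail.at C (i % g)
  at-mod {g} C i = trans (cong at (m≡m%n+[m/n]*n i g)) (go (i div g))
    where
    open ClosedTrail C
    go : ∀ q → at (i % g + q * g) ≡ at (i % g)
    go zero    = cong at (+-identityʳ (i % g))
    go (suc q) = trans (cong at (trans (cong (λ z → i % g + z) (+-comm g (q * g))) (sym (+-assoc (i % g) (q * g) g))))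
      (trans (period (i % g + q * g)) (go q))

-- The random event that guarantees a short loop.

module Hitting (c N : ℕ) (G : Graph (suc N)) (dist : ∀ u v → ∃[ d ] IsDistance G u v d)
  (h : ℕ) (depth-≤h : ∀ v → Metric.d G dist Fin.zero v ≤ h) (2≤n : 2 ≤ suc N)
  (k half : ℕ) (half≤ : half ≤ suc k) (k≤ : k ≤ half) (1≤k : 1 ≤ k)
  (C : ClosedTrail G (suc (k + half))) (t : ℕ) (R<t : Parameters.R c N h < t) where

  open Parameters c N h
  open Metric G dist
  open ClosedTrail C

  module At (is : Vec ℕ m) = Correctness c N G dist h depth-≤h is t R<t

  g : ℕ
  g = suc (k + half)

  Good : Vec ℕ m → Set
  Good is = ∃[ x ] suc (At.loop-at is x) ≤ 2 * g × At.loop-at is x < none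

  ball : Fin n → ℕ → List (Fin n)
  ball y k = filter (λ u → d u y ≤? k) (allFin n)

  peak⇒Good : ∀ is {k half} {C′ : ClosedTrail G (suc (k + half))} {s} (P : Peak G dist {k} {half} C′ s) →
    At.Informed is s (Peak.y₁ P) → At.Informed is s (Peak.y₂ P) →
    d s (Peak.y₁ P) + d s (Peak.y₂ P) + 3 ≤ 2 * g → Good is
  peak⇒Good is {s = s} P i₁ i₂ sum = x , ≤-trans (s≤s loop≤) (≤-trans (≤-reflexive (sym (+-suc _ 2))) sum) ,
    ≤-<-trans loop≤ (≤-trans (s≤s (+-monoˡ-≤ 2 (+-mono-≤ (At.diam is s y₁) (At.diam is s y₂)))) (≤-reflexive (eq h)))
    where
    open Peak P
    loop≤ : At.loop-at is x ≤ d s y₁ + d s y₂ + 2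
    loop≤ = At.loop-≤ is adj₁ adj₂ y₁≢y₂ below₁ below₂ i₁ i₂
    eq : ∀ h → suc (h + h + (h + h) + 2) ≡ 4 * h + 3
    eq = solve-∀

  n≤z : n ≤ 2 ^ L
  n≤z = proj₁ (2^⌈log₂⌉-bounds n 2≤n)

  module Large (j : ℕ) (large : K < length (ball (at j) k)) where
    -- A draw `i ≥ n` samples the vertex `i % n` but does not count as a hit. At least `K` hits
    -- among the `2 ^ L` values remain, one for each vertex of the ball.
    E : ℕ → Bool
    E i = does (i ∈? map toℕ (ball (at j) k))

    K≤count : K ≤ count E 0 (2 ^ L)
    K≤count = begin
      K                                             ≤⟨ <⇒≤ large ⟩
      length (ball (at j) k)                        ≤⟨ count-filter (λ u → d u (at j) ≤? k) E 0 id member ⟩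
      count E 0 n                                   ≤⟨ m≤m+n _ _ ⟩
      count E 0 n + count E (n + 0) (2 ^ L ∸ n)     ≡⟨ count-+ E 0 n (2 ^ L ∸ n) ⟨
      count E 0 (n + (2 ^ L ∸ n))                   ≡⟨ cong (count E 0) (m+[n∸m]≡n n≤z) ⟩
      count E 0 (2 ^ L)                             ∎
      where
      open ≤-Reasoning
      member : ∀ u → d u (at j) ≤ k → T (E (toℕ u + 0))
      member u le = subst (T ∘ E) (sym (+-identityʳ (toℕ u))) (does⁺ (toℕ u ∈? map toℕ (ball (at j) k))
        (∈-map⁺ toℕ (∈-filter⁺ (λ u → d u (at j) ≤? k) (∈-allFin u) le)))

    good : ∀ is → T (not (misses E is)) → Good is
    good is hits = from-hit (hit E is hits)
      where
      from-source : ∀ u → d u (at j) ≤ k → toℕ u ∈ At.S* is → Good is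
      from-source u le u∈ with near-peak G dist (shift G j C) half≤ k≤ 1≤k u le
      ... | i , l , r , sum = peak⇒Good is (toPeak G dist (shift G j C) half≤ k≤ 1≤k u i l r) (inj₁ u∈) (inj₁ u∈) sum
      from-hit : (∃[ i ] i ∈ Vec.toList is × T (E i)) → Good is
      from-hit (i , i∈ , Ei) with ∈-map⁻ toℕ (does⁻ (i ∈? map toℕ (ball (at j) k)) Ei)
      ... | u , u∈ , refl = from-source u
              (proj₂ (∈-filter⁻ (λ u → d u (at j) ≤? k) {xs = allFin n} u∈))
              (subst (_∈ At.S* is) (m<n⇒m%n≡m (toℕ<n u)) (∈-map⁺ (_% n) i∈))

  module Small (small : ∀ i → length (ball (at i) k) ≤ K) where
    good : ∀ is → Good is
    good is with close-peak G dist C half≤ k≤ 1≤k (at 0) (d-refl (at 0))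
    ... | i , l , r , le₁ , le₂ = peak⇒Good is (toPeak G dist C half≤ k≤ 1≤k (at 0) i l r)
        (inj₂ (shrink i le₁)) (inj₂ (shrink (2 + i) le₂))
        (≤-trans (+-monoˡ-≤ 3 (+-mono-≤ le₁ le₂)) (≤-trans (+-monoʳ-≤ (k + k) (s≤s (s≤s (≤-trans 1≤k k≤))))
          (≤-trans (m≤m+n _ half) (≤-reflexive (eq k half)))))
      where
      shrink : ∀ i → d (at 0) (at i) ≤ k → length (ball (at i) (d (at 0) (at i))) ≤ K
      shrink i le = ≤-trans (length-filter-mono (λ u → d u (at i) ≤? d (at 0) (at i)) (λ u → d u (at i) ≤? k)
        (λ p → ≤-trans p le) (allFin n)) (small i)
      eq : ∀ k half → k + k + (2 + half) + half ≡ 2 * suc (k + half)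
      eq = solve-∀

  -- Either the ball of radius k = ⌊ (g ∸ 1) / 2 ⌋ around some vertex of the
  -- cycle is large, and then it is likely to contain a sampled vertex, or all
  -- these balls are small, and then no token on the cycle is delayed.
  good-event : ∃[ E ] K ≤ count E 0 (2 ^ L) × (∀ is → T (not (misses E is)) → Good is)
  good-event with anyUpTo? (λ j → K <? length (ball (at j) k)) g
  ... | yes (j , _ , large) = Large.E j large , Large.K≤count j large , Large.good j large
  -- Success is certain in this case; the full event lets both cases share one probability bound.
  ... | no ¬large = (λ _ → true) , ≤-trans (^-monoʳ-≤ 2 (⌈n/2⌉≤n L)) (≤-reflexive (sym (count-true 0 (2 ^ L)))) ,
      λ is _ → Small.good small is
    where
    small : ∀ i → length (ball (at i) k) ≤ K
    small i = subst (λ y → length (ball y k) ≤ K) (sym (at-mod G C i))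
      (≮⇒≥ λ lt → ¬large (i % g , m%n<n i g , lt))

-- Time, bandwidth and success of the whole run.

module Main (c N : ℕ) (G : Graph (suc N)) (D g : ℕ) .{{_ : NonZero g}}
  (dist : ∀ u v → ∃[ d ] IsDistance G u v d)
  (h : ℕ) (depth-≤h : ∀ v → Metric.d G dist Fin.zero v ≤ h)
  (w : Fin (suc N)) (deepest : Metric.d G dist Fin.zero w ≡ h)
  (2≤n : 2 ≤ suc N) (h≤D : h ≤ D) (D≤N : D ≤ N)
  (shortest : ∀ ℓ → Cycle G ℓ → g ≤ ℓ)
  (k half : ℕ) (half≤ : half ≤ suc k) (k≤ : k ≤ half) (1≤k : 1 ≤ k)
  (g≡ : g ≡ suc (k + half)) (C : ClosedTrail G (suc (k + half)))
  (t : ℕ) (t≡ : t ≡ suc (Parameters.R c N h)) where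

  open Parameters c N h
  open Execution c N G

  private
    A = algorithm c
    module B = Bounds c N h D 2≤n h≤D D≤N
    module F (is : Vec ℕ m) = Final c N G dist h depth-≤h is t t≡
    module H = Hitting c N G dist h depth-≤h 2≤n k half half≤ k≤ 1≤k C t (≤-reflexive (sym t≡))

  rounds launch-time T-total : ℕ
  rounds  = t + (t + (t + (t + t)))
  launch-time      = 3 * suc h
  T-total = rounds + launch-time

  final : Vec ℕ m → Config A G
  final is = config (prounds rounds (started h is))

  run-total : run A G T-total ≡ (draws L m >>= λ is → ret (final is))
  run-total = run-proc dist h depth-≤h w deepest rounds

  final-output : ∀ is → AllOutput A G (F.answer is) (final is)
  final-output is v = trans (lookup-config (prounds rounds (started h is)) v) (cong toStatus (F.all-halted is v))

  halting : Always (AllHalted A G) (run A G T-total)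
  halting = subst (Always (AllHalted A G)) (sym run-total)
    (Always->>= (draws L m) λ is v → F.answer is , final-output is v)

  T-total-≤ : T-total ≤ (20 + 20 * c + 48) * (⌊√ n ⌋ + D) * L ^ 1
  T-total-≤ = subst (λ t → t + (t + (t + (t + t))) + launch-time ≤ (20 + 20 * c + 48) * (⌊√ n ⌋ + D) * L ^ 1) (sym t≡) B.time-≤

  Success : Config A G → Set
  Success σ = ∃[ o ] AllOutput A G o σ × suc o ≤ 2 * g × Cycle G o

  -- `ProbAtLeast` asks for a Boolean event. The existential over the output is settled by reading
  -- it off at node 0.
  success? : ∀ σ → Dec (Success σ)
  success? σ = from-status (Vec.lookup σ Fin.zero) refl
    where
    halted? : ∀ (s : Status State) o → Dec (s ≡ halted o)
    halted? (running _) o = no λ ()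
    halted? (halted o′) o = map′ (cong halted) (λ { refl → refl }) (o′ ℕ.≟ o)
    from-status : ∀ s → Vec.lookup σ Fin.zero ≡ s → Dec (Success σ)
    from-status (running _) eq = no λ { (o , out , _) → case trans (sym eq) (out Fin.zero) of λ () }
    from-status (halted o)  eq = map′ (λ p → o , p)
      (λ { (o′ , out , p) → case trans (sym eq) (out Fin.zero) of λ { refl → out , p } })
      (Fin.all? (λ u → halted? (Vec.lookup σ u) o) ×-dec (suc o ≤? 2 * g) ×-dec cycle? G o)

  Good⇒Success : ∀ is → H.Good is → Success (final is)
  Good⇒Success is (x , le , lt) = F.answer is , final-output is ,
    ≤-trans (s≤s (proj₁ correct)) (subst (λ g → suc (H.At.loop-at is x) ≤ 2 * g) (sym g≡) le) , proj₂ correct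
    where
    correct = F.answer-correct is x lt

  success-probability : whp n c ℚ.≤ Pr (λ σ → does (success? σ)) (run A G T-total)
  success-probability = from-event H.good-event
    where
    from-event : (∃[ E ] K ≤ count E 0 (2 ^ L) × (∀ is → T (not (misses E is)) → H.Good is)) →
      whp n c ℚ.≤ Pr (λ σ → does (success? σ)) (run A G T-total)
    from-event (E , K≤ , good) = begin
      whp n c                                            ≤⟨ Pr-hits E L m n c (B.miss-probability _ misses-≤) ⟩
      Pr (not ∘ misses E) (draws L m)                    ≤⟨ Pr-mono (draws L m) (λ is hits → does⁺ (success? (final is)) (Good⇒Success is (good is hits))) ⟩
      Pr (λ is → does (success? (final is))) (draws L m) ≡⟨ Pr-map (λ σ → does (success? σ)) (draws L m) final ⟨
      Pr (λ σ → does (success? σ)) (draws L m >>= λ is → ret (final is))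
                                                         ≡⟨ cong (Pr (λ σ → does (success? σ))) run-total ⟨
      Pr (λ σ → does (success? σ)) (run A G T-total)     ∎
      where
      open ℚ.≤-Reasoning
      misses-≤ : count (not ∘ E) 0 (2 ^ L) + K ≤ 2 ^ L
      misses-≤ = ≤-trans (+-monoʳ-≤ _ K≤) (≤-reflexive (trans (+-comm _ (count E 0 (2 ^ L))) (count-not E 0 (2 ^ L))))

  success : ProbAtLeast (whp n c)
    (λ σ → ∃[ g̃ ] AllOutput A G g̃ σ × g ≤ g̃
       × (+ g̃ / 1) ℚ.≤ ((+ 2 / 1) ℚ.- (+ 1 / g)) ℚ.* (+ g / 1) × Cycle G g̃)
    (run A G T-total)
  success = (λ σ → does (success? σ)) ,
    (λ σ s → let (o , out , le , cyc) = does⁻ (success? σ) s in o , out , shortest o cyc , ≤-2g-1 o g le , cyc) ,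
    success-probability

  Q : ℕ
  Q = (R + 4 * h + 10) * n

  encode-bits : ∀ {x} → x ≤ Q → length (encode x) ≤ suc (2 * B.e)
  encode-bits {x} le = length-encode x B.e (≤-trans (s≤s le) B.value-bits)

  bandwidth : Bandwidth A G (4 * (8 + c) + 2)
  bandwidth τ with τ <? launch-time
  ... | yes lt = subst (Always _) (sym (run-wave dist h depth-≤h w deepest τ lt)) λ u v _ →
    ≤-trans (≤-reflexive (cong length (message-running (wave-config τ) u v (lookup∘tabulate (running ∘ waving τ) u))))
      (≤-trans (≤-reflexive (length-++ (encode (far τ u))))
        (≤-trans (+-mono-≤ (encode-bits (≤-trans (far-≤ dist h depth-≤h τ u) 1+h≤Q)) (encode-bits (≤-trans (top-≤ τ u) N≤Q))) B.pair-bits))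
    where
    open Wave N G
    1+h≤Q : suc h ≤ Q
    1+h≤Q = ≤-trans (by-≡ (R + 3 * h + 9) (eq R h)) (m≤m*n (R + 4 * h + 10) n)
      where
      eq : ∀ R h → suc h + (R + 3 * h + 9) ≡ R + 4 * h + 10
      eq = solve-∀
    N≤Q : N ≤ Q
    N≤Q = ≤-trans (n≤1+n N) (≤-trans (≤-reflexive (sym (*-identityˡ n))) (*-monoˡ-≤ n
      (≤-trans (s≤s z≤n) (m≤n+m 10 (R + 4 * h)))))
  ... | no nlt = subst (λ z → Always _ (run A G z)) (m∸n+n≡m (≮⇒≥ nlt))
    (subst (Always _) (sym (run-proc dist h depth-≤h w deepest (τ ∸ launch-time)))
      (Always->>= (draws L m) λ is u v _ → ≤-trans
        (message-length (prounds (τ ∸ launch-time) (started h is)) u v (F.bounded is (τ ∸ launch-time) u))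
        (≤-trans (m≤m+n (suc (2 * B.e)) (suc (2 * B.e))) B.pair-bits)))
    where
    message-length : ∀ p u v → value (p u) ≤ Q → length (message A G (config p) u v) ≤ suc (2 * B.e)
    message-length p u v le = aux (p u) (lookup-config p u) le
      where
      aux : ∀ q → Vec.lookup (config p) u ≡ toStatus q → value q ≤ Q →
        length (message A G (config p) u v) ≤ suc (2 * B.e)
      aux (output o) eq le = ≤-trans (≤-reflexive (cong length (message-halted (config p) u v eq))) z≤n
      aux q@(flood _ _ _ _ _ _ _) eq le =
        ≤-trans (≤-reflexive (cong length (message-running (config p) u v eq))) (encode-bits le)
      aux q@(gossip _ _ _) eq le =
        ≤-trans (≤-reflexive (cong length (message-running (config p) u v eq))) (encode-bits le)

  result : Bandwidth A G (4 * (8 + c) + 2) × (∃[ T ]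
    T ≤ (20 + 20 * c + 48) * (⌊√ n ⌋ + D) * L ^ 1
    × Always (AllHalted A G) (run A G T)
    × ProbAtLeast (whp n c)
        (λ σ → ∃[ g̃ ] AllOutput A G g̃ σ × g ≤ g̃
           × (+ g̃ / 1) ℚ.≤ ((+ 2 / 1) ℚ.- (+ 1 / g)) ℚ.* (+ g / 1) × Cycle G g̃)
        (run A G T))
  result = bandwidth , T-total , T-total-≤ , halting , success

theorem6 : ∀ (c : ℕ) →
    Σ[ A ∈ Algorithm ] ∃[ b ] ∃[ C ] ∃[ k ]
    (∀ (n : ℕ) .{{_ : NonZero n}} (G : Graph n) (D g : ℕ) .{{_ : NonZero g}} →
    IsDiameter G D → IsGirth G g →
    Bandwidth A G b
    × (∃[ T ]
    T ≤ C * (⌊√ n ⌋ + D) * ⌈log₂ n ⌉ ^ k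
    × Always (AllHalted A G) (run A G T)
    × ProbAtLeast (whp n c)
    (λ σ → ∃[ g̃ ]
    AllOutput A G g̃ σ
    × g ≤ g̃
    × (+ g̃ / 1) ℚ.≤ ((+ 2 / 1) ℚ.- (+ 1 / g)) ℚ.* (+ g / 1)
    × Cycle G g̃)
    (run A G T)))
theorem6 c = algorithm c , 4 * (8 + c) + 2 , 20 + 20 * c + 48 , 1 , λ
  -- Without vertices there is no pair to attain the diameter.
  { zero    G D g (_ , () , _)
  ; (suc N) G D g (near , u , v , longest) (cycle , shortest) → conclude N G D g near longest cycle shortest }
  where
  conclude : ∀ N (G : Graph (suc N)) D g .{{_ : NonZero g}} →
    (∀ u v → ∃[ d ] IsDistance G u v d × d ≤ D) → ∀ {u v} → IsDistance G u v D →
    Cycle G g → (∀ ℓ → Cycle G ℓ → g ≤ ℓ) → _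
  conclude N G D g@(suc g′) near (p , p-min) cycle shortest =
    Main.result c N G D g dist h (proj₂ deepest) w refl
      (two N _ _ (ClosedTrail.turn (proj₂ trail) 0)) (proj₂ (proj₂ (near Fin.zero w))) D≤N shortest
      ⌊ g′ /2⌋ ⌈ g′ /2⌉ (⌊n/2⌋-mono (n≤1+n (suc g′))) (⌊n/2⌋≤⌈n/2⌉ g′) (⌊n/2⌋-mono (s≤s⁻¹ (proj₁ trail)))
      g≡ (subst (ClosedTrail G) g≡ (proj₂ trail)) (suc (Parameters.R c N h)) refl
    where
    dist : ∀ u v → ∃[ d ] IsDistance G u v d
    dist u v = let (d , is-d , _) = near u v in d , is-d
    deepest : ∃[ w ] ∀ v → Metric.d G dist Fin.zero v ≤ Metric.d G dist Fin.zero w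
    deepest = argmax-Fin (Metric.d G dist Fin.zero)
    w : Fin (suc N)
    w = proj₁ deepest
    h : ℕ
    h = Metric.d G dist Fin.zero w
    trail : 3 ≤ g × ClosedTrail G g
    trail = Cycle⇒ClosedTrail G cycle
    two : ∀ N (u v : Fin (suc N)) → u ≢ v → 2 ≤ suc N
    two zero    Fin.zero Fin.zero ne = contradiction refl ne
    two (suc N) _        _        _  = s≤s (s≤s z≤n)
    -- A shortest walk of length `D` has `D + 1` distinct vertices. This makes `h` polynomial in
    -- `n`, as the bandwidth bound requires.
    D≤N : D ≤ N
    D≤N = s≤s⁻¹ (subst (_≤ suc N) (length-vertices G p) (Unique⇒length-≤ G (shortest⇒Unique G p p-min)))
    g≡ : g ≡ suc (⌊ g′ /2⌋ + ⌈ g′ /2⌉)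
    g≡ = cong suc (sym (⌊n/2⌋+⌈n/2⌉≡n g′))
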